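{- If $(G,Z)$ is a suspect, then $G$ is not a smooth augmentation of the line graph of a bipartite multigraph.
   Context: Graphs are finite and simple. Stable set: pairwise non-adjacent; strong: meets every maximal clique. Claw-free: no induced $K_{1,3}$. A path is a sequence of distinct vertices $p_0\hbox{ - }\dots\hbox{ - }p_k$ with $p_i$ adjacent to $p_j$ iff $|i-j|=1$; length $k$. Hole of length $k\ge4$: induced $C_k$; antihole: induced complement of $C_k$. Prism: two vertex-disjoint triangles $\{a_1,a_2,a_3\},\{b_1,b_2,b_3\}$ and paths $P_i$ with ends $a_i,b_i$, for $i<j$ only edges between $V(P_i),V(P_j)$ being $a_ia_j,b_ib_j$; odd if all $P_i$ odd. Handcuff: two vertex-disjoint even holes $C_1,C_2$ and a disjoint odd-length path $p_1\hbox{ - }\dots\hbox{ - }p_r$, $p_1$ with exactly two neighbours in $V(C_1)$, adjacent, $p_r$ with exactly two in $V(C_2)$, adjacent, no other edges among the parts. Eye mask: two vertex-disjoint even holes $C_1,C_2$, edges $x_1y_1\in E(C_1),x_2y_2\in E(C_2)$ with $\{x_1,y_1\}$ complete to $\{x_2,y_2\}$, no other edges between $V(C_1),V(C_2)$. Innocent: no odd hole, no antihole of length $\ge6$, no odd prism, handcuff or eye mask. Simplicial vertex: neighbourhood is a clique. Clown: graph on $\{c_0,\dots,c_k\}$, $c_1\hbox{ - }\dots\hbox{ - }c_k\hbox{ - }c_1$ an even hole, $c_0$ (the hat $h(D)$) adjacent to exactly $c_1,c_2$ among $c_1,\dots,c_k$. A vertex $v$ is safe if simplicial and for every clown $D$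 in the graph every path with ends $v,h(D)$ whose vertices other than $h(D)$ are disjoint from and anticomplete to $V(D)\setminus\{h(D)\}$ has odd length. Even pair: every path between the two vertices has even length; consistent: every two members form an even pair. A pair $(G,Z)$ is a suspect if $G$ is a claw-free innocent graph, $Z$ is a consistent set of safe vertices of $G$ such that no strong stable set of $G$ contains $Z$, and $|V(G)|$ is minimum among all graphs $G$ for which such a pair exists. A bipartite multigraph is a loopless multigraph whose vertex set can be partitioned into two stable sets; its line graph has its edges as vertices, two adjacent iff they share an endpoint. A cobipartite graph $(X,Y)$ is a graph whose vertex set is partitioned into two cliques $X,Y$. An edge is flat if it lies in no triangle. Augmenting a flat edge $xy$ of a graph $H$ by a connected cobipartite graph $(X,Y)$ disjoint from $H$ means: take $H\setminus\{x,y\}$ together with $(X,Y)$ and add all edges between $X$ and $N_H(x)\setminus\{y\}$ and all edges between $Y$ and $N_H(y)\setminus\{x\}$. If $x_1y_1,\dots,x_hy_h$ are pairwise disjoint flat edges of $H$ and $(X_1,Y_1),\dots,(X_h,Y_h)$ are pairwise disjoint connected cobipartite graphs disjoint from $H$, the graph obtained by augmenting each $x_iy_i$ by $(X_i,Y_i)$ (the result does not depend on the order) is an augmentation of $H$; it is a smooth augmentation if for each $i$ every vertex of $X_i$ has a neighbour in $Y_i$ and every vertex of $Y_i$ has a neighbour in $X_i$. -}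

module Defs where

open import Data.Nat using (ℕ; zero; suc; _+_; _≤_; _<_)
open import Data.Nat.Divisibility using (_∣_)
open import Data.Fin using (Fin; toℕ; fromℕ; zero; suc; _≟_)
open import Data.Fin.Subset using (Subset; _∈_; _∉_; _⊆_)
open import Data.Bool using (Bool; true; false)
open import Data.Product using (Σ; ∃; _×_; _,_; proj₁; proj₂; ∃-syntax; Σ-syntax)
open import Data.Sum using (_⊎_; inj₁; inj₂)
open import Data.Unit using (⊤; tt)
open import Data.Empty using (⊥)
open import Relation.Nullary using (¬_; yes; no)
open import Relation.Binary.PropositionalEquality using (_≡_; _≢_; refl)
open import Relation.Binary.Construct.Closure.ReflexiveTransitive using (Star)
open import Function.Definitions using (Injective)

record Graph : Set where
  field
    size       : ℕ
    adj        : Fin size → Fin size → Bool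
    adj-sym    : ∀ u v → adj u v ≡ adj v u
    adj-irrefl : ∀ v → adj v v ≡ false

open Graph public

V : Graph → Set
V G = Fin (size G)

E : (G : Graph) → V G → V G → Set
E G u v = adj G u v ≡ true

Even Odd : ℕ → Set
Even k = 2 ∣ k
Odd k = ¬ (2 ∣ k)

record Embedding (G : Graph) (A : Set) (R : A → A → Set) : Set where
  field
    emb     : A → V G
    emb-inj : Injective _≡_ _≡_ emb
    emb-adj : ∀ a b → (E G (emb a) (emb b) → R a b) × (R a b → E G (emb a) (emb b))

open Embedding public

NatAdj : ℕ → ℕ → Set
NatAdj i j = suc i ≡ j ⊎ suc j ≡ i

CycAdj : (k : ℕ) → Fin k → Fin k → Set
CycAdj k i j = NatAdj (toℕ i) (toℕ j)
             ⊎ (toℕ i ≡ 0 × suc (toℕ j) ≡ k)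
             ⊎ (toℕ j ≡ 0 × suc (toℕ i) ≡ k)

AntiAdj : (k : ℕ) → Fin k → Fin k → Set
AntiAdj k i j = i ≢ j × ¬ CycAdj k i j

PathAdj : (k : ℕ) → Fin (suc k) → Fin (suc k) → Set
PathAdj k i j = NatAdj (toℕ i) (toℕ j)

ClawAdj : Fin 4 → Fin 4 → Set
ClawAdj i j = (toℕ i ≡ 0 × toℕ j ≢ 0) ⊎ (toℕ j ≡ 0 × toℕ i ≢ 0)

-- prism with paths P_i of lengths l i, a_i = (i , 0), b_i = (i , l i)
PrismV : (Fin 3 → ℕ) → Set
PrismV l = Σ (Fin 3) (λ i → Fin (suc (l i)))

PrismAdj : (l : Fin 3 → ℕ) → PrismV l → PrismV l → Set
PrismAdj l (i , x) (j , y) =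
  (i ≡ j × NatAdj (toℕ x) (toℕ y))
  ⊎ (i ≢ j × ((toℕ x ≡ 0 × toℕ y ≡ 0) ⊎ (toℕ x ≡ l i × toℕ y ≡ l j)))

-- handcuff: hole C1 (length k1), path p_0 - ... - p_L, hole C2 (length k2);
-- p_0 adjacent exactly to vertices 0,1 of C1, p_L exactly to vertices 0,1 of C2
HandcuffV : ℕ → ℕ → ℕ → Set
HandcuffV k1 L k2 = Fin k1 ⊎ Fin (suc L) ⊎ Fin k2

HandcuffAdj : (k1 L k2 : ℕ) → HandcuffV k1 L k2 → HandcuffV k1 L k2 → Set
HandcuffAdj k1 L k2 (inj₁ a) (inj₁ b) = CycAdj k1 a b
HandcuffAdj k1 L k2 (inj₁ a) (inj₂ (inj₁ p)) = toℕ p ≡ 0 × toℕ a < 2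
HandcuffAdj k1 L k2 (inj₁ a) (inj₂ (inj₂ c)) = ⊥
HandcuffAdj k1 L k2 (inj₂ (inj₁ p)) (inj₁ a) = toℕ p ≡ 0 × toℕ a < 2
HandcuffAdj k1 L k2 (inj₂ (inj₁ p)) (inj₂ (inj₁ q)) = PathAdj L p q
HandcuffAdj k1 L k2 (inj₂ (inj₁ p)) (inj₂ (inj₂ c)) = toℕ p ≡ L × toℕ c < 2
HandcuffAdj k1 L k2 (inj₂ (inj₂ c)) (inj₁ a) = ⊥
HandcuffAdj k1 L k2 (inj₂ (inj₂ c)) (inj₂ (inj₁ p)) = toℕ p ≡ L × toℕ c < 2
HandcuffAdj k1 L k2 (inj₂ (inj₂ c)) (inj₂ (inj₂ d)) = CycAdj k2 c d

-- eye mask: holes C1, C2; edge {0,1} of C1 complete to edge {0,1} of C2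
EyeMaskAdj : (k1 k2 : ℕ) → Fin k1 ⊎ Fin k2 → Fin k1 ⊎ Fin k2 → Set
EyeMaskAdj k1 k2 (inj₁ a) (inj₁ b) = CycAdj k1 a b
EyeMaskAdj k1 k2 (inj₁ a) (inj₂ c) = toℕ a < 2 × toℕ c < 2
EyeMaskAdj k1 k2 (inj₂ c) (inj₁ a) = toℕ a < 2 × toℕ c < 2
EyeMaskAdj k1 k2 (inj₂ c) (inj₂ d) = CycAdj k2 c d

-- clown: hat inj₁ tt adjacent exactly to c_1, c_2 (indices 0,1) of an even hole
ClownAdj : (k : ℕ) → ⊤ ⊎ Fin k → ⊤ ⊎ Fin k → Set
ClownAdj k (inj₁ _) (inj₁ _) = ⊥
ClownAdj k (inj₁ _) (inj₂ a) = toℕ a < 2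
ClownAdj k (inj₂ a) (inj₁ _) = toℕ a < 2
ClownAdj k (inj₂ a) (inj₂ b) = CycAdj k a b

ClawFree : Graph → Set
ClawFree G = ¬ Embedding G (Fin 4) ClawAdj

Hole : Graph → ℕ → Set
Hole G k = 4 ≤ k × Embedding G (Fin k) (CycAdj k)

HasOddHole : Graph → Set
HasOddHole G = ∃[ k ] (Odd k × Hole G k)

HasLongAntihole : Graph → Set
HasLongAntihole G = ∃[ k ] (6 ≤ k × Embedding G (Fin k) (AntiAdj k))

HasOddPrism : Graph → Set
HasOddPrism G = ∃[ l ] ((∀ i → Odd (l i)) × Embedding G (PrismV l) (PrismAdj l))

HasHandcuff : Graph → Set
HasHandcuff G = ∃[ k1 ] ∃[ L ] ∃[ k2 ]
  (4 ≤ k1 × Even k1 × 4 ≤ k2 × Even k2 × Odd L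
   × Embedding G (HandcuffV k1 L k2) (HandcuffAdj k1 L k2))

HasEyeMask : Graph → Set
HasEyeMask G = ∃[ k1 ] ∃[ k2 ]
  (4 ≤ k1 × Even k1 × 4 ≤ k2 × Even k2
   × Embedding G (Fin k1 ⊎ Fin k2) (EyeMaskAdj k1 k2))

Innocent : Graph → Set
Innocent G = ¬ HasOddHole G × ¬ HasLongAntihole G × ¬ HasOddPrism G
           × ¬ HasHandcuff G × ¬ HasEyeMask G

record Path (G : Graph) : Set where
  field
    len  : ℕ
    pemb : Embedding G (Fin (suc len)) (PathAdj len)

  vtx : Fin (suc len) → V G
  vtx = emb pemb

  first last : V G
  first = vtx zero
  last  = vtx (fromℕ len)

open Path public

PathBetween : (G : Graph) → V G → V G → Path G → Set
PathBetween G u v P = (first P ≡ u × last P ≡ v) ⊎ (first P ≡ v × last P ≡ u)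

EvenPair : (G : Graph) → V G → V G → Set
EvenPair G u v = (P : Path G) → PathBetween G u v P → Even (len P)

Consistent : (G : Graph) → Subset (size G) → Set
Consistent G Z = ∀ u v → u ∈ Z → v ∈ Z → u ≢ v → EvenPair G u v

record Clown (G : Graph) : Set where
  field
    ck      : ℕ
    ck-even : Even ck
    ck-4    : 4 ≤ ck
    cemb    : Embedding G (⊤ ⊎ Fin ck) (ClownAdj ck)

  hat : V G
  hat = emb cemb (inj₁ tt)

  body : Fin ck → V G
  body j = emb cemb (inj₂ j)

open Clown public

Simplicial : (G : Graph) → V G → Set
Simplicial G v = ∀ u w → E G v u → E G v w → u ≢ w → E G u w

Safe : (G : Graph) → V G → Set
Safe G v = Simplicial G v ×
  ((D : Clown G) (P : Path G) → PathBetween G v (hat D) P →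
   (∀ i → vtx P i ≢ hat D → ∀ j → vtx P i ≢ body D j × ¬ E G (vtx P i) (body D j)) →
   Odd (len P))

Clique : (G : Graph) → Subset (size G) → Set
Clique G K = ∀ u v → u ∈ K → v ∈ K → u ≢ v → E G u v

MaximalClique : (G : Graph) → Subset (size G) → Set
MaximalClique G K = Clique G K × (∃[ v ] v ∈ K)
                  × (∀ K' → Clique G K' → K ⊆ K' → K' ⊆ K)

Stable : (G : Graph) → Subset (size G) → Set
Stable G S = ∀ u v → u ∈ S → v ∈ S → ¬ E G u v

StrongStable : (G : Graph) → Subset (size G) → Set
StrongStable G S = Stable G S × (∀ K → MaximalClique G K → ∃[ v ] (v ∈ K × v ∈ S))

Bad : (G : Graph) → Subset (size G) → Set
Bad G Z = ClawFree G × Innocent G × Consistent G Z × (∀ v → v ∈ Z → Safe G v)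
        × ¬ (∃[ S ] (StrongStable G S × Z ⊆ S))

Suspect : (G : Graph) → Subset (size G) → Set
Suspect G Z = Bad G Z × (∀ (G' : Graph) (Z' : Subset (size G')) → Bad G' Z' → size G ≤ size G')

record BipMultigraph : Set where
  field
    nV nE    : ℕ
    src tgt  : Fin nE → Fin nV
    side     : Fin nV → Bool
    bipartite : ∀ e → side (src e) ≢ side (tgt e)

open BipMultigraph public

LineAdj : (B : BipMultigraph) → Fin (nE B) → Fin (nE B) → Set
LineAdj B e f = e ≢ f ×
  (src B e ≡ src B f ⊎ src B e ≡ tgt B f ⊎ tgt B e ≡ src B f ⊎ tgt B e ≡ tgt B f)

CobipAdj : (a b : ℕ) → (Fin a → Fin b → Set) → Fin a ⊎ Fin b → Fin a ⊎ Fin b → Set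
CobipAdj a b cr (inj₁ p) (inj₁ q) = p ≢ q
CobipAdj a b cr (inj₁ p) (inj₂ q) = cr p q
CobipAdj a b cr (inj₂ q) (inj₁ p) = cr p q
CobipAdj a b cr (inj₂ p) (inj₂ q) = p ≢ q

Connected : (A : Set) → (A → A → Set) → Set
Connected A R = A × (∀ u v → Star R u v)

record SmoothAug (B : BipMultigraph) : Set₁ where
  field
    h      : ℕ
    x y    : Fin h → Fin (nE B)
    edge   : ∀ i → LineAdj B (x i) (y i)
    flat   : ∀ i z → ¬ (LineAdj B z (x i) × LineAdj B z (y i))
    disj   : ∀ i j → i ≢ j → x i ≢ x j × x i ≢ y j × y i ≢ x j × y i ≢ y j
    a b    : Fin h → ℕ
    cross  : (i : Fin h) → Fin (a i) → Fin (b i) → Set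
    conn   : ∀ i → Connected (Fin (a i) ⊎ Fin (b i)) (CobipAdj (a i) (b i) (cross i))
    smoothX : ∀ i p → ∃[ q ] cross i p q
    smoothY : ∀ i q → ∃[ p ] cross i p q

open SmoothAug public

module _ (B : BipMultigraph) (A : SmoothAug B) where

  -- vertices: untouched vertices of H, plus X_i ∪ Y_i for each i
  AugV : Set
  AugV = (Σ (Fin (nE B)) λ v → ∀ i → v ≢ x A i × v ≢ y A i)
       ⊎ (Σ (Fin (h A)) λ i → Fin (a A i) ⊎ Fin (b A i))

  origin : AugV → Fin (nE B)
  origin (inj₁ (v , _)) = v
  origin (inj₂ (i , inj₁ _)) = x A i
  origin (inj₂ (i , inj₂ _)) = y A i

  AugAdj : AugV → AugV → Set
  AugAdj (inj₂ (i , s)) (inj₂ (j , t)) with i ≟ j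
  ... | yes refl = CobipAdj (a A i) (b A i) (cross A i) s t
  ... | no _     = LineAdj B (origin (inj₂ (i , s))) (origin (inj₂ (j , t)))
  AugAdj (inj₁ u) w = LineAdj B (origin (inj₁ u)) (origin w)
  AugAdj (inj₂ u) (inj₁ w) = LineAdj B (origin (inj₂ u)) (origin (inj₁ w))

Isomorphic : (G : Graph) (A : Set) → (A → A → Set) → Set
Isomorphic G A R = Σ (V G → A) λ f → Σ (A → V G) λ g →
  (∀ v → g (f v) ≡ v) × (∀ w → f (g w) ≡ w) ×
  (∀ u v → (E G u v → R (f u) (f v)) × (R (f u) (f v) → E G u v))

SmoothAugOfLineGraphOfBipartiteMultigraph : Graph → Set₁
SmoothAugOfLineGraphOfBipartiteMultigraph G =
  Σ BipMultigraph λ B → Σ (SmoothAug B) λ A → Isomorphic G (AugV B A) (AugAdj B A)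

{-# OPTIONS --safe #-}
-- In the line graph of a bipartite multigraph a stable set is a matching, and it is strong as soon as
-- it covers every vertex whose star is a maximal clique.  Let N ⊇ Z be a matching missing such a
-- vertex s.  From s start two alternating walks along different edges.  If no exchange along a walk
-- improves N, each walk either ends with an edge of Z or runs into what has been walked before.  As N
-- alternates, all these collisions happen on one side of the bipartition, so the union of the walks
-- yields an odd prism, a handcuff or an eye mask (two cycles), a clown with a path of the wrong parity
-- to a member of Z (one cycle), or a path of the wrong parity between two members of Z (no cycle).
--
-- A suspect that is a smooth augmentation is itself such a line graph, because by minimality each
-- (Xᵢ , Yᵢ) is a single edge or a square.  If Xᵢ ∪ Yᵢ induces a square and more, keep only the square:
-- the smaller graph has a strong stable set containing Z, and its two vertices in the square can be
-- replaced by a nonedge that meets every maximal clique inside Xᵢ ∪ Yᵢ (a bisimplicial edge of the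
-- bipartite complement, which is chordal bipartite since there is no long antihole).  Without a square
-- the neighbourhoods are nested, and at most three vertices of Xᵢ ∪ Yᵢ have to be kept.
module Submission where

open import Defs
open import Data.Nat using (ℕ; zero; suc; _+_; _*_; _∸_; _≤_; _<_; z≤n; s≤s; _≤?_; _<?_)
open import Data.Nat.Properties as ℕₚ
  using (≤-refl; ≤-trans; <-≤-trans; ≤-<-trans; +-suc; +-comm; +-assoc;
    +-identityʳ; suc-injective; m≤m+n; m≤n+m; n≤1+n; <⇒≤; ≤-pred;
    <-irrefl; <-cmp; m≤n⇒m<n∨m≡n; 1+n≰n; 1+n≢n; +-cancelˡ-≡; +-monoʳ-<; +-monoʳ-≤; m+[n∸m]≡n)
open import Data.Nat.Divisibility using (_∣_; divides; ∣m∣n⇒∣m+n; ∣-refl; _∣0)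
open import Data.Fin using (Fin; toℕ; zero; suc; _≟_)
open import Data.Fin.Properties as Finₚ using (toℕ-injective; toℕ<n; toℕ-fromℕ; any?; all?; pigeonhole)
open import Data.Fin.Subset using (Subset; _∈_; _∉_; _⊆_; ∣_∣)
open import Data.Fin.Subset.Properties using (_∈?_; p⊆q⇒∣p∣≤∣q∣; p⊂q⇒∣p∣<∣q∣; ∣p∣≤n)
open import Data.Bool using (Bool; true; false; not)
open import Data.Bool.Properties as Boolₚ using (not-involutive)
open import Data.Vec using (Vec; []; _∷_; tabulate; lookup; here; there)
open import Data.Vec.Properties using (lookup∘tabulate; lookup⇒[]=; []=⇒lookup)
open import Data.Product using (∃; _×_; _,_; proj₁; proj₂; ∃-syntax; Σ-syntax; swap)
open import Data.Sum using (_⊎_; inj₁; inj₂; [_,_]′) renaming (swap to ⊎-swap)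
open import Data.Sum.Properties using (inj₁-injective; inj₂-injective)
open import Data.Unit using (⊤; tt)
open import Data.Empty using (⊥; ⊥-elim)
open import Function using (_∘_; id; case_of_)
open import Function.Definitions using (Injective)
open import Relation.Nullary using (¬_; Dec; yes; no; does; _×-dec_; _⊎-dec_; ¬?)
open import Relation.Nullary.Decidable using (map′; decidable-stable; _→-dec_; toWitness)
open import Relation.Unary using (Decidable)
open import Relation.Binary.Definitions using (tri<; tri≈; tri>)
open import Relation.Binary.PropositionalEquality using (_≡_; _≢_; refl; sym; trans; cong; cong₂; subst; subst₂)
open import Data.Nat.Induction using (<-rec)
import Data.Fin.Subset as Subset using (⊤)
import Data.Fin.Subset.Properties as Subsetₚ
open import Data.Product.Properties using () renaming (≡-dec to ×-≡-dec)

-- Why the collisions happen on one side: after its first joint, an alternating walk meets left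
-- labels only at members of `N`. As `N` is a matching, such a label can recur only together with
-- the right label just before it, and the first left label is uncovered. So a walk that ends in a
-- collision ends at a right label, and a walk that ends with a member of `Z` ends at a left label.
-- This fixes the parity of every piece cut from the walks. The two walks are traversed as a single
-- one, the first of them backwards. If both ends are collisions, let the initial joint reappear at
-- position I and the final joint at position J: I before J gives a handcuff, I = J an eye mask, and
-- J before I an odd prism. Minimality only refutes the absence of a strong set in a smaller graph,
-- so existence statements come doubly negated; this suffices because the goal is a contradiction.
-- Smoothness makes the largest of the nested neighbourhoods the whole opposite side, which is where
-- vertices complete to the other side come from.

module _ {n : ℕ} where

  subsetOf : {P : Fin n → Set} → Decidable P → Subset n
  subsetOf P? = tabulate (λ v → does (P? v))

  ∈-subsetOf⁺ : {P : Fin n → Set} (P? : Decidable P) {v : Fin n} → P v → v ∈ subsetOf P?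
  ∈-subsetOf⁺ P? {v} p = lookup⇒[]= v _ (trans (lookup∘tabulate _ v) (lemma (P? v) p))
    where
    lemma : ∀ {A : Set} (d : Dec A) → A → does d ≡ true
    lemma (yes _) _ = refl
    lemma (no ¬a) a = ⊥-elim (¬a a)

  ∈-subsetOf⁻ : {P : Fin n → Set} (P? : Decidable P) {v : Fin n} → v ∈ subsetOf P? → P v
  ∈-subsetOf⁻ P? {v} m = lemma (P? v) (trans (sym (lookup∘tabulate _ v)) ([]=⇒lookup m))
    where
    lemma : ∀ {A : Set} (d : Dec A) → does d ≡ true → A
    lemma (yes a) _ = a

-- Bounded search and parity

least : {P : ℕ → Set} → Decidable P → ∀ n → P n → ∃[ k ] (k ≤ n × P k × (∀ i → i < k → ¬ P i))
least {P} P? n pn with P? 0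
... | yes p0 = 0 , z≤n , p0 , λ i ()
least {P} P? zero pn | no ¬p0 = ⊥-elim (¬p0 pn)
least {P} P? (suc n) pn | no ¬p0 with least {λ k → P (suc k)} (λ k → P? (suc k)) n pn
... | k , k≤n , pk , min = suc k , s≤s k≤n , pk , λ { zero _ → ¬p0 ; (suc i) (s≤s i<k) → min i i<k }

-- The shape of each pair (Xᵢ , Yᵢ) is known only up to double negation; for finitely many pairs all
-- shapes may be assumed at once.
¬¬-∀Fin : ∀ {n} {P : Fin n → Set} → (∀ i → ¬ ¬ P i) → ¬ ¬ (∀ i → P i)
¬¬-∀Fin {zero}  h k = k λ ()
¬¬-∀Fin {suc n} h k = h zero λ p0 → ¬¬-∀Fin (λ i → h (suc i)) λ ps → k λ { zero → p0 ; (suc i) → ps i }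

∃<? : {P : ℕ → Set} → Decidable P → ∀ n → Dec (∃[ i ] (i < n × P i))
∃<? P? zero = no λ ()
∃<? P? (suc n) with P? n
... | yes p = yes (n , ≤-refl , p)
... | no ¬p with ∃<? P? n
...   | yes (i , i<n , p) = yes (i , ≤-trans i<n (n≤1+n n) , p)
...   | no ¬q = no λ { (i , s≤s i≤n , p) → case m≤n⇒m<n∨m≡n i≤n of λ
          { (inj₁ i<n) → ¬q (i , i<n , p) ; (inj₂ refl) → ¬p p } }

-- Labels change sides at every edge of a walk, so parity of length is read off by comparing the
-- sides of the two ends.
flips : ℕ → Bool → Bool
flips zero    b = b
flips (suc n) b = not (flips n b)

flips-even : ∀ n b → flips n b ≡ b → Even n
flips-even zero b e = 2 ∣0
flips-even (suc zero) true ()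
flips-even (suc zero) false ()
flips-even (suc (suc n)) b e =
  ∣m∣n⇒∣m+n ∣-refl (flips-even n b (trans (sym (not-involutive (flips n b))) e))

odd⇒¬even : ∀ n → Even n → ¬ Even (suc n)
odd⇒¬even n (divides p e) (divides q e') = lemma p q (trans (cong suc (sym e)) e')
  where
  lemma : ∀ p q → suc (p * 2) ≢ q * 2
  lemma zero    (suc q) ()
  lemma (suc p) (suc q) e = lemma p q (suc-injective (suc-injective e))

flips-odd : ∀ n b → flips n b ≡ not b → Odd n
flips-odd n b e ev = odd⇒¬even n ev (flips-even (suc n) b (trans (cong not e) (not-involutive b)))

even≥4 : ∀ k → 3 ≤ k → Even k → 4 ≤ k
even≥4 k 3≤k ev with m≤n⇒m<n∨m≡n 3≤k
... | inj₁ p = p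
... | inj₂ refl = ⊥-elim (odd⇒¬even 2 ∣-refl ev)

-- Cliques and stable sets of a graph

module Graphs (G : Graph) where

  E? : ∀ u v → Dec (E G u v)
  E? u v = Boolₚ._≟_ (adj G u v) true

  E-sym : ∀ {u v} → E G u v → E G v u
  E-sym {u} {v} e = trans (adj-sym G v u) e

  E-irrefl : ∀ {v} → ¬ E G v v
  E-irrefl {v} e with trans (sym (adj-irrefl G v)) e
  ... | ()

  E⇒≢ : ∀ {u v} → E G u v → u ≢ v
  E⇒≢ e refl = E-irrefl e

  -- Adding `w` keeps `K` a clique, so maximality already has it inside.
  maximal-absorbs : ∀ {K w} → MaximalClique G K → (∀ u → u ∈ K → u ≢ w → E G u w) → w ∈ K
  maximal-absorbs {K} {w} (cl , _ , max) h = max K⁺ cl⁺ (λ m → ∈-subsetOf⁺ K⁺? (inj₁ m)) (∈-subsetOf⁺ K⁺? (inj₂ refl))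
    where
    K⁺? : Decidable (λ v → v ∈ K ⊎ v ≡ w)
    K⁺? v = (v ∈? K) ⊎-dec (v ≟ w)
    K⁺ : Subset (size G)
    K⁺ = subsetOf K⁺?
    cl⁺ : Clique G K⁺
    cl⁺ u v u∈ v∈ ne with ∈-subsetOf⁻ K⁺? u∈ | ∈-subsetOf⁻ K⁺? v∈
    ... | inj₁ p | inj₁ q = cl u v p q ne
    ... | inj₁ p | inj₂ refl = h u p ne
    ... | inj₂ refl | inj₁ q = E-sym (h v q (λ e → ne (sym e)))
    ... | inj₂ refl | inj₂ refl = ⊥-elim (ne refl)

  -- An edge between two members would be a path of odd length 1.
  consistent⇒stable : ∀ {Z} → Consistent G Z → Stable G Z
  consistent⇒stable con u v u∈ v∈ e = odd⇒¬even 0 (2 ∣0) (con u v u∈ v∈ (E⇒≢ e) π (inj₁ (refl , refl)))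
    where
    f : Fin 2 → V G
    f zero = u
    f (suc zero) = v
    f-inj : Injective _≡_ _≡_ f
    f-inj {zero} {zero} _ = refl
    f-inj {zero} {suc zero} q = ⊥-elim (E⇒≢ e q)
    f-inj {suc zero} {zero} q = ⊥-elim (E⇒≢ e (sym q))
    f-inj {suc zero} {suc zero} _ = refl
    f-adj : ∀ i j → (E G (f i) (f j) → PathAdj 1 i j) × (PathAdj 1 i j → E G (f i) (f j))
    f-adj zero zero = (λ q → ⊥-elim (E-irrefl q)) , λ { (inj₁ ()) ; (inj₂ ()) }
    f-adj zero (suc zero) = (λ _ → inj₁ refl) , λ _ → e
    f-adj (suc zero) zero = (λ _ → inj₂ refl) , λ _ → E-sym e
    f-adj (suc zero) (suc zero) = (λ q → ⊥-elim (E-irrefl q)) , λ { (inj₁ ()) ; (inj₂ ()) }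
    π : Path G
    π = record { len = 1 ; pemb = record { emb = f ; emb-inj = f-inj ; emb-adj = f-adj } }

-- Line graphs of bipartite multigraphs, as graphs with two vertex labels

IsLabelling : (G : Graph) {P Q : Set} → (V G → P) → (V G → Q) → Set
IsLabelling G l r = ∀ u v →
  (E G u v → u ≢ v × (l u ≡ l v ⊎ r u ≡ r v)) × (u ≢ v × (l u ≡ l v ⊎ r u ≡ r v) → E G u v)

module Geometry (G : Graph) {P Q : Set} (l : V G → P) (r : V G → Q) (labelling : IsLabelling G l r) where
  open Graphs G using (E-sym; E-irrefl; E⇒≢)

  Lab : Set
  Lab = P ⊎ Q

  isLeft : Lab → Bool
  isLeft (inj₁ _) = true
  isLeft (inj₂ _) = false

  -- A vertex of `G` is an edge of the multigraph; here it is traversed from `α` to `β`, in either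
  -- direction.
  Ends : V G → Lab → Lab → Set
  Ends v α β = (α ≡ inj₁ (l v) × β ≡ inj₂ (r v)) ⊎ (α ≡ inj₂ (r v) × β ≡ inj₁ (l v))

  ends-sym : ∀ {v α β} → Ends v α β → Ends v β α
  ends-sym (inj₁ (p , q)) = inj₂ (q , p)
  ends-sym (inj₂ (p , q)) = inj₁ (q , p)

  ends-flip : ∀ {v α β} → Ends v α β → isLeft β ≡ not (isLeft α)
  ends-flip (inj₁ (refl , refl)) = refl
  ends-flip (inj₂ (refl , refl)) = refl

  ends-unique : ∀ {v α β γ δ} → Ends v α β → Ends v γ δ → (α ≡ γ × β ≡ δ) ⊎ (α ≡ δ × β ≡ γ)
  ends-unique (inj₁ (refl , refl)) (inj₁ (refl , refl)) = inj₁ (refl , refl)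
  ends-unique (inj₁ (refl , refl)) (inj₂ (refl , refl)) = inj₂ (refl , refl)
  ends-unique (inj₂ (refl , refl)) (inj₁ (refl , refl)) = inj₂ (refl , refl)
  ends-unique (inj₂ (refl , refl)) (inj₂ (refl , refl)) = inj₁ (refl , refl)

  Share : Lab → Lab → Lab → Lab → Set
  Share α β γ δ = α ≡ γ ⊎ α ≡ δ ⊎ β ≡ γ ⊎ β ≡ δ

  E⇒share : ∀ {u v α β γ δ} → Ends u α β → Ends v γ δ → E G u v → Share α β γ δ
  E⇒share eu ev e with eu | ev | proj₂ (proj₁ (labelling _ _) e)
  ... | inj₁ (refl , refl) | inj₁ (refl , refl) | inj₁ q = inj₁ (cong inj₁ q)
  ... | inj₁ (refl , refl) | inj₁ (refl , refl) | inj₂ q = inj₂ (inj₂ (inj₂ (cong inj₂ q)))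
  ... | inj₁ (refl , refl) | inj₂ (refl , refl) | inj₁ q = inj₂ (inj₁ (cong inj₁ q))
  ... | inj₁ (refl , refl) | inj₂ (refl , refl) | inj₂ q = inj₂ (inj₂ (inj₁ (cong inj₂ q)))
  ... | inj₂ (refl , refl) | inj₁ (refl , refl) | inj₁ q = inj₂ (inj₂ (inj₁ (cong inj₁ q)))
  ... | inj₂ (refl , refl) | inj₁ (refl , refl) | inj₂ q = inj₂ (inj₁ (cong inj₂ q))
  ... | inj₂ (refl , refl) | inj₂ (refl , refl) | inj₁ q = inj₂ (inj₂ (inj₂ (cong inj₁ q)))
  ... | inj₂ (refl , refl) | inj₂ (refl , refl) | inj₂ q = inj₁ (cong inj₂ q)

  private
    common : ∀ {u v α β γ δ} → Ends u α β → Ends v γ δ → α ≡ γ → l u ≡ l v ⊎ r u ≡ r v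
    common (inj₁ (refl , refl)) (inj₁ (refl , refl)) e = inj₁ (inj₁-injective e)
    common (inj₂ (refl , refl)) (inj₂ (refl , refl)) e = inj₂ (inj₂-injective e)
    common (inj₁ (refl , refl)) (inj₂ (refl , refl)) ()
    common (inj₂ (refl , refl)) (inj₁ (refl , refl)) ()

  share⇒E : ∀ {u v α β γ δ} → Ends u α β → Ends v γ δ → u ≢ v → Share α β γ δ → E G u v
  share⇒E eu ev ne s = proj₂ (labelling _ _) (ne , lemma s)
    where
    lemma : Share _ _ _ _ → _
    lemma (inj₁ q)               = common eu ev q
    lemma (inj₂ (inj₁ q))        = common eu (ends-sym ev) q
    lemma (inj₂ (inj₂ (inj₁ q))) = common (ends-sym eu) ev q
    lemma (inj₂ (inj₂ (inj₂ q))) = common (ends-sym eu) (ends-sym ev) q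

  -- A walk of the multigraph with `n` edges `d` and `n + 1` joints `φ`. Both are functions on all
  -- of ℕ with arbitrary values beyond the end, so that shifting, reversing and joining are plain
  -- index changes.
  Seg : ℕ → (ℕ → V G) → (ℕ → Lab) → Set
  Seg n d φ = ∀ x → x < n → Ends (d x) (φ x) (φ (suc x))

  seg-kind : ∀ {n d φ} → Seg n d φ → ∀ x → x ≤ n → isLeft (φ x) ≡ flips x (isLeft (φ 0))
  seg-kind s zero    _   = refl
  seg-kind s (suc x) x<n = trans (ends-flip (s x x<n)) (cong not (seg-kind s x (<⇒≤ x<n)))

  record Pth (n : ℕ) (d : ℕ → V G) (φ : ℕ → Lab) : Set where
    field
      seg : Seg n d φ
      inj : ∀ x y → x ≤ n → y ≤ n → φ x ≡ φ y → x ≡ y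

  -- `3≤k` rules out a pair of parallel edges, which closes up in the multigraph but is no hole of
  -- `G`.
  record Cyc (k : ℕ) (d : ℕ → V G) (φ : ℕ → Lab) : Set where
    field
      seg    : Seg k d φ
      inj    : ∀ x y → x < k → y < k → φ x ≡ φ y → x ≡ y
      closed : φ k ≡ φ 0
      3≤k    : 3 ≤ k

  module PthProps {n d φ} (p : Pth n d φ) where
    open Pth p

    d-inj : ∀ x y → x < n → y < n → d x ≡ d y → x ≡ y
    d-inj x y x<n y<n e with ends-unique (seg x x<n) (subst (λ w → Ends w _ _) (sym e) (seg y y<n))
    ... | inj₁ (q , _) = inj x y (<⇒≤ x<n) (<⇒≤ y<n) q
    ... | inj₂ (q , q') with inj x (suc y) (<⇒≤ x<n) y<n q | inj (suc x) y x<n (<⇒≤ y<n) q'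
    ...   | refl | ()

    adj⇒ : ∀ x y → x < n → y < n → E G (d x) (d y) → NatAdj x y
    adj⇒ x y x<n y<n e with E⇒share (seg x x<n) (seg y y<n) e
    ... | inj₁ q = ⊥-elim (E⇒≢ e (cong d (inj x y (<⇒≤ x<n) (<⇒≤ y<n) q)))
    ... | inj₂ (inj₁ q) = inj₂ (sym (inj x (suc y) (<⇒≤ x<n) y<n q))
    ... | inj₂ (inj₂ (inj₁ q)) = inj₁ (inj (suc x) y x<n (<⇒≤ y<n) q)
    ... | inj₂ (inj₂ (inj₂ q)) =
      ⊥-elim (E⇒≢ e (cong d (suc-injective (inj (suc x) (suc y) x<n y<n q))))

    ⇒adj : ∀ x y → x < n → y < n → NatAdj x y → E G (d x) (d y)
    ⇒adj x y x<n y<n (inj₁ refl) =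
      share⇒E (seg x x<n) (seg y y<n) (λ e → 1+n≢n (sym (d-inj x (suc x) x<n y<n e))) (inj₂ (inj₂ (inj₁ refl)))
    ⇒adj x y x<n y<n (inj₂ refl) =
      share⇒E (seg x x<n) (seg y y<n) (λ e → 1+n≢n (d-inj (suc y) y x<n y<n e)) (inj₂ (inj₁ refl))

    adj-fin : ∀ (i j : Fin n) →
      (E G (d (toℕ i)) (d (toℕ j)) → NatAdj (toℕ i) (toℕ j)) × (NatAdj (toℕ i) (toℕ j) → E G (d (toℕ i)) (d (toℕ j)))
    adj-fin i j = adj⇒ _ _ (toℕ<n i) (toℕ<n j) , ⇒adj _ _ (toℕ<n i) (toℕ<n j)

  CycAdjℕ : ℕ → ℕ → ℕ → Set
  CycAdjℕ k x y = NatAdj x y ⊎ (x ≡ 0 × suc y ≡ k) ⊎ (y ≡ 0 × suc x ≡ k)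

  module CycProps {k d φ} (c : Cyc k d φ) where
    open Cyc c

    even : Even k
    even = flips-even k _ (trans (sym (seg-kind seg k ≤-refl)) (cong isLeft closed))

    4≤k : 4 ≤ k
    4≤k = even≥4 k 3≤k even

    0<k : 0 < k
    0<k = ≤-trans (s≤s z≤n) 3≤k

    1<k : 1 < k
    1<k = ≤-trans (s≤s (s≤s z≤n)) 3≤k

    next : ∀ x → x < k → (suc x < k) ⊎ (suc x ≡ k × φ (suc x) ≡ φ 0)
    next x x<k with m≤n⇒m<n∨m≡n x<k
    ... | inj₁ p = inj₁ p
    ... | inj₂ refl = inj₂ (refl , closed)

    inj-next : ∀ x y → x < k → y < k → φ x ≡ φ (suc y) → x ≡ suc y ⊎ (x ≡ 0 × suc y ≡ k)
    inj-next x y x<k y<k q with next y y<k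
    ... | inj₁ y'<k = inj₁ (inj x (suc y) x<k y'<k q)
    ... | inj₂ (e , q') = inj₂ (inj x 0 x<k 0<k (trans q q') , e)

    inj-next₂ : ∀ x y → x < k → y < k → φ (suc x) ≡ φ (suc y) → x ≡ y
    inj-next₂ x y x<k y<k q with next x x<k
    ... | inj₁ x'<k with inj-next (suc x) y x'<k y<k q
    ...   | inj₁ e = suc-injective e
    ...   | inj₂ (() , _)
    inj-next₂ x y x<k y<k q | inj₂ (e , q') with inj-next 0 y 0<k y<k (trans (sym q') q)
    ...   | inj₁ ()
    ...   | inj₂ (_ , e') = suc-injective (trans e (sym e'))

    d-inj : ∀ x y → x < k → y < k → d x ≡ d y → x ≡ y
    d-inj x y x<k y<k e with ends-unique (seg x x<k) (subst (λ w → Ends w _ _) (sym e) (seg y y<k))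
    ... | inj₁ (q , _) = inj x y x<k y<k q
    ... | inj₂ (q , q') with inj-next x y x<k y<k q | inj-next y x y<k x<k (sym q')
    ...   | inj₁ refl | inj₁ ()
    -- Only a cycle of length 2 could run through one edge in both directions.
    ...   | inj₁ refl | inj₂ (refl , e') = ⊥-elim (<-irrefl refl (subst (3 ≤_) (sym e') 3≤k))
    ...   | inj₂ (refl , e') | inj₁ refl = ⊥-elim (<-irrefl refl (subst (3 ≤_) (sym e') 3≤k))
    ...   | inj₂ (refl , _) | inj₂ (refl , e') = refl

    adj⇒ : ∀ x y → x < k → y < k → E G (d x) (d y) → CycAdjℕ k x y
    adj⇒ x y x<k y<k e with E⇒share (seg x x<k) (seg y y<k) e
    ... | inj₁ q = ⊥-elim (E⇒≢ e (cong d (inj x y x<k y<k q)))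
    ... | inj₂ (inj₁ q) with inj-next x y x<k y<k q
    ...   | inj₁ p = inj₁ (inj₂ (sym p))
    ...   | inj₂ p = inj₂ (inj₁ p)
    adj⇒ x y x<k y<k e | inj₂ (inj₂ (inj₁ q)) with inj-next y x y<k x<k (sym q)
    ...   | inj₁ p = inj₁ (inj₁ (sym p))
    ...   | inj₂ p = inj₂ (inj₂ p)
    adj⇒ x y x<k y<k e | inj₂ (inj₂ (inj₂ q)) = ⊥-elim (E⇒≢ e (cong d (inj-next₂ x y x<k y<k q)))

    ⇒adj : ∀ x y → x < k → y < k → CycAdjℕ k x y → E G (d x) (d y)
    ⇒adj x y x<k y<k a = share⇒E (seg x x<k) (seg y y<k) (λ e → lemma a (d-inj x y x<k y<k e)) (shared a)
      where
      lemma : CycAdjℕ k x y → x ≢ y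
      lemma (inj₁ (inj₁ p)) refl = 1+n≢n p
      lemma (inj₁ (inj₂ p)) refl = 1+n≢n p
      lemma (inj₂ (inj₁ (refl , p))) refl = <-irrefl p 1<k
      lemma (inj₂ (inj₂ (refl , p))) refl = <-irrefl p 1<k
      shared : CycAdjℕ k x y → Share _ _ _ _
      shared (inj₁ (inj₁ refl)) = inj₂ (inj₂ (inj₁ refl))
      shared (inj₁ (inj₂ refl)) = inj₂ (inj₁ refl)
      shared (inj₂ (inj₁ (refl , refl))) = inj₂ (inj₁ (sym closed))
      shared (inj₂ (inj₂ (refl , refl))) = inj₂ (inj₂ (inj₁ closed))

    adj-fin : ∀ (i j : Fin k) →
      (E G (d (toℕ i)) (d (toℕ j)) → CycAdj k i j) × (CycAdj k i j → E G (d (toℕ i)) (d (toℕ j)))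
    adj-fin i j = adj⇒ _ _ (toℕ<n i) (toℕ<n j) , ⇒adj _ _ (toℕ<n i) (toℕ<n j)

  -- The segment meets the cycle exactly in the label that joins the vertices 0 and 1 of the cycle.
  record Attached (k : ℕ) (φ : ℕ → Lab) (n : ℕ) (ψ : ℕ → Lab) (t : ℕ) : Set where
    field
      meet  : ∀ x y → x < k → y ≤ n → φ x ≡ ψ y → x ≡ 1 × y ≡ t
      joint : φ 1 ≡ ψ t

  module AttachedProps {k d φ n p ψ t} (c : Cyc k d φ) (s : Seg n p ψ) (at : Attached k φ n ψ t) where
    open Cyc c
    open CycProps c using (next; 0<k; 1<k)
    open Attached at

    meet-suc : ∀ x y → x < k → y ≤ n → φ (suc x) ≡ ψ y → x ≡ 0 × y ≡ t
    meet-suc x y x<k y≤n q with next x x<k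
    ... | inj₁ x'<k with meet (suc x) y x'<k y≤n q
    ...   | refl , e = refl , e
    meet-suc x y x<k y≤n q | inj₂ (_ , q') with meet 0 y 0<k y≤n (trans (sym q') q)
    ...   | () , _

    distinct : ∀ x y → x < k → y < n → d x ≢ p y
    distinct x y x<k y<n e with ends-unique (seg x x<k) (subst (λ w → Ends w _ _) (sym e) (s y y<n))
    ... | inj₁ (q , q') with meet x y x<k (<⇒≤ y<n) q | meet-suc x (suc y) x<k y<n q'
    ...   | refl , _ | () , _
    distinct x y x<k y<n e | inj₂ (q , q') with meet x (suc y) x<k y<n q | meet-suc x y x<k (<⇒≤ y<n) q'
    ...   | refl , _ | () , _

    adj⇒ : ∀ x y → x < k → y < n → E G (d x) (p y) → x < 2 × (y ≡ t ⊎ suc y ≡ t)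
    adj⇒ x y x<k y<n e with E⇒share (seg x x<k) (s y y<n) e
    ... | inj₁ q with meet x y x<k (<⇒≤ y<n) q
    ...   | refl , e' = s≤s (s≤s z≤n) , inj₁ e'
    adj⇒ x y x<k y<n e | inj₂ (inj₁ q) with meet x (suc y) x<k y<n q
    ...   | refl , e' = s≤s (s≤s z≤n) , inj₂ e'
    adj⇒ x y x<k y<n e | inj₂ (inj₂ (inj₁ q)) with meet-suc x y x<k (<⇒≤ y<n) q
    ...   | refl , e' = s≤s z≤n , inj₁ e'
    adj⇒ x y x<k y<n e | inj₂ (inj₂ (inj₂ q)) with meet-suc x (suc y) x<k y<n q
    ...   | refl , e' = s≤s z≤n , inj₂ e'

    ⇒adj : ∀ x y → x < k → y < n → x < 2 → y ≡ t ⊎ suc y ≡ t → E G (d x) (p y)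
    ⇒adj x y x<k y<n x<2 h = share⇒E (seg x x<k) (s y y<n) (distinct x y x<k y<n) (lemma x x<2 h)
      where
      lemma : ∀ x → x < 2 → y ≡ t ⊎ suc y ≡ t → Share (φ x) (φ (suc x)) (ψ y) (ψ (suc y))
      lemma 0 _ (inj₁ refl) = inj₂ (inj₂ (inj₁ joint))
      lemma 0 _ (inj₂ refl) = inj₂ (inj₂ (inj₂ joint))
      lemma 1 _ (inj₁ refl) = inj₁ joint
      lemma 1 _ (inj₂ refl) = inj₂ (inj₁ joint)
      lemma (suc (suc x)) (s≤s (s≤s ())) _

  private
    toℕ-embedding : ∀ {k} {d : ℕ → V G} → (∀ x y → x < k → y < k → d x ≡ d y → x ≡ y) →
                    {i j : Fin k} → d (toℕ i) ≡ d (toℕ j) → i ≡ j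
    toℕ-embedding inj {i} {j} e = toℕ-injective (inj (toℕ i) (toℕ j) (toℕ<n i) (toℕ<n j) e)

  module _ {k₁ d₁ φ₁ k₂ d₂ φ₂} (c₁ : Cyc k₁ d₁ φ₁) (c₂ : Cyc k₂ d₂ φ₂) where
    private
      module C₁ = CycProps c₁
      module C₂ = CycProps c₂

    -- The common joint has index 1 on both cycles, so the edges meeting there are those with
    -- indices 0 and 1 on either cycle, as an eye mask demands.
    eyeMask : Attached k₁ φ₁ k₂ φ₂ 1 → HasEyeMask G
    eyeMask at = k₁ , k₂ , C₁.4≤k , C₁.even , C₂.4≤k , C₂.even ,
        record { emb = f ; emb-inj = f-inj ; emb-adj = f-adj }
      where
      module A = AttachedProps c₁ (Cyc.seg c₂) at
      f : Fin k₁ ⊎ Fin k₂ → V G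
      f (inj₁ i) = d₁ (toℕ i)
      f (inj₂ j) = d₂ (toℕ j)
      f-inj : Injective _≡_ _≡_ f
      f-inj {inj₁ i} {inj₁ j} e = cong inj₁ (toℕ-embedding C₁.d-inj e)
      f-inj {inj₁ i} {inj₂ j} e = ⊥-elim (A.distinct _ _ (toℕ<n i) (toℕ<n j) e)
      f-inj {inj₂ i} {inj₁ j} e = ⊥-elim (A.distinct _ _ (toℕ<n j) (toℕ<n i) (sym e))
      f-inj {inj₂ i} {inj₂ j} e = cong inj₂ (toℕ-embedding C₂.d-inj e)
      to : ∀ {y} → y ≡ 1 ⊎ suc y ≡ 1 → y < 2
      to (inj₁ refl) = s≤s (s≤s z≤n)
      to (inj₂ refl) = s≤s z≤n
      from : ∀ {y} → y < 2 → y ≡ 1 ⊎ suc y ≡ 1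
      from {0} _ = inj₂ refl
      from {1} _ = inj₁ refl
      from {suc (suc y)} (s≤s (s≤s ()))
      cross⇒ : ∀ i j → E G (d₁ (toℕ i)) (d₂ (toℕ j)) → toℕ i < 2 × toℕ j < 2
      cross⇒ i j e with A.adj⇒ _ _ (toℕ<n i) (toℕ<n j) e
      ... | p , q = p , to q
      f-adj : ∀ a b → (E G (f a) (f b) → EyeMaskAdj k₁ k₂ a b) × (EyeMaskAdj k₁ k₂ a b → E G (f a) (f b))
      f-adj (inj₁ i) (inj₁ j) = C₁.adj-fin i j
      f-adj (inj₁ i) (inj₂ j) = cross⇒ i j , λ { (p , q) → A.⇒adj _ _ (toℕ<n i) (toℕ<n j) p (from q) }
      f-adj (inj₂ i) (inj₁ j) = (λ e → cross⇒ j i (E-sym e)) ,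
        λ { (p , q) → E-sym (A.⇒adj _ _ (toℕ<n j) (toℕ<n i) p (from q)) }
      f-adj (inj₂ i) (inj₂ j) = C₂.adj-fin i j

    -- A path with `suc L` edges in the multigraph is a path of length `L` in `G`. Its first and its
    -- last joint lie on the two cycles, at index 1 of each.
    handcuff : ∀ {L p ψ} → Pth (suc L) p ψ → Odd L →
      Attached k₁ φ₁ (suc L) ψ 0 → Attached k₂ φ₂ (suc L) ψ (suc L) →
      (∀ x y → x < k₁ → y ≤ k₂ → φ₁ x ≢ φ₂ y) → HasHandcuff G
    handcuff {L} {p} {ψ} pth odd at₁ at₂ disjoint =
        k₁ , L , k₂ , C₁.4≤k , C₁.even , C₂.4≤k , C₂.even , odd ,
        record { emb = f ; emb-inj = f-inj ; emb-adj = f-adj }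
      where
      module A₁ = AttachedProps c₁ (Pth.seg pth) at₁
      module A₂ = AttachedProps c₂ (Pth.seg pth) at₂
      module PP = PthProps pth
      disjoint' : ∀ x y → x ≤ k₁ → y ≤ k₂ → φ₁ x ≢ φ₂ y
      disjoint' x y x≤k y≤k e with m≤n⇒m<n∨m≡n x≤k
      ... | inj₁ x<k = disjoint x y x<k y≤k e
      ... | inj₂ refl = disjoint 0 y C₁.0<k y≤k (trans (sym (Cyc.closed c₁)) e)
      apart : ∀ x y → x < k₁ → y < k₂ → ¬ Share (φ₁ x) (φ₁ (suc x)) (φ₂ y) (φ₂ (suc y))
      apart x y p q (inj₁ e) = disjoint' x y (<⇒≤ p) (<⇒≤ q) e
      apart x y p q (inj₂ (inj₁ e)) = disjoint' x (suc y) (<⇒≤ p) q e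
      apart x y p q (inj₂ (inj₂ (inj₁ e))) = disjoint' (suc x) y p (<⇒≤ q) e
      apart x y p q (inj₂ (inj₂ (inj₂ e))) = disjoint' (suc x) (suc y) p q e
      apart-≢ : ∀ x y → x < k₁ → y < k₂ → d₁ x ≢ d₂ y
      apart-≢ x y x<k y<k e with ends-unique (Cyc.seg c₁ x x<k) (subst (λ w → Ends w _ _) (sym e) (Cyc.seg c₂ y y<k))
      ... | inj₁ (q , _) = apart x y x<k y<k (inj₁ q)
      ... | inj₂ (q , _) = apart x y x<k y<k (inj₂ (inj₁ q))
      apart-E : ∀ x y → x < k₁ → y < k₂ → ¬ E G (d₁ x) (d₂ y)
      apart-E x y x<k y<k e = apart x y x<k y<k (E⇒share (Cyc.seg c₁ x x<k) (Cyc.seg c₂ y y<k) e)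
      f : HandcuffV k₁ L k₂ → V G
      f (inj₁ i) = d₁ (toℕ i)
      f (inj₂ (inj₁ j)) = p (toℕ j)
      f (inj₂ (inj₂ j)) = d₂ (toℕ j)
      f-inj : Injective _≡_ _≡_ f
      f-inj {inj₁ i} {inj₁ j} e = cong inj₁ (toℕ-embedding C₁.d-inj e)
      f-inj {inj₁ i} {inj₂ (inj₁ j)} e = ⊥-elim (A₁.distinct _ _ (toℕ<n i) (toℕ<n j) e)
      f-inj {inj₁ i} {inj₂ (inj₂ j)} e = ⊥-elim (apart-≢ _ _ (toℕ<n i) (toℕ<n j) e)
      f-inj {inj₂ (inj₁ i)} {inj₁ j} e = ⊥-elim (A₁.distinct _ _ (toℕ<n j) (toℕ<n i) (sym e))
      f-inj {inj₂ (inj₁ i)} {inj₂ (inj₁ j)} e = cong (λ z → inj₂ (inj₁ z)) (toℕ-embedding PP.d-inj e)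
      f-inj {inj₂ (inj₁ i)} {inj₂ (inj₂ j)} e = ⊥-elim (A₂.distinct _ _ (toℕ<n j) (toℕ<n i) (sym e))
      f-inj {inj₂ (inj₂ i)} {inj₁ j} e = ⊥-elim (apart-≢ _ _ (toℕ<n j) (toℕ<n i) (sym e))
      f-inj {inj₂ (inj₂ i)} {inj₂ (inj₁ j)} e = ⊥-elim (A₂.distinct _ _ (toℕ<n i) (toℕ<n j) e)
      f-inj {inj₂ (inj₂ i)} {inj₂ (inj₂ j)} e = cong (λ z → inj₂ (inj₂ z)) (toℕ-embedding C₂.d-inj e)
      cross₁ : ∀ i (j : Fin (suc L)) → E G (d₁ (toℕ {k₁} i)) (p (toℕ j)) → toℕ j ≡ 0 × toℕ i < 2
      cross₁ i j e with A₁.adj⇒ _ _ (toℕ<n i) (toℕ<n j) e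
      ... | q , inj₁ z = z , q
      cross₂ : ∀ i (j : Fin (suc L)) → E G (d₂ (toℕ {k₂} i)) (p (toℕ j)) → toℕ j ≡ L × toℕ i < 2
      cross₂ i j e with A₂.adj⇒ _ _ (toℕ<n i) (toℕ<n j) e
      ... | q , inj₁ z = ⊥-elim (<-irrefl z (toℕ<n j))
      ... | q , inj₂ z = suc-injective z , q
      f-adj : ∀ a b → (E G (f a) (f b) → HandcuffAdj k₁ L k₂ a b) × (HandcuffAdj k₁ L k₂ a b → E G (f a) (f b))
      f-adj (inj₁ i) (inj₁ j) = C₁.adj-fin i j
      f-adj (inj₁ i) (inj₂ (inj₁ j)) = cross₁ i j , λ { (q , q') → A₁.⇒adj _ _ (toℕ<n i) (toℕ<n j) q' (inj₁ q) }
      f-adj (inj₁ i) (inj₂ (inj₂ j)) = (λ e → ⊥-elim (apart-E _ _ (toℕ<n i) (toℕ<n j) e)) , λ ()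
      f-adj (inj₂ (inj₁ i)) (inj₁ j) = (λ e → cross₁ j i (E-sym e)) ,
        λ { (q , q') → E-sym (A₁.⇒adj _ _ (toℕ<n j) (toℕ<n i) q' (inj₁ q)) }
      f-adj (inj₂ (inj₁ i)) (inj₂ (inj₁ j)) = PP.adj-fin i j
      f-adj (inj₂ (inj₁ i)) (inj₂ (inj₂ j)) = (λ e → cross₂ j i (E-sym e)) ,
        λ { (q , q') → E-sym (A₂.⇒adj _ _ (toℕ<n j) (toℕ<n i) q' (inj₂ (cong suc q))) }
      f-adj (inj₂ (inj₂ i)) (inj₁ j) = (λ e → ⊥-elim (apart-E _ _ (toℕ<n j) (toℕ<n i) (E-sym e))) , λ ()
      f-adj (inj₂ (inj₂ i)) (inj₂ (inj₁ j)) = cross₂ i j ,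
        λ { (q , q') → A₂.⇒adj _ _ (toℕ<n i) (toℕ<n j) q' (inj₂ (cong suc q)) }
      f-adj (inj₂ (inj₂ i)) (inj₂ (inj₂ j)) = C₂.adj-fin i j

  pth⇒Path : ∀ {n d φ} → Pth (suc n) d φ → Σ[ π ∈ Path G ]
    (len π ≡ n × first π ≡ d 0 × last π ≡ d n × (∀ i → vtx π i ≡ d (toℕ i)))
  pth⇒Path {n} {d} p = record { len = n ; pemb = record
      { emb = λ i → d (toℕ i)
      ; emb-inj = toℕ-embedding PP.d-inj
      ; emb-adj = λ i j → PP.adj-fin i j } }
    , refl , refl , cong d (toℕ-fromℕ n) , λ i → refl
    where module PP = PthProps p

  -- The edge `p 0` leaves the cycle at the joint of its edges 0 and 1 and is therefore a hat; the
  -- later edges share no joint with the cycle. The path from the hat to `p n` has the even length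
  -- `n`.
  clown-not-safe : ∀ {k d φ n p ψ} → Cyc k d φ → Pth (suc n) p ψ → Attached k φ (suc n) ψ 0 → Even n →
    ¬ Safe G (p n)
  clown-not-safe {k} {d} {φ} {n} {p} {ψ} c pth at ev (_ , safe) with pth⇒Path pth
  ... | π , refl , first≡ , last≡ , vtx≡ = safe D π (inj₂ (first≡ , last≡)) away ev
    where
    module C = CycProps c
    module A = AttachedProps c (Pth.seg pth) at
    h<n : 0 < suc n
    h<n = s≤s z≤n
    f : ⊤ ⊎ Fin k → V G
    f (inj₁ _) = p 0
    f (inj₂ j) = d (toℕ j)
    f-inj : Injective _≡_ _≡_ f
    f-inj {inj₁ _} {inj₁ _} e = refl
    f-inj {inj₁ _} {inj₂ j} e = ⊥-elim (A.distinct _ _ (toℕ<n j) h<n (sym e))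
    f-inj {inj₂ i} {inj₁ _} e = ⊥-elim (A.distinct _ _ (toℕ<n i) h<n e)
    f-inj {inj₂ i} {inj₂ j} e = cong inj₂ (toℕ-embedding C.d-inj e)
    f-adj : ∀ a b → (E G (f a) (f b) → ClownAdj k a b) × (ClownAdj k a b → E G (f a) (f b))
    f-adj (inj₁ _) (inj₁ _) = E-irrefl , λ ()
    f-adj (inj₁ _) (inj₂ j) = (λ e → proj₁ (A.adj⇒ _ _ (toℕ<n j) h<n (E-sym e))) ,
      λ q → E-sym (A.⇒adj _ _ (toℕ<n j) h<n q (inj₁ refl))
    f-adj (inj₂ i) (inj₁ _) = (λ e → proj₁ (A.adj⇒ _ _ (toℕ<n i) h<n e)) ,
      λ q → A.⇒adj _ _ (toℕ<n i) h<n q (inj₁ refl)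
    f-adj (inj₂ i) (inj₂ j) = C.adj-fin i j
    D : Clown G
    D = record { ck = k ; ck-even = C.even ; ck-4 = C.4≤k
               ; cemb = record { emb = f ; emb-inj = f-inj ; emb-adj = f-adj } }
    away : ∀ i → vtx π i ≢ p 0 → ∀ j → vtx π i ≢ d (toℕ j) × ¬ E G (vtx π i) (d (toℕ j))
    away i ne j rewrite vtx≡ i =
      (λ e → A.distinct _ _ (toℕ<n j) (toℕ<n i) (sym e)) ,
      λ e → case proj₂ (A.adj⇒ _ _ (toℕ<n j) (toℕ<n i) (E-sym e)) of λ
        { (inj₁ z) → ne (cong p z) }

  -- A theta of the multigraph: three paths with common ends and otherwise disjoint. The edges at
  -- the common start form one triangle of the prism, those at the common finish the other.
  module _ (m : Fin 3 → ℕ) (d : Fin 3 → ℕ → V G) (φ : Fin 3 → ℕ → Lab)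
    (pth : ∀ i → Pth (suc (m i)) (d i) (φ i)) (odd : ∀ i → Odd (m i))
    (start : ∀ i j → φ i 0 ≡ φ j 0) (finish : ∀ i j → φ i (suc (m i)) ≡ φ j (suc (m j)))
    (meet : ∀ i j x y → i ≢ j → x ≤ suc (m i) → y ≤ suc (m j) → φ i x ≡ φ j y →
            (x ≡ 0 × y ≡ 0) ⊎ (x ≡ suc (m i) × y ≡ suc (m j))) where
    private
      module PP i = PthProps (pth i)

      f : PrismV m → V G
      f (i , x) = d i (toℕ x)

      m≢0 : ∀ i → m i ≢ 0
      m≢0 i e = odd i (subst Even (sym e) (2 ∣0))

      cross-≢ : ∀ i j → i ≢ j → ∀ x y → x < suc (m i) → y < suc (m j) → d i x ≢ d j y
      cross-≢ i j ne x y p q e with ends-unique (Pth.seg (pth i) x p) (subst (λ w → Ends w _ _) (sym e) (Pth.seg (pth j) y q))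
      ... | inj₁ (a , b) with meet i j x y ne (<⇒≤ p) (<⇒≤ q) a | meet i j (suc x) (suc y) ne p q b
      ...   | inj₂ (refl , _) | _ = <-irrefl refl p
      -- Two of the paths share an edge only if both consist of that edge alone, and then `m i` is
      -- 0.
      ...   | inj₁ (refl , refl) | inj₂ (z , _) = m≢0 i (sym (suc-injective z))
      cross-≢ i j ne x y p q e | inj₂ (a , b) with meet i j x (suc y) ne (<⇒≤ p) q a
      ...   | inj₂ (refl , _) = <-irrefl refl p

      cross⇒ : ∀ i j → i ≢ j → ∀ x y → x < suc (m i) → y < suc (m j) → E G (d i x) (d j y) →
               (x ≡ 0 × y ≡ 0) ⊎ (x ≡ m i × y ≡ m j)
      cross⇒ i j ne x y p q e with E⇒share (Pth.seg (pth i) x p) (Pth.seg (pth j) y q) e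
      ... | inj₁ a with meet i j x y ne (<⇒≤ p) (<⇒≤ q) a
      ...   | inj₁ z = inj₁ z
      ...   | inj₂ (refl , _) = ⊥-elim (<-irrefl refl p)
      cross⇒ i j ne x y p q e | inj₂ (inj₁ a) with meet i j x (suc y) ne (<⇒≤ p) q a
      ...   | inj₂ (refl , _) = ⊥-elim (<-irrefl refl p)
      cross⇒ i j ne x y p q e | inj₂ (inj₂ (inj₁ a)) with meet i j (suc x) y ne p (<⇒≤ q) a
      ...   | inj₂ (_ , refl) = ⊥-elim (<-irrefl refl q)
      cross⇒ i j ne x y p q e | inj₂ (inj₂ (inj₂ a)) with meet i j (suc x) (suc y) ne p q a
      ...   | inj₂ (z , z') = inj₂ (suc-injective z , suc-injective z')

      ⇒cross : ∀ i j → i ≢ j → ∀ x y → x < suc (m i) → y < suc (m j) →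
               (x ≡ 0 × y ≡ 0) ⊎ (x ≡ m i × y ≡ m j) → E G (d i x) (d j y)
      ⇒cross i j ne x y p q h = share⇒E (Pth.seg (pth i) x p) (Pth.seg (pth j) y q) (cross-≢ i j ne x y p q) (lemma h)
        where
        lemma : _ → Share _ _ _ _
        lemma (inj₁ (refl , refl)) = inj₁ (start i j)
        lemma (inj₂ (refl , refl)) = inj₂ (inj₂ (inj₂ (finish i j)))

      f-inj : Injective _≡_ _≡_ f
      f-inj {i , x} {j , y} e with i ≟ j
      ... | yes refl = cong (i ,_) (toℕ-embedding (PP.d-inj i) e)
      ... | no ne = ⊥-elim (cross-≢ i j ne _ _ (toℕ<n x) (toℕ<n y) e)

      f-adj : ∀ a b → (E G (f a) (f b) → PrismAdj m a b) × (PrismAdj m a b → E G (f a) (f b))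
      f-adj (i , x) (j , y) = to , from
        where
        to : E G (d i (toℕ x)) (d j (toℕ y)) → PrismAdj m (i , x) (j , y)
        to e with i ≟ j
        ... | yes refl = inj₁ (refl , PP.adj⇒ i _ _ (toℕ<n x) (toℕ<n y) e)
        ... | no ne = inj₂ (ne , cross⇒ i j ne _ _ (toℕ<n x) (toℕ<n y) e)
        from : PrismAdj m (i , x) (j , y) → E G (d i (toℕ x)) (d j (toℕ y))
        from (inj₁ (refl , a)) = PP.⇒adj i _ _ (toℕ<n x) (toℕ<n y) a
        from (inj₂ (ne , a)) = ⇒cross i j ne _ _ (toℕ<n x) (toℕ<n y) a

    oddPrism : HasOddPrism G
    oddPrism = m , odd , record { emb = f ; emb-inj = f-inj ; emb-adj = f-adj }

-- Obstructions cut from a single walk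

module Walks (G : Graph) {P Q : Set} (l : V G → P) (r : V G → Q) (labelling : IsLabelling G l r) where
  open Geometry G l r labelling

  shift : {A : Set} → ℕ → (ℕ → A) → ℕ → A
  shift o f x = f (o + x)

  shift-seg : ∀ {N c κ} → Seg N c κ → ∀ o n → o + n ≤ N → Seg n (shift o c) (shift o κ)
  shift-seg {c = c} {κ} s o n o+n≤N x x<n =
    subst (λ i → Ends (c (o + x)) (κ (o + x)) (κ i)) (sym (+-suc o x)) (s (o + x) (<-≤-trans (+-monoʳ-< o x<n) o+n≤N))

  -- A walk with `n` edges has `n + 1` joints, hence the two different index reversals.
  reverseV : {A : Set} → ℕ → (ℕ → A) → ℕ → A
  reverseV n d x = d (n ∸ suc x)

  reverseL : {A : Set} → ℕ → (ℕ → A) → ℕ → A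
  reverseL n φ x = φ (n ∸ x)

  reverse-seg : ∀ {n d φ} → Seg n d φ → Seg n (reverseV n d) (reverseL n φ)
  reverse-seg {suc n} {d} {φ} s x (s≤s x≤n) =
    ends-sym (subst (λ i → Ends (d (n ∸ x)) (φ (n ∸ x)) (φ i)) (sym (ℕₚ.+-∸-assoc 1 x≤n)) (s (n ∸ x) (s≤s (ℕₚ.m∸n≤m n x))))

  reverse-pth : ∀ {n d φ} → Pth n d φ → Pth n (reverseV n d) (reverseL n φ)
  reverse-pth {n} p = record
    { seg = reverse-seg (Pth.seg p)
    ; inj = λ x y x≤n y≤n e → ℕₚ.∸-cancelˡ-≡ x≤n y≤n (Pth.inj p _ _ (ℕₚ.m∸n≤m n x) (ℕₚ.m∸n≤m n y) e) }

  -- Turns a cycle by one step, which moves its base joint from index 0 to index 1, where `Attached`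
  -- expects it.
  rotate : {A : Set} → ℕ → (ℕ → A) → ℕ → A
  rotate k f zero    = f k
  rotate k f (suc x) = f x

  rotate-cyc : ∀ {k d φ} → Cyc (suc k) d φ → Cyc (suc k) (rotate k d) (rotate k φ)
  rotate-cyc {k} {d} {φ} c = record { seg = rseg ; inj = rinj ; closed = refl ; 3≤k = 3≤k }
    where
    open Cyc c
    rseg : Seg (suc k) (rotate k d) (rotate k φ)
    rseg zero    _         = subst (Ends (d k) (φ k)) closed (seg k ≤-refl)
    rseg (suc x) (s≤s x<k) = seg x (≤-trans x<k (n≤1+n k))
    rinj : ∀ x y → x < suc k → y < suc k → rotate k φ x ≡ rotate k φ y → x ≡ y
    rinj zero    zero    _         _         e = refl
    rinj zero    (suc y) _         (s≤s y<k) e = ⊥-elim (<-irrefl (sym (inj k y ≤-refl (≤-trans y<k (n≤1+n k)) e)) y<k)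
    rinj (suc x) zero    (s≤s x<k) _         e = ⊥-elim (<-irrefl (inj x k (≤-trans x<k (n≤1+n k)) ≤-refl e) x<k)
    rinj (suc x) (suc y) (s≤s x<k) (s≤s y<k) e = cong suc (inj x y (≤-trans x<k (n≤1+n k)) (≤-trans y<k (n≤1+n k)) e)

  -- Ends on one side make the number of edges even; `m`, the length as a path of `G`, is one less.
  seg-odd : ∀ {m d φ} → Seg (suc m) d φ → isLeft (φ (suc m)) ≡ isLeft (φ 0) → Odd m
  seg-odd {m} s e = flips-odd m _ (trans (sym (not-involutive _)) (cong not (trans (sym (seg-kind s (suc m) ≤-refl)) e)))

  seg-even : ∀ {m d φ} → Seg (suc m) d φ → isLeft (φ (suc m)) ≡ not (isLeft (φ 0)) → Even m
  seg-even {m} s e = flips-even m _ (trans (sym (not-involutive _))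
    (trans (cong not (trans (sym (seg-kind s (suc m) ≤-refl)) e)) (not-involutive _)))

  private
    split≤ : ∀ {m n} → m ≤ n → ∃[ k ] n ≡ m + k
    split≤ {m} {n} p = n ∸ m , sym (m+[n∸m]≡n p)

    split< : ∀ {m n} → m < n → ∃[ k ] n ≡ m + suc k
    split< {m} p with split≤ p
    ... | k , refl = k , sym (+-suc m k)

    m+n≡m⇒n≡0 : ∀ m {n} → m + n ≡ m → n ≡ 0
    m+n≡m⇒n≡0 m {n} e = +-cancelˡ-≡ m n 0 (trans e (sym (+-identityʳ m)))

  module InitialCycle {N c κ} (s : Seg N c κ) (I : ℕ) (I<N : suc I < N) (3≤I : 3 ≤ suc I)
    (inner : ∀ x y → 0 < x → x < N → 0 < y → y < N → κ x ≡ κ y → x ≡ y) (closing : κ 0 ≡ κ (suc I)) where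

    c₁ : ℕ → V G
    c₁ = rotate I c

    κ₁ : ℕ → Lab
    κ₁ = rotate I κ

    cyc₁ : Cyc (suc I) c₁ κ₁
    cyc₁ = rotate-cyc record
      { seg = λ x x<k → s x (ℕₚ.<-trans x<k I<N) ; inj = inj ; closed = sym closing ; 3≤k = 3≤I }
      where
      inj : ∀ x y → x < suc I → y < suc I → κ x ≡ κ y → x ≡ y
      inj zero zero _ _ _ = refl
      inj zero (suc y) _ q e =
        ⊥-elim (<-irrefl (inner (suc y) (suc I) (s≤s z≤n) (ℕₚ.<-trans q I<N) (s≤s z≤n) I<N (trans (sym e) closing)) q)
      inj (suc x) zero p _ e =
        ⊥-elim (<-irrefl (inner (suc x) (suc I) (s≤s z≤n) (ℕₚ.<-trans p I<N) (s≤s z≤n) I<N (trans e closing)) p)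
      inj (suc x) (suc y) p q e = inner (suc x) (suc y) (s≤s z≤n) (ℕₚ.<-trans p I<N) (s≤s z≤n) (ℕₚ.<-trans q I<N) e

    -- The closing joint occurs on the walk at positions 0 and `suc I`. It is reported at `suc I`,
    -- because `inner` says nothing about position 0.
    position : ∀ x → x < suc I → ∃[ i ] (0 < i × i ≤ suc I × κ₁ x ≡ κ i × (i ≡ suc I → x ≡ 1))
    position zero _ = I , ≤-trans (s≤s z≤n) (≤-pred 3≤I) , n≤1+n I , refl , λ e → ⊥-elim (1+n≢n (sym e))
    position (suc zero) _ = suc I , s≤s z≤n , ≤-refl , closing , λ _ → refl
    position (suc (suc x)) p = suc x , s≤s z≤n , <⇒≤ (≤-trans (n≤1+n _) p) , refl ,
      λ e → ⊥-elim (<-irrefl e (≤-trans (n≤1+n _) p))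

  module FinalCycle {c κ} (J k : ℕ) (s : Seg (J + suc k) c κ) (0<J : 0 < J) (3≤k : 3 ≤ suc k)
    (inner : ∀ x y → 0 < x → x < J + suc k → 0 < y → y < J + suc k → κ x ≡ κ y → x ≡ y)
    (closing : κ (J + suc k) ≡ κ J) where

    c₂ : ℕ → V G
    c₂ = rotate k (shift J c)

    κ₂ : ℕ → Lab
    κ₂ = rotate k (shift J κ)

    cyc₂ : Cyc (suc k) c₂ κ₂
    cyc₂ = rotate-cyc record
      { seg = shift-seg s J (suc k) ≤-refl
      ; inj = λ x y p q e → +-cancelˡ-≡ J x y
          (inner (J + x) (J + y) (≤-trans 0<J (m≤m+n J x)) (+-monoʳ-< J p) (≤-trans 0<J (m≤m+n J y)) (+-monoʳ-< J q) e)
      ; closed = trans closing (cong κ (sym (+-identityʳ J))) ; 3≤k = 3≤k }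

    -- The closing joint is reported at position `J`, because `inner` does not reach the last
    -- position.
    position : ∀ x → x ≤ suc k → ∃[ i ] (J ≤ i × i < J + suc k × κ₂ x ≡ κ i × (i ≡ J → x ≡ 1))
    position zero _ = J + k , m≤m+n J k , +-monoʳ-< J ≤-refl , refl ,
      λ e → ⊥-elim (<-irrefl (sym (m+n≡m⇒n≡0 J e)) (≤-trans (s≤s z≤n) (≤-pred 3≤k)))
    position (suc x) (s≤s x≤k) = J + x , m≤m+n J x , +-monoʳ-< J (s≤s x≤k) , refl , λ e → cong suc (m+n≡m⇒n≡0 J e)

  -- A walk whose initial joint and final joint reappear at positions I and J.
  module Dumbbell {c κ} (I J k : ℕ) (s : Seg (J + suc k) c κ) (3≤I : 3 ≤ suc I) (0<J : 0 < J) (3≤k : 3 ≤ suc k)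
    (I<N : suc I < J + suc k)
    (inner : ∀ x y → 0 < x → x < J + suc k → 0 < y → y < J + suc k → κ x ≡ κ y → x ≡ y)
    (closing₁ : κ 0 ≡ κ (suc I)) (closing₂ : κ (J + suc k) ≡ κ J)
    (kinds : isLeft (κ (J + suc k)) ≡ isLeft (κ 0)) where
    private
      N : ℕ
      N = J + suc k

      module C₁ = InitialCycle s I I<N 3≤I inner closing₁
      module C₂ = FinalCycle J k s 0<J 3≤k inner closing₂

      J<N : J < N
      J<N = subst (J <_) (sym (+-suc J k)) (s≤s (m≤m+n J k))

    eye : suc I ≡ J → HasEyeMask G
    eye refl = eyeMask C₁.cyc₁ C₂.cyc₂ record { meet = meet ; joint = trans closing₁ (cong κ (sym (+-identityʳ J))) }
      where
      meet : ∀ x y → x < suc I → y ≤ suc k → C₁.κ₁ x ≡ C₂.κ₂ y → x ≡ 1 × y ≡ 1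
      meet x y p q e with C₁.position x p | C₂.position y q
      ... | i , 0<i , i≤I , e₁ , h₁ | j , J≤j , j<N , e₂ , h₂
        with inner i j 0<i (≤-<-trans i≤I J<N) (≤-trans 0<J J≤j) j<N (trans (sym e₁) (trans e e₂))
      ... | refl = h₁ (ℕₚ.≤-antisym i≤I J≤j) , h₂ (ℕₚ.≤-antisym i≤I J≤j)

    cuff : suc I < J → HasHandcuff G
    cuff I<J with split< I<J
    ... | L , refl = handcuff C₁.cyc₁ C₂.cyc₂ path (seg-odd pseg kind)
                       record { meet = meet₁ ; joint = trans closing₁ (cong κ (sym (+-identityʳ (suc I)))) }
                       record { meet = meet₂ ; joint = cong κ (+-identityʳ J) }
                       disjoint
      where
      pseg : Seg (suc L) (shift (suc I) c) (shift (suc I) κ)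
      pseg = shift-seg s (suc I) (suc L) (<⇒≤ J<N)
      kind : isLeft (κ J) ≡ isLeft (κ (suc I + 0))
      kind = trans (cong isLeft (sym closing₂)) (trans kinds
               (cong isLeft (trans closing₁ (cong κ (sym (+-identityʳ (suc I)))))))
      low : ∀ {x} → x ≤ suc L → suc I + x < N
      low p = ≤-<-trans (+-monoʳ-≤ (suc I) p) J<N
      path : Pth (suc L) (shift (suc I) c) (shift (suc I) κ)
      path = record { seg = pseg ; inj = λ x y p q e → +-cancelˡ-≡ (suc I) x y
               (inner _ _ (s≤s z≤n) (low p) (s≤s z≤n) (low q) e) }
      meet₁ : ∀ x y → x < suc I → y ≤ suc L → C₁.κ₁ x ≡ κ (suc I + y) → x ≡ 1 × y ≡ 0
      meet₁ x y p q e with C₁.position x p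
      ... | i , 0<i , i≤I , e₁ , h
        with inner i (suc I + y) 0<i (≤-<-trans i≤I I<N) (s≤s z≤n) (low q) (trans (sym e₁) e)
      ... | refl with m+n≡m⇒n≡0 (suc I) (ℕₚ.≤-antisym i≤I (m≤m+n (suc I) y))
      ...   | refl = h (+-identityʳ (suc I)) , refl
      meet₂ : ∀ x y → x < suc k → y ≤ suc L → C₂.κ₂ x ≡ κ (suc I + y) → x ≡ 1 × y ≡ suc L
      meet₂ x y p q e with C₂.position x (<⇒≤ p)
      ... | i , J≤i , i<N , e₁ , h
        with inner i (suc I + y) (≤-trans 0<J J≤i) i<N (s≤s z≤n) (low q) (trans (sym e₁) e)
      ... | refl with ℕₚ.≤-antisym q (ℕₚ.+-cancelˡ-≤ (suc I) _ _ J≤i)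
      ...   | refl = h refl , refl
      disjoint : ∀ x y → x < suc I → y ≤ suc k → C₁.κ₁ x ≢ C₂.κ₂ y
      disjoint x y p q e with C₁.position x p | C₂.position y q
      ... | i , 0<i , i≤I , e₁ , h₁ | j , J≤j , j<N , e₂ , h₂
        with inner i j 0<i (≤-<-trans i≤I I<N) (≤-trans 0<J J≤j) j<N (trans (sym e₁) (trans e e₂))
      ... | refl = <-irrefl refl (≤-trans I<J (≤-trans J≤j i≤I))

    -- The two cycles overlap in the stretch from `J` to `suc I`. Three paths join κ (suc I) = κ 0
    -- to κ J = κ N: the stretch from 0 to `J`, the overlap reversed, and the stretch from `suc I`
    -- to `N`.
    prism : J < suc I → HasOddPrism G
    prism J<I with split< 0<J | split< J<I | split< I<N
    ... | m₀ , refl | m₁ , I≡ | m₂ , N≡ = oddPrism m d φ pth odd start finish meet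
      where
      m : Fin 3 → ℕ
      m zero = m₀
      m (suc zero) = m₁
      m (suc (suc zero)) = m₂
      d : Fin 3 → ℕ → V G
      d zero = c
      d (suc zero) = reverseV (suc m₁) (shift J c)
      d (suc (suc zero)) = shift (suc I) c
      φ : Fin 3 → ℕ → Lab
      φ zero = κ
      φ (suc zero) = reverseL (suc m₁) (shift J κ)
      φ (suc (suc zero)) = shift (suc I) κ
      inner' : ∀ {x y} → 0 < x → x < N → 0 < y → y < N → κ x ≡ κ y → x ≡ y
      inner' a b c' d' = inner _ _ a b c' d'
      pth : ∀ i → Pth (suc (m i)) (d i) (φ i)
      pth zero = record { seg = λ x p → s x (ℕₚ.<-trans p J<N) ; inj = inj }
        where
        inj : ∀ x y → x ≤ J → y ≤ J → κ x ≡ κ y → x ≡ y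
        inj zero zero _ _ _ = refl
        inj zero (suc y) _ q e = ⊥-elim (<-irrefl
          (inner' (s≤s z≤n) (≤-<-trans q J<N) (s≤s z≤n) I<N (trans (sym e) closing₁)) (≤-<-trans q J<I))
        inj (suc x) zero p _ e = ⊥-elim (<-irrefl
          (inner' (s≤s z≤n) (≤-<-trans p J<N) (s≤s z≤n) I<N (trans e closing₁)) (≤-<-trans p J<I))
        inj (suc x) (suc y) p q e = inner' (s≤s z≤n) (≤-<-trans p J<N) (s≤s z≤n) (≤-<-trans q J<N) e
      pth (suc zero) = reverse-pth record
        { seg = shift-seg s J (suc m₁) (subst (_≤ N) I≡ (<⇒≤ I<N))
        ; inj = λ x y p q e → +-cancelˡ-≡ J x y (inner' (s≤s z≤n) (low p) (s≤s z≤n) (low q) e) }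
        where
        low : ∀ {x} → x ≤ suc m₁ → J + x < N
        low {x} p = ≤-<-trans (subst (λ n → J + x ≤ n) (sym I≡) (+-monoʳ-≤ J p)) I<N
      pth (suc (suc zero)) = record { seg = shift-seg s (suc I) (suc m₂) (subst (_≤ N) N≡ ≤-refl) ; inj = inj }
        where
        low : ∀ {x} → x < suc m₂ → suc I + x < N
        low {x} p = subst (λ n → suc I + x < n) (sym N≡) (+-monoʳ-< (suc I) p)
        -- Position `N` is beyond the reach of `inner`; its joint is replaced by the equal one at
        -- `J`, which precedes the whole stretch.
        notlast : ∀ x → x < suc m₂ → κ (suc I + x) ≢ κ (suc I + suc m₂)
        notlast x p e = <-irrefl (sym (inner' (s≤s z≤n) (low p) (s≤s z≤n) J<N
          (trans e (trans (cong κ (sym N≡)) closing₂)))) (≤-trans J<I (m≤m+n (suc I) x))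
        inj : ∀ x y → x ≤ suc m₂ → y ≤ suc m₂ → κ (suc I + x) ≡ κ (suc I + y) → x ≡ y
        inj x y p q e with m≤n⇒m<n∨m≡n p | m≤n⇒m<n∨m≡n q
        ... | inj₁ p' | inj₁ q' = +-cancelˡ-≡ (suc I) x y (inner' (s≤s z≤n) (low p') (s≤s z≤n) (low q') e)
        ... | inj₂ refl | inj₂ refl = refl
        ... | inj₁ p' | inj₂ refl = ⊥-elim (notlast x p' e)
        ... | inj₂ refl | inj₁ q' = ⊥-elim (notlast y q' (sym e))
      φ-start : ∀ i → φ i 0 ≡ κ (suc I)
      φ-start zero = closing₁
      φ-start (suc zero) = cong κ (sym I≡)
      φ-start (suc (suc zero)) = cong κ (+-identityʳ (suc I))
      φ-finish : ∀ i → φ i (suc (m i)) ≡ κ J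
      φ-finish zero = refl
      φ-finish (suc zero) = cong κ (trans (cong (J +_) (ℕₚ.n∸n≡0 m₁)) (+-identityʳ J))
      φ-finish (suc (suc zero)) = trans (cong κ (sym N≡)) closing₂
      start : ∀ i j → φ i 0 ≡ φ j 0
      start i j = trans (φ-start i) (sym (φ-start j))
      finish : ∀ i j → φ i (suc (m i)) ≡ φ j (suc (m j))
      finish i j = trans (φ-finish i) (sym (φ-finish j))
      odd : ∀ i → Odd (m i)
      odd i = seg-odd (Pth.seg (pth i)) (cong-kind i)
        where
        cong-kind : ∀ i → isLeft (φ i (suc (m i))) ≡ isLeft (φ i 0)
        cong-kind i = trans (cong isLeft (trans (φ-finish i) (sym closing₂))) (trans kinds
                        (cong isLeft (trans closing₁ (sym (φ-start i)))))
      Interior : Fin 3 → ℕ → Set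
      Interior zero t = 0 < t × t < J
      Interior (suc zero) t = J < t × t < suc I
      Interior (suc (suc zero)) t = suc I < t × t < N
      interior-bounds : ∀ i t → Interior i t → 0 < t × t < N × t ≢ J × t ≢ suc I
      interior-bounds zero t (a , b) = a , ℕₚ.<-trans b J<N , (λ e → <-irrefl e b) , λ e → <-irrefl e (ℕₚ.<-trans b J<I)
      interior-bounds (suc zero) t (a , b) =
        ℕₚ.<-trans 0<J a , ℕₚ.<-trans b I<N , (λ e → <-irrefl (sym e) a) , λ e → <-irrefl e b
      interior-bounds (suc (suc zero)) t (a , b) = ℕₚ.<-trans (s≤s z≤n) a , b ,
        (λ e → <-irrefl (sym e) (ℕₚ.<-trans J<I a)) , λ e → <-irrefl (sym e) a
      interior-disjoint : ∀ i j t → i ≢ j → Interior i t → Interior j t → ⊥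
      interior-disjoint zero zero t ne _ _ = ne refl
      interior-disjoint (suc zero) (suc zero) t ne _ _ = ne refl
      interior-disjoint (suc (suc zero)) (suc (suc zero)) t ne _ _ = ne refl
      interior-disjoint zero (suc zero) t _ (_ , b) (a , _) = ℕₚ.<-asym a b
      interior-disjoint (suc zero) zero t _ (a , _) (_ , b) = ℕₚ.<-asym a b
      interior-disjoint zero (suc (suc zero)) t _ (_ , b) (a , _) = ℕₚ.<-asym (ℕₚ.<-trans J<I a) b
      interior-disjoint (suc (suc zero)) zero t _ (a , _) (_ , b) = ℕₚ.<-asym (ℕₚ.<-trans J<I a) b
      interior-disjoint (suc zero) (suc (suc zero)) t _ (_ , b) (a , _) = ℕₚ.<-asym a b
      interior-disjoint (suc (suc zero)) (suc zero) t _ (a , _) (_ , b) = ℕₚ.<-asym a b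
      data Where (i : Fin 3) (x : ℕ) : Set where
        at-start  : x ≡ 0 → Where i x
        at-finish : x ≡ suc (m i) → Where i x
        inside    : ∀ t → Interior i t → φ i x ≡ κ t → Where i x
      locate : ∀ i x → x ≤ suc (m i) → Where i x
      locate i zero _ = at-start refl
      locate i (suc x) p with m≤n⇒m<n∨m≡n p
      ... | inj₂ e = at-finish e
      locate zero (suc x) _ | inj₁ p = inside (suc x) (s≤s z≤n , p) refl
      locate (suc zero) (suc x) _ | inj₁ (s≤s p) = inside (J + (m₁ ∸ x))
        (subst (J <_) (sym (trans (cong (J +_) e) (+-suc J _))) (s≤s (m≤m+n J _)) ,
         subst (λ n → J + (m₁ ∸ x) < n) (sym I≡) (+-monoʳ-< J (s≤s (ℕₚ.m∸n≤m m₁ x)))) refl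
        where
        e : m₁ ∸ x ≡ suc (m₁ ∸ suc x)
        e = ℕₚ.+-∸-assoc 1 p
      locate (suc (suc zero)) (suc x) _ | inj₁ p = inside (suc I + suc x)
        (subst (suc I <_) (sym (+-suc (suc I) x)) (s≤s (m≤m+n (suc I) x)) ,
         subst (λ n → suc I + suc x < n) (sym N≡) (+-monoʳ-< (suc I) p)) refl
      0<sI : 0 < suc I
      0<sI = s≤s z≤n
      J≢I : J ≢ suc I
      J≢I e = <-irrefl e J<I
      at-φ : ∀ {i x y} → x ≡ y → φ i x ≡ φ i y
      at-φ refl = refl
      meet : ∀ i j x y → i ≢ j → x ≤ suc (m i) → y ≤ suc (m j) → φ i x ≡ φ j y →
             (x ≡ 0 × y ≡ 0) ⊎ (x ≡ suc (m i) × y ≡ suc (m j))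
      meet i j x y ne p q e with locate i x p | locate j y q
      ... | at-start a | at-start b = inj₁ (a , b)
      ... | at-finish a | at-finish b = inj₂ (a , b)
      ... | at-start a | at-finish b = ⊥-elim (J≢I (inner' 0<J J<N 0<sI I<N
            (trans (sym (trans (at-φ {j} b) (φ-finish j))) (trans (sym e) (trans (at-φ {i} a) (φ-start i))))))
      ... | at-finish a | at-start b = ⊥-elim (J≢I (inner' 0<J J<N 0<sI I<N
            (trans (sym (trans (at-φ {i} a) (φ-finish i))) (trans e (trans (at-φ {j} b) (φ-start j))))))
      ... | at-start a | inside t b f with interior-bounds j t b
      ...   | 0<t , t<N , _ , t≢I = ⊥-elim (t≢I (inner' 0<t t<N 0<sI I<N
              (trans (sym f) (trans (sym e) (trans (at-φ {i} a) (φ-start i))))))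
      meet i j x y ne p q e | inside t a f | at-start b with interior-bounds i t a
      ...   | 0<t , t<N , _ , t≢I = ⊥-elim (t≢I (inner' 0<t t<N 0<sI I<N
              (trans (sym f) (trans e (trans (at-φ {j} b) (φ-start j))))))
      meet i j x y ne p q e | at-finish a | inside t b f with interior-bounds j t b
      ...   | 0<t , t<N , t≢J , _ = ⊥-elim (t≢J (inner' 0<t t<N 0<J J<N
              (trans (sym f) (trans (sym e) (trans (at-φ {i} a) (φ-finish i))))))
      meet i j x y ne p q e | inside t a f | at-finish b with interior-bounds i t a
      ...   | 0<t , t<N , t≢J , _ = ⊥-elim (t≢J (inner' 0<t t<N 0<J J<N
              (trans (sym f) (trans e (trans (at-φ {j} b) (φ-finish j))))))
      meet i j x y ne p q e | inside t a f | inside t' b f'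
        with interior-bounds i t a | interior-bounds j t' b
      ... | 0<t , t<N , _ | 0<t' , t'<N , _ with inner' 0<t t<N 0<t' t'<N (trans (sym f) (trans e f'))
      ...   | refl = ⊥-elim (interior-disjoint i j t ne a b)

    not-innocent : ¬ Innocent G
    not-innocent (_ , _ , ¬prism , ¬cuff , ¬eye) with <-cmp (suc I) J
    ... | tri< I<J _ _ = ¬cuff (cuff I<J)
    ... | tri≈ _ I≡J _ = ¬eye (eye I≡J)
    ... | tri> _ _ J<I = ¬prism (prism J<I)

  -- The walk starts with a cycle and goes on as a tail from the base joint. Ends on opposite sides
  -- give the tail an odd number `suc n` of edges, so the path from the hat to the last edge has the
  -- even length `n`.
  lollipop-not-safe : ∀ {c κ} (I n : ℕ) → Seg (suc I + suc n) c κ → 3 ≤ suc I →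
    (∀ x y → 0 < x → x ≤ suc I + suc n → 0 < y → y ≤ suc I + suc n → κ x ≡ κ y → x ≡ y) →
    κ 0 ≡ κ (suc I) → isLeft (κ (suc I + suc n)) ≡ not (isLeft (κ 0)) →
    ¬ Safe G (c (suc I + n))
  lollipop-not-safe {c} {κ} I n s 3≤I inner closing kinds =
    clown-not-safe C₁.cyc₁ path record { meet = meet ; joint = trans closing (cong κ (sym (+-identityʳ (suc I)))) }
      (seg-even pseg (trans kinds (cong (not ∘ isLeft) (trans closing (cong κ (sym (+-identityʳ (suc I))))))))
    where
    I<N : suc I < suc I + suc n
    I<N = subst (suc I <_) (sym (+-suc (suc I) n)) (s≤s (m≤m+n (suc I) n))
    module C₁ = InitialCycle s I I<N 3≤I (λ x y a b a' b' → inner x y a (<⇒≤ b) a' (<⇒≤ b')) closing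
    pseg : Seg (suc n) (shift (suc I) c) (shift (suc I) κ)
    pseg = shift-seg s (suc I) (suc n) ≤-refl
    low : ∀ {x} → x ≤ suc n → suc I + x ≤ suc I + suc n
    low = +-monoʳ-≤ (suc I)
    path : Pth (suc n) (shift (suc I) c) (shift (suc I) κ)
    path = record { seg = pseg ; inj = λ x y p q e → +-cancelˡ-≡ (suc I) x y
             (inner _ _ (s≤s z≤n) (low p) (s≤s z≤n) (low q) e) }
    meet : ∀ x y → x < suc I → y ≤ suc n → C₁.κ₁ x ≡ κ (suc I + y) → x ≡ 1 × y ≡ 0
    meet x y p q e with C₁.position x p
    ... | i , 0<i , i≤I , e₁ , h
      with inner i (suc I + y) 0<i (≤-trans i≤I (<⇒≤ I<N)) (s≤s z≤n) (low q) (trans (sym e₁) e)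
    ... | refl with m+n≡m⇒n≡0 (suc I) (ℕₚ.≤-antisym i≤I (m≤m+n (suc I) y))
    ...   | refl = h (+-identityʳ (suc I)) , refl

  dumbbell : ∀ {N c κ} I J → Seg N c κ → 3 ≤ I → I < N → 0 < J → J + 3 ≤ N →
    (∀ x y → 0 < x → x < N → 0 < y → y < N → κ x ≡ κ y → x ≡ y) →
    κ 0 ≡ κ I → κ N ≡ κ J → isLeft (κ N) ≡ isLeft (κ 0) → ¬ Innocent G
  dumbbell (suc I) J s 3≤I I<N 0<J J+3≤N inner e₁ e₂ kinds with split≤ J+3≤N
  ... | k , N≡ with trans N≡ (+-assoc J 3 k)
  ...   | refl = Dumbbell.not-innocent I J (suc (suc k)) s 3≤I 0<J (s≤s (s≤s (s≤s z≤n))) I<N inner e₁ e₂ kinds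

  lollipop : ∀ {N c κ} I → Seg N c κ → 3 ≤ I → I < N →
    (∀ x y → 0 < x → x ≤ N → 0 < y → y ≤ N → κ x ≡ κ y → x ≡ y) →
    κ 0 ≡ κ I → isLeft (κ N) ≡ not (isLeft (κ 0)) → ¬ Safe G (c (N ∸ 1))
  lollipop {c = c} (suc I) s 3≤I I<N inner e kinds with split< I<N
  ... | n , refl = subst (λ i → ¬ Safe G (c i)) (sym (ℕₚ.+-∸-assoc (suc I) {suc n} (s≤s z≤n)))
                     (lollipop-not-safe I n s 3≤I inner e kinds)

  join : {A : Set} → ℕ → (ℕ → A) → (ℕ → A) → ℕ → A
  join zero    f g         = g
  join (suc n) f g zero    = f 0
  join (suc n) f g (suc x) = join n (f ∘ suc) g x

  join-< : ∀ {A : Set} n {f g : ℕ → A} x → x < n → join n f g x ≡ f x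
  join-< (suc n) zero    _         = refl
  join-< (suc n) (suc x) (s≤s x<n) = join-< n x x<n

  join-+ : ∀ {A : Set} n {f g : ℕ → A} x → join n f g (n + x) ≡ g x
  join-+ zero    x = refl
  join-+ (suc n) x = join-+ n x

  join-≤ : ∀ {A : Set} n {f g : ℕ → A} → f n ≡ g 0 → ∀ x → x ≤ n → join n f g x ≡ f x
  join-≤ n {f} {g} e x x≤n with m≤n⇒m<n∨m≡n x≤n
  ... | inj₁ x<n = join-< n x x<n
  ... | inj₂ refl = trans (cong (join x f g) (sym (+-identityʳ x))) (trans (join-+ x 0) (sym e))

  join-seg : ∀ {n m d φ d' φ'} → Seg n d φ → Seg m d' φ' → φ n ≡ φ' 0 → Seg (n + m) (join n d d') (join n φ φ')
  join-seg {n} {m} {d} {φ} {d'} {φ'} s s' e x x<n+m with x <? n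
  ... | yes x<n rewrite join-< n {d} {d'} x x<n | join-≤ n {φ} {φ'} e x (<⇒≤ x<n) | join-≤ n {φ} {φ'} e (suc x) x<n = s x x<n
  ... | no x≮n with split≤ (ℕₚ.≮⇒≥ x≮n)
  ...   | y , refl with ℕₚ.+-cancelˡ-< n y m x<n+m
  ...     | y<m rewrite join-+ n {d} {d'} y | join-+ n {φ} {φ'} y | sym (+-suc n y) | join-+ n {φ} {φ'} (suc y) = s' y y<m

  -- Two walks from a common joint, traversed as a single walk: the first backwards, then the second.
  -- Only the joints of index below b₁, respectively b₂, are known to be distinct.
  module TwoArms {n₁ n₂ d₁ d₂ φ₁ φ₂} (s₁ : Seg n₁ d₁ φ₁) (s₂ : Seg n₂ d₂ φ₂) (b₁ b₂ : ℕ) (base : φ₁ 0 ≡ φ₂ 0)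
    (inj₁₁ : ∀ i j → i < b₁ → j < b₁ → φ₁ i ≡ φ₁ j → i ≡ j)
    (inj₂₂ : ∀ i j → i < b₂ → j < b₂ → φ₂ i ≡ φ₂ j → i ≡ j)
    (cross : ∀ i j → i < b₁ → j < b₂ → φ₁ i ≡ φ₂ j → i ≡ 0 × j ≡ 0) where

    c : ℕ → V G
    c = join n₁ (reverseV n₁ d₁) d₂

    κ : ℕ → Lab
    κ = join n₁ (reverseL n₁ φ₁) φ₂

    private
      base' : reverseL n₁ φ₁ n₁ ≡ φ₂ 0
      base' = trans (cong φ₁ (ℕₚ.n∸n≡0 n₁)) base

    walk : Seg (n₁ + n₂) c κ
    walk = join-seg (reverse-seg s₁) s₂ base'

    κ-first : ∀ i → i ≤ n₁ → κ (n₁ ∸ i) ≡ φ₁ i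
    κ-first i i≤n = trans (join-≤ n₁ base' (n₁ ∸ i) (ℕₚ.m∸n≤m n₁ i)) (cong φ₁ (ℕₚ.m∸[m∸n]≡n i≤n))

    κ-second : ∀ j → κ (n₁ + j) ≡ φ₂ j
    κ-second j = join-+ n₁ j

    -- Positions whose joint has an index below the bound of its own arm, where distinctness is
    -- known.
    Good : ℕ → Set
    Good x = (x ≤ n₁ × n₁ ∸ x < b₁) ⊎ ∃[ j ] (x ≡ n₁ + j × j < b₂)

    good-inj : ∀ x y → Good x → Good y → κ x ≡ κ y → x ≡ y
    good-inj x y (inj₁ (x≤n , p)) (inj₁ (y≤n , q)) e = ℕₚ.∸-cancelˡ-≡ x≤n y≤n
      (inj₁₁ _ _ p q (trans (sym (join-≤ n₁ base' x x≤n)) (trans e (join-≤ n₁ base' y y≤n))))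
    good-inj x y (inj₂ (i , refl , p)) (inj₂ (j , refl , q)) e =
      cong (n₁ +_) (inj₂₂ i j p q (trans (sym (κ-second i)) (trans e (κ-second j))))
    good-inj x y (inj₁ (x≤n , p)) (inj₂ (j , refl , q)) e
      with cross _ j p q (trans (sym (join-≤ n₁ base' x x≤n)) (trans e (κ-second j)))
    ... | a , refl = trans (ℕₚ.≤-antisym x≤n (ℕₚ.m∸n≡0⇒m≤n a)) (sym (+-identityʳ n₁))
    good-inj x y (inj₂ (i , refl , p)) (inj₁ (y≤n , q)) e
      with cross _ i q p (trans (sym (join-≤ n₁ base' y y≤n)) (trans (sym e) (κ-second i)))
    ... | a , refl = trans (+-identityʳ n₁) (sym (ℕₚ.≤-antisym y≤n (ℕₚ.m∸n≡0⇒m≤n a)))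

    good : ∀ x → (0 < x ⊎ n₁ < b₁) → n₁ ≤ b₁ → (∀ j → x ≡ n₁ + j → j < b₂) → Good x
    good x h n≤b₁ hi with x ≤? n₁
    ... | no x≰n with split≤ (<⇒≤ (ℕₚ.≰⇒> x≰n))
    ...   | j , e = inj₂ (j , e , hi j e)
    good x h n≤b₁ hi | yes x≤n = inj₁ (x≤n , lemma h)
      where
      lemma : (0 < x ⊎ n₁ < b₁) → n₁ ∸ x < b₁
      lemma (inj₂ p) = ≤-<-trans (ℕₚ.m∸n≤m n₁ x) p
      lemma (inj₁ p) = <-≤-trans (ℕₚ.∸-monoʳ-< p x≤n) n≤b₁

    κ-zero : κ 0 ≡ φ₁ n₁
    κ-zero = trans (cong κ (sym (ℕₚ.n∸n≡0 n₁))) (κ-first n₁ ≤-refl)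

    -- Both ends are left out because both may be collisions. In `inner⁺` only the initial end may
    -- be one, in `path` neither.
    inner : n₁ ≤ b₁ → n₂ ≤ b₂ → ∀ x y → 0 < x → x < n₁ + n₂ → 0 < y → y < n₁ + n₂ → κ x ≡ κ y → x ≡ y
    inner h₁ h₂ x y p p' q q' = good-inj x y (lemma x p p') (lemma y q q')
      where
      lemma : ∀ x → 0 < x → x < n₁ + n₂ → Good x
      lemma x p p' = good x (inj₁ p) h₁ λ { j refl → <-≤-trans (ℕₚ.+-cancelˡ-< n₁ j n₂ p') h₂ }

    inner⁺ : n₁ ≤ b₁ → n₂ < b₂ → ∀ x y → 0 < x → x ≤ n₁ + n₂ → 0 < y → y ≤ n₁ + n₂ → κ x ≡ κ y → x ≡ y
    inner⁺ h₁ h₂ x y p p' q q' = good-inj x y (lemma x p p') (lemma y q q')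
      where
      lemma : ∀ x → 0 < x → x ≤ n₁ + n₂ → Good x
      lemma x p p' = good x (inj₁ p) h₁ λ { j refl → ≤-<-trans (ℕₚ.+-cancelˡ-≤ n₁ j n₂ p') h₂ }

    path : n₁ < b₁ → n₂ < b₂ → Pth (n₁ + n₂) c κ
    path h₁ h₂ = record { seg = walk ; inj = λ x y p q → good-inj x y (lemma x p) (lemma y q) }
      where
      lemma : ∀ x → x ≤ n₁ + n₂ → Good x
      lemma x p = good x (inj₂ h₁) (<⇒≤ h₁) λ { j refl → ≤-<-trans (ℕₚ.+-cancelˡ-≤ n₁ j n₂ p) h₂ }

-- Alternating walks and exchange

module Coverage (G : Graph) where

  Cov : {A : Set} → (V G → A) → Subset (size G) → V G → Set
  Cov f M u = ∃[ n ] (n ∈ M × f n ≡ f u)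

  -- If this fails, the class of f u is properly contained in that of f' u, so it is not a maximal clique.
  Need : {A B : Set} → (V G → A) → (V G → B) → V G → Set
  Need f f' u = ∃[ w ] (f w ≡ f u × f' w ≢ f' u) ⊎ (∀ w → f' w ≡ f' u → f w ≡ f u)

module Augmenting (G : Graph) {P Q : Set} (_≟P_ : (a b : P) → Dec (a ≡ b)) (_≟Q_ : (a b : Q) → Dec (a ≡ b))
  (l : V G → P) (r : V G → Q) (labelling : IsLabelling G l r)
  (N : Subset (size G)) (N-stable : Stable G N) where
  open Geometry G l r labelling
  open Walks G l r labelling
  open Coverage G

  N-l-inj : ∀ {m m'} → m ∈ N → m' ∈ N → l m ≡ l m' → m ≡ m'
  N-l-inj {m} {m'} p q e with m ≟ m'
  ... | yes refl = refl
  ... | no ne = ⊥-elim (N-stable m m' p q (proj₂ (labelling m m') (ne , inj₁ e)))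

  N-r-inj : ∀ {m m'} → m ∈ N → m' ∈ N → r m ≡ r m' → m ≡ m'
  N-r-inj {m} {m'} p q e with m ≟ m'
  ... | yes refl = refl
  ... | no ne = ⊥-elim (N-stable m m' p q (proj₂ (labelling m m') (ne , inj₂ e)))

  Mate : V G → V G → Set
  Mate e n = n ∈ N × r n ≡ r e

  Alt : V G → V G → Set
  Alt m e = l e ≡ l m × r e ≢ r m

  mate? : ∀ e → Dec (∃ (Mate e))
  mate? e = any? (λ n → (n ∈? N) ×-dec (r n ≟Q r e))

  alt? : ∀ m → Dec (∃ (Alt m))
  alt? m = any? (λ e → (l e ≟P l m) ×-dec ¬? (r e ≟Q r m))

  mate alt : V G → V G
  mate e with mate? e
  ... | yes (n , _) = n
  ... | no _ = e
  alt m with alt? m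
  ... | yes (e , _) = e
  ... | no _ = m

  mate-spec : ∀ {e n} → Mate e n → mate e ∈ N × r (mate e) ≡ r e
  mate-spec {e} h with mate? e
  ... | yes (_ , p) = p
  ... | no ¬p = ⊥-elim (¬p (_ , h))

  -- This holds even for the default value `m`, so it needs no hypothesis.
  alt-l : ∀ m → l (alt m) ≡ l m
  alt-l m with alt? m
  ... | yes (_ , p , _) = p
  ... | no _ = refl

  alt-r : ∀ {m e} → Alt m e → r (alt m) ≢ r m
  alt-r {m} h with alt? m
  ... | yes (_ , _ , p) = p
  ... | no ¬p = ⊥-elim (¬p (_ , h))

  -- The alternating walk from g: e₀ = g, each mᵢ ∈ N matches the right label of eᵢ, and eᵢ₊₁ leaves the left label of mᵢ.
  es ms : V G → ℕ → V G
  es g zero    = g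
  es g (suc i) = alt (ms g i)
  ms g i = mate (es g i)

  -- mate and alt return their argument when there is nothing to choose, so matched has to be asserted.
  record Core (g : V G) (k : ℕ) : Set where
    field
      matched : ∀ i → i < k → ms g i ∈ N × r (ms g i) ≡ r (es g i)
      fresh   : ∀ i j → i < k → j < k → r (es g i) ≡ r (es g j) → i ≡ j

  -- Doubling by recursion on the argument, so that indices of interleaved sequences reduce two
  -- steps at a time.
  dbl : ℕ → ℕ
  dbl zero    = zero
  dbl (suc n) = suc (suc (dbl n))

  dbl-mono-≤ : ∀ {i j} → i ≤ j → dbl i ≤ dbl j
  dbl-mono-≤ z≤n     = z≤n
  dbl-mono-≤ (s≤s p) = s≤s (s≤s (dbl-mono-≤ p))

  dbl-mono-< : ∀ {i j} → i < j → suc (dbl i) < dbl j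
  dbl-mono-< = dbl-mono-≤

  data Half : ℕ → Set where
    even : ∀ i → Half (dbl i)
    odd  : ∀ i → Half (suc (dbl i))

  half : ∀ n → Half n
  half zero = even zero
  half (suc n) with half n
  ... | even i = odd i
  ... | odd i  = even (suc i)

  interleave : {A : Set} → (ℕ → A) → (ℕ → A) → ℕ → A
  interleave f g zero    = f 0
  interleave f g (suc x) = interleave g (f ∘ suc) x

  interleave-even : ∀ {A : Set} (f g : ℕ → A) i → interleave f g (dbl i) ≡ f i
  interleave-even f g zero    = refl
  interleave-even f g (suc i) = interleave-even (f ∘ suc) (g ∘ suc) i

  interleave-odd : ∀ {A : Set} (f g : ℕ → A) i → interleave f g (suc (dbl i)) ≡ g i
  interleave-odd f g i = interleave-even g (f ∘ suc) i

  steps : V G → ℕ → V G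
  steps g = interleave (es g) (ms g)

  joints : V G → ℕ → Lab
  joints g zero    = inj₁ (l g)
  joints g (suc x) = interleave (inj₂ ∘ r ∘ es g) (inj₁ ∘ l ∘ ms g) x

  joints-odd : ∀ g i → joints g (suc (dbl i)) ≡ inj₂ (r (es g i))
  joints-odd g i = interleave-even _ _ i

  joints-even : ∀ g i → joints g (dbl (suc i)) ≡ inj₁ (l (ms g i))
  joints-even g i = interleave-odd (inj₂ ∘ r ∘ es g) _ i

  joints-l : ∀ g i → joints g (dbl i) ≡ inj₁ (l (es g i))
  joints-l g zero    = refl
  joints-l g (suc i) = trans (joints-even g i) (cong inj₁ (sym (alt-l (ms g i))))

  ends-es : ∀ g i → Ends (steps g (dbl i)) (joints g (dbl i)) (joints g (suc (dbl i)))
  ends-es g i rewrite interleave-even (es g) (ms g) i = inj₁ (joints-l g i , joints-odd g i)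

  ends-ms : ∀ {g k} → Core g k → ∀ i → i < k →
    Ends (steps g (suc (dbl i))) (joints g (suc (dbl i))) (joints g (dbl (suc i)))
  ends-ms {g} co i i<k rewrite interleave-odd (es g) (ms g) i =
    inj₂ (trans (joints-odd g i) (cong inj₂ (sym (proj₂ (Core.matched co i i<k)))) , joints-even g i)

  dbl-cancel-≤ : ∀ {i j} → dbl i ≤ dbl j → i ≤ j
  dbl-cancel-≤ {zero} _ = z≤n
  dbl-cancel-≤ {suc i} {suc j} (s≤s (s≤s p)) = s≤s (dbl-cancel-≤ p)

  dbl-cancel-odd< : ∀ {i j} → suc (dbl i) < suc (dbl j) → i < j
  dbl-cancel-odd< {zero}  {suc j} _ = s≤s z≤n
  dbl-cancel-odd< {zero}  {zero} (s≤s ())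
  dbl-cancel-odd< {suc i} {suc j} (s≤s (s≤s (s≤s p))) = s≤s (dbl-cancel-odd< (s≤s p))
  dbl-cancel-odd< {suc i} {zero} (s≤s ())

  -- This walk ends after the last asserted member of `N`; `seg-core⁺` adds the edge e_k, whose mate
  -- is not asserted.
  seg-core : ∀ {g k} → Core g k → Seg (dbl k) (steps g) (joints g)
  seg-core {g} co x x<2k with half x
  ... | even i = ends-es g i
  ... | odd i  = ends-ms co i (dbl-cancel-odd< (ℕₚ.m≤n⇒m≤1+n x<2k))

  seg-core⁺ : ∀ {g k} → Core g k → Seg (suc (dbl k)) (steps g) (joints g)
  seg-core⁺ {g} {k} co x (s≤s x≤2k) with m≤n⇒m<n∨m≡n x≤2k
  ... | inj₁ x<2k = seg-core co x x<2k
  ... | inj₂ refl = ends-es g k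

  private
    inj₁≢inj₂ : ∀ {α : Lab} {p q} → α ≡ inj₁ p → α ≡ inj₂ q → ⊥
    inj₁≢inj₂ refl ()

  -- Equal left joints belong to members of `N`, which then coincide, so the right joints before
  -- them agree; the first left joint is uncovered and recurs nowhere. It therefore suffices to
  -- compare right labels. `R` is equality for a walk against itself, and "both are 0" for two walks
  -- with disjoint right labels.
  joints-match : ∀ {g h k k'} → Core g k → Core h k' → l g ≡ l h → (∀ n → n ∈ N → l n ≢ l g) →
    (R : ℕ → ℕ → Set) → R 0 0 →
    (∀ i j → i < k → j < k' → r (es g i) ≡ r (es h j) →
       R (suc (dbl i)) (suc (dbl j)) × R (dbl (suc i)) (dbl (suc j))) →
    ∀ x y → x < suc (dbl k) → y < suc (dbl k') → joints g x ≡ joints h y → R x y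
  joints-match {g} {h} cg ch lg≡lh unc R R0 hyp x y x≤ y≤ e with half x | half y
  ... | even zero | even zero = R0
  ... | even zero | even (suc j) = ⊥-elim (unc _ (proj₁ (Core.matched ch j (dbl-cancel-≤ {suc j} (≤-pred y≤))))
        (sym (inj₁-injective (trans e (joints-even h j)))))
  ... | even (suc i) | even zero = ⊥-elim (unc _ (proj₁ (Core.matched cg i (dbl-cancel-≤ {suc i} (≤-pred x≤))))
        (trans (inj₁-injective (trans (sym (joints-even g i)) e)) (sym lg≡lh)))
  ... | even (suc i) | even (suc j) = proj₂ (hyp i j i<k j<k' (trans (sym (proj₂ (Core.matched cg i i<k)))
        (trans (cong r (N-l-inj (proj₁ (Core.matched cg i i<k)) (proj₁ (Core.matched ch j j<k'))
          (inj₁-injective (trans (sym (joints-even g i)) (trans e (joints-even h j))))))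
          (proj₂ (Core.matched ch j j<k')))))
    where
    i<k = dbl-cancel-≤ {suc i} (≤-pred x≤)
    j<k' = dbl-cancel-≤ {suc j} (≤-pred y≤)
  ... | odd i | odd j = proj₁ (hyp i j (dbl-cancel-odd< x≤) (dbl-cancel-odd< y≤)
        (inj₂-injective (trans (sym (joints-odd g i)) (trans e (joints-odd h j)))))
  ... | even i | odd j = ⊥-elim (inj₁≢inj₂ (trans (sym e) (joints-l g i)) (joints-odd h j))
  ... | odd i | even j = ⊥-elim (inj₁≢inj₂ (trans e (joints-l h j)) (joints-odd g i))

  -- The two sides are treated differently: an exchange started at a left label never loses a right
  -- label, but it may give up a left label where `Need` fails.
  Improvement : Subset (size G) → V G → Set
  Improvement Z g = ∃[ N' ] (Stable G N' × Z ⊆ N' × (∀ u → Need l r u → Cov l N u → Cov l N' u) ×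
    (∀ u → Cov r N u → Cov r N' u) × Cov l N' g)

  -- The vertices m_i with i < K are replaced by the e_i with i ≤ k. If K = k, the right label of
  -- e_k was free and the walk is augmenting. If K = k + 1, the exchange gives up m_k and may
  -- uncover its left label, which `needless` permits.
  module Exchange (Z : Subset (size G)) (Z⊆N : Z ⊆ N) (g : V G) (unc : ∀ n → n ∈ N → l n ≢ l g)
    (k K : ℕ) (k≤K : k ≤ K) (K≤1+k : K ≤ suc k)
    (matched : ∀ i → i < K → ms g i ∈ N × r (ms g i) ≡ r (es g i))
    (ms∉Z : ∀ i → i < K → ms g i ∉ Z)
    (fresh : ∀ i j → i < suc k → j < suc k → r (es g i) ≡ r (es g j) → i ≡ j)
    (last : ∀ n → Mate (es g k) n → k < K)
    (needless : k < K → ¬ Need l r (ms g k)) where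
    private
      Added Removed New : V G → Set
      Added v = ∃[ i ] (i < suc k × v ≡ es g i)
      Removed v = ∃[ i ] (i < K × v ≡ ms g i)
      New v = (v ∈ N × ¬ Removed v) ⊎ Added v

      removed? : Decidable Removed
      removed? v = ∃<? (λ i → v ≟ ms g i) K

      new? : Decidable New
      new? v = ((v ∈? N) ×-dec ¬? (removed? v)) ⊎-dec ∃<? (λ i → v ≟ es g i) (suc k)

      N' : Subset (size G)
      N' = subsetOf new?

      es∈N' : ∀ i → i < suc k → es g i ∈ N'
      es∈N' i p = ∈-subsetOf⁺ new? (inj₂ (i , p , refl))

      i<k⇒i<K : ∀ {i} → i < k → i < K
      i<k⇒i<K p = <-≤-trans p k≤K

      same-r : ∀ n i → i < suc k → n ∈ N → r n ≡ r (es g i) → Removed n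
      same-r n i (s≤s i≤k) n∈N e with m≤n⇒m<n∨m≡n i≤k
      ... | inj₁ i<k = i , i<k⇒i<K i<k , N-r-inj n∈N (proj₁ (matched i (i<k⇒i<K i<k)))
                          (trans e (sym (proj₂ (matched i (i<k⇒i<K i<k)))))
      ... | inj₂ refl with last n (n∈N , e)
      ...   | k<K = k , k<K , N-r-inj n∈N (proj₁ (matched k k<K)) (trans e (sym (proj₂ (matched k k<K))))

      same-l : ∀ n i → i < suc k → n ∈ N → l n ≡ l (es g i) → Removed n
      same-l n zero _ n∈N e = ⊥-elim (unc n n∈N e)
      same-l n (suc i) (s≤s i<k) n∈N e = i , i<k⇒i<K i<k ,
        N-l-inj n∈N (proj₁ (matched i (i<k⇒i<K i<k))) (trans e (alt-l (ms g i)))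

      added-l : ∀ i j → i < suc k → j < suc k → l (es g i) ≡ l (es g j) → i ≡ j
      added-l zero zero _ _ e = refl
      added-l zero (suc j) _ (s≤s j<k) e =
        ⊥-elim (unc _ (proj₁ (matched j (i<k⇒i<K j<k))) (trans (sym (alt-l (ms g j))) (sym e)))
      added-l (suc i) zero (s≤s i<k) _ e =
        ⊥-elim (unc _ (proj₁ (matched i (i<k⇒i<K i<k))) (trans (sym (alt-l (ms g i))) e))
      added-l (suc i) (suc j) (s≤s i<k) (s≤s j<k) e = cong suc (fresh i j (ℕₚ.m≤n⇒m≤1+n i<k) (ℕₚ.m≤n⇒m≤1+n j<k)
        (trans (sym (proj₂ (matched i (i<k⇒i<K i<k)))) (trans (cong r
          (N-l-inj (proj₁ (matched i (i<k⇒i<K i<k))) (proj₁ (matched j (i<k⇒i<K j<k)))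
            (trans (sym (alt-l (ms g i))) (trans e (alt-l (ms g j)))))) (proj₂ (matched j (i<k⇒i<K j<k))))))

      stable : Stable G N'
      stable u v u∈ v∈ e with ∈-subsetOf⁻ new? u∈ | ∈-subsetOf⁻ new? v∈ | proj₁ (labelling u v) e
      ... | inj₁ (u∈N , _) | inj₁ (v∈N , _) | _ = N-stable u v u∈N v∈N e
      ... | inj₁ (u∈N , ¬rem) | inj₂ (i , p , refl) | _ , inj₁ q = ¬rem (same-l u i p u∈N q)
      ... | inj₁ (u∈N , ¬rem) | inj₂ (i , p , refl) | _ , inj₂ q = ¬rem (same-r u i p u∈N q)
      ... | inj₂ (i , p , refl) | inj₁ (v∈N , ¬rem) | _ , inj₁ q = ¬rem (same-l v i p v∈N (sym q))
      ... | inj₂ (i , p , refl) | inj₁ (v∈N , ¬rem) | _ , inj₂ q = ¬rem (same-r v i p v∈N (sym q))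
      ... | inj₂ (i , p , refl) | inj₂ (j , p' , refl) | ne , inj₁ q = ne (cong (es g) (added-l i j p p' q))
      ... | inj₂ (i , p , refl) | inj₂ (j , p' , refl) | ne , inj₂ q = ne (cong (es g) (fresh i j p p' q))

      Z⊆N' : Z ⊆ N'
      Z⊆N' z∈Z = ∈-subsetOf⁺ new? (inj₁ (Z⊆N z∈Z , λ { (i , p , refl) → ms∉Z i p z∈Z }))

      kept-l : ∀ u → Need l r u → Cov l N u → Cov l N' u
      kept-l u need (n , n∈N , q) with removed? n
      ... | no ¬rem = n , ∈-subsetOf⁺ new? (inj₁ (n∈N , ¬rem)) , q
      ... | yes (i , i<K , refl) with m≤n⇒m<n∨m≡n (≤-pred (<-≤-trans i<K K≤1+k))
      ...   | inj₁ i<k = es g (suc i) , es∈N' (suc i) (s≤s i<k) , trans (alt-l (ms g i)) q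
      ...   | inj₂ refl = ⊥-elim (needless i<K (transfer need))
        where
        -- `Need` depends on the vertex and not only on its left label, so it has to be moved from
        -- `u` to the removed vertex of the same left class.
        transfer : Need l r u → Need l r (ms g k)
        transfer need with any? (λ w → (l w ≟P l (ms g k)) ×-dec ¬? (r w ≟Q r (ms g k)))
        ... | yes h = inj₁ h
        ... | no ¬h = inj₂ λ w e → case need of λ
          { (inj₁ (w' , a , b)) → ⊥-elim (¬h (case r w' ≟Q r (ms g k) of λ
              { (no ne) → w' , trans a (sym q) , ne
              ; (yes y) → u , sym q , λ y' → b (trans y (sym y')) }))
          ; (inj₂ all) → case r u ≟Q r (ms g k) of λ
              { (yes y) → trans (all w (trans e (sym y))) (sym q)
              ; (no ne) → ⊥-elim (¬h (u , sym q , ne)) } }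

      kept-r : ∀ u → Cov r N u → Cov r N' u
      kept-r u (n , n∈N , q) with removed? n
      ... | no ¬rem = n , ∈-subsetOf⁺ new? (inj₁ (n∈N , ¬rem)) , q
      ... | yes (i , i<K , refl) = es g i , es∈N' i (<-≤-trans i<K K≤1+k) , trans (sym (proj₂ (matched i i<K))) q

    improvement : Improvement Z g
    improvement = N' , stable , Z⊆N' , kept-l , kept-r , g , es∈N' 0 (s≤s z≤n) , refl

  -- `T` stands for the right labels occupied by the other arm. In `loops` the bound `suc j < k`
  -- keeps the closed cycle from having only two edges.
  data Stop (Z : Subset (size G)) (T : Q → Set) (g : V G) (k : ℕ) : Set where
    hits  : T (r (es g k)) → Stop Z T g k
    loops : ∀ j → suc j < k → r (es g k) ≡ r (es g j) → Stop Z T g k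
    safe  : ¬ T (r (es g k)) → Core g (suc k) → ms g k ∈ Z → Stop Z T g k

  record Arm (Z : Subset (size G)) (T : Q → Set) (g : V G) : Set where
    field
      k     : ℕ
      core  : Core g k
      avoid : ∀ i → i < k → ¬ T (r (es g i))
      stop  : Stop Z T g k

  -- The walk is followed to its first event. If that is no collision, then e_k has no mate, or m_k
  -- is in `Z`, or m_k has no alternative edge. The first and the third allow an exchange, so the
  -- second remains.
  arm : (Z : Subset (size G)) → Z ⊆ N → {T : Q → Set} → Decidable T → ∀ g → (∀ n → n ∈ N → l n ≢ l g) →
        ¬ Improvement Z g → Arm Z T g
  arm Z Z⊆N {T} T? g unc ¬imp = build start
    where
    Reg Event : ℕ → Set
    Reg i = ∃ (Mate (es g i)) × ms g i ∉ Z × ∃ (Alt (ms g i))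
    Event i = ¬ Reg i ⊎ T (r (es g i)) ⊎ ∃[ j ] (j < i × r (es g i) ≡ r (es g j))

    reg? : Decidable Reg
    reg? i = mate? _ ×-dec ¬? (ms g i ∈? Z) ×-dec alt? _

    event? : Decidable Event
    event? i = ¬? (reg? i) ⊎-dec T? _ ⊎-dec ∃<? (λ j → r (es g i) ≟Q r (es g j)) i

    start : ∃[ k ] (Event k × (∀ i → i < k → ¬ Event i))
    -- There is one index more than there are vertices, so a vertex repeats and an event does occur.
    start with pigeonhole ≤-refl (λ (i : Fin (suc (size G))) → es g (toℕ i))
    ... | i , j , i<j , e with least event? (toℕ j) (inj₂ (inj₂ (toℕ i , i<j , cong r (sym e))))
    ...   | k , _ , ev , min = k , ev , min

    build : ∃[ k ] (Event k × (∀ i → i < k → ¬ Event i)) → Arm Z T g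
    build (k , ev , min) = record { k = k ; core = core ; avoid = λ i p t → min i p (inj₂ (inj₁ t)) ; stop = stop }
      where
      reg : ∀ i → i < k → Reg i
      reg i p = decidable-stable (reg? i) (λ ¬reg → min i p (inj₁ ¬reg))
      no-repeat : ∀ i j → j < i → i < k → r (es g i) ≢ r (es g j)
      no-repeat i j j<i p e = min i p (inj₂ (inj₂ (j , j<i , e)))
      matched : ∀ i → i < k → ms g i ∈ N × r (ms g i) ≡ r (es g i)
      matched i p = mate-spec (proj₂ (proj₁ (reg i p)))
      core : Core g k
      core = record
        { matched = matched
        ; fresh = λ i j p q e → case <-cmp i j of λ
            { (tri< i<j _ _) → ⊥-elim (no-repeat j i i<j q (sym e))
            ; (tri≈ _ i≡j _) → i≡j
            ; (tri> _ _ j<i) → ⊥-elim (no-repeat i j j<i p e) } }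
      -- `alt` changes the right label, so e_k cannot return to that of its immediate predecessor.
      far : ∀ {j} → j < k → r (es g k) ≡ r (es g j) → suc j < k
      far {j} p e with m≤n⇒m<n∨m≡n p
      ... | inj₁ q = q
      ... | inj₂ refl = ⊥-elim (alt-r (proj₂ (proj₂ (proj₂ (reg j p)))) (trans e (sym (proj₂ (matched j p)))))
      stop : Stop Z T g k
      stop with T? (r (es g k)) | ∃<? (λ j → r (es g k) ≟Q r (es g j)) k
      ... | yes t | _ = hits t
      ... | no _ | yes (j , p , e) = loops j (far p e) e
      ... | no ¬t | no new = cases (mate? (es g k)) (ms g k ∈? Z) (alt? (ms g k))
        where
        ¬reg : ¬ Reg k
        ¬reg reg = case ev of λ
          { (inj₁ ¬reg) → ¬reg reg ; (inj₂ (inj₁ t)) → ¬t t ; (inj₂ (inj₂ h)) → new h }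
        fresh⁺ : ∀ i j → i < suc k → j < suc k → r (es g i) ≡ r (es g j) → i ≡ j
        fresh⁺ i j (s≤s i≤k) (s≤s j≤k) e with m≤n⇒m<n∨m≡n i≤k | m≤n⇒m<n∨m≡n j≤k
        ... | inj₁ p | inj₁ q = Core.fresh core i j p q e
        ... | inj₁ p | inj₂ refl = ⊥-elim (new (i , p , sym e))
        ... | inj₂ refl | inj₁ q = ⊥-elim (new (j , q , e))
        ... | inj₂ refl | inj₂ refl = refl
        matched⁺ : ∃ (Mate (es g k)) → ∀ i → i < suc k → ms g i ∈ N × r (ms g i) ≡ r (es g i)
        matched⁺ m i (s≤s i≤k) with m≤n⇒m<n∨m≡n i≤k
        ... | inj₁ p = matched i p
        ... | inj₂ refl = mate-spec (proj₂ m)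
        -- With no alternative edge at m_k, `Need` could only hold by inclusion of classes, and e_k
        -- refutes that: it has the right label of m_k, and sharing the left one too would make m_k
        -- cover the start or coincide with an earlier m_i.
        needless : ∃ (Mate (es g k)) → ¬ ∃ (Alt (ms g k)) → ¬ Need l r (ms g k)
        needless m ¬alt (inj₁ (w , h)) = ¬alt (w , h)
        needless m ¬alt (inj₂ all) = lemma k ≤-refl (all (es g k) (sym (proj₂ (mate-spec (proj₂ m)))))
          where
          lemma : ∀ i → i ≤ k → l (es g i) ≢ l (ms g k)
          lemma zero _ e = unc _ (proj₁ (mate-spec (proj₂ m))) (sym e)
          lemma (suc i) i<k e = new (i , i<k , trans (sym (proj₂ (mate-spec (proj₂ m)))) (trans
            (cong r (sym (N-l-inj (proj₁ (matched i i<k)) (proj₁ (mate-spec (proj₂ m)))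
              (trans (sym (alt-l (ms g i))) e)))) (proj₂ (matched i i<k))))
        cases : Dec (∃ (Mate (es g k))) → Dec (ms g k ∈ Z) → Dec (∃ (Alt (ms g k))) → Stop Z T g k
        cases (no ¬m) _ _ = ⊥-elim (¬imp (Exchange.improvement Z Z⊆N g unc k k ≤-refl (n≤1+n k)
          matched (λ i p → proj₁ (proj₂ (reg i p))) fresh⁺ (λ n h → ⊥-elim (¬m (n , h))) (λ p → ⊥-elim (<-irrefl refl p))))
        cases (yes m) (yes z) _ = safe ¬t record
          { matched = matched⁺ m
          ; fresh = fresh⁺ } z
        cases (yes m) (no ¬z) (yes a) = ⊥-elim (¬reg (m , ¬z , a))
        cases (yes m) (no ¬z) (no ¬a) = ⊥-elim (¬imp (Exchange.improvement Z Z⊆N g unc k (suc k) (n≤1+n k) ≤-refl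
          (matched⁺ m) ms∉Z fresh⁺ (λ _ _ → ≤-refl) (λ _ → needless m ¬a)))
          where
          ms∉Z : ∀ i → i < suc k → ms g i ∉ Z
          ms∉Z i (s≤s i≤k) with m≤n⇒m<n∨m≡n i≤k
          ... | inj₁ p = proj₁ (proj₂ (reg i p))
          ... | inj₂ refl = ¬z

  dbl-gap : ∀ {i j} → suc i < j → 3 ≤ dbl j ∸ dbl i
  dbl-gap {zero}  (s≤s (s≤s z≤n)) = s≤s (s≤s (s≤s z≤n))
  dbl-gap {suc i} (s≤s p)         = dbl-gap p

  module TwoCores {g h k₁ k₂ n₁ n₂} (co₁ : Core g k₁) (co₂ : Core h k₂) (lg≡lh : l g ≡ l h)
    (unc : ∀ n → n ∈ N → l n ≢ l g) (disjoint : ∀ i j → i < k₁ → j < k₂ → r (es g i) ≢ r (es h j))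
    (s₁ : Seg n₁ (steps g) (joints g)) (s₂ : Seg n₂ (steps h) (joints h)) where

    private
      same : ∀ {f k} → Core f k → (∀ n → n ∈ N → l n ≢ l f) →
             ∀ i j → i < suc (dbl k) → j < suc (dbl k) → joints f i ≡ joints f j → i ≡ j
      same {f} co u = joints-match co co refl u _≡_ refl λ i j p q e →
        cong (suc ∘ dbl) (Core.fresh co i j p q e) , cong (dbl ∘ suc) (Core.fresh co i j p q e)

    open TwoArms s₁ s₂ (suc (dbl k₁)) (suc (dbl k₂)) (cong inj₁ lg≡lh)
      (same co₁ unc) (same co₂ (λ n n∈N e → unc n n∈N (trans e (sym lg≡lh))))
      (joints-match co₁ co₂ lg≡lh unc (λ i j → i ≡ 0 × j ≡ 0) (refl , refl) (λ i j p q e → ⊥-elim (disjoint i j p q e)))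
      public

    end : ∀ m → n₂ ≡ suc m → c (n₁ + n₂ ∸ 1) ≡ steps h m
    end m refl = trans (cong c (ℕₚ.+-∸-assoc n₁ {suc m} (s≤s z≤n))) (join-+ n₁ m)

  module _ (innocent : Innocent G) (Z : Subset (size G)) (Z⊆N : Z ⊆ N)
    (Z-safe : ∀ z → z ∈ Z → Safe G z) (Z-consistent : Consistent G Z) where

    private
      module Split {g h : V G} (lh≡lg : l h ≡ l g) (rh≢rg : r h ≢ r g)
        (unc : ∀ n → n ∈ N → l n ≢ l g) where

        -- The first arm closes on itself at e_{j₁}. In `self` the second arm does so too. In
        -- `other` it ends on the first arm at e_i: on the stem for i < j₁, on the loop for i > j₁.
        module LoopLoop {k₁ k₂} (co₁ : Core g k₁) (co₂ : Core h k₂)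
          (disjoint : ∀ i j → i < k₁ → j < k₂ → r (es g i) ≢ r (es h j))
          (j₁ : ℕ) (j₁<k₁ : suc j₁ < k₁) (loop₁ : r (es g k₁) ≡ r (es g j₁)) where
          open TwoCores co₁ co₂ (sym lh≡lg) unc disjoint (seg-core⁺ co₁) (seg-core⁺ co₂)

          j₁≤k₁ : suc (dbl j₁) ≤ suc (dbl k₁)
          j₁≤k₁ = s≤s (dbl-mono-≤ (<⇒≤ (<⇒≤ j₁<k₁)))

          closing₁ : κ 0 ≡ κ (suc (dbl k₁) ∸ suc (dbl j₁))
          closing₁ = trans κ-zero (trans (joints-odd g k₁) (trans (cong inj₂ loop₁)
            (trans (sym (joints-odd g j₁)) (sym (κ-first (suc (dbl j₁)) j₁≤k₁)))))

          kinds : isLeft (κ (suc (dbl k₁) + suc (dbl k₂))) ≡ isLeft (κ 0)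
          kinds = trans (cong isLeft (trans (κ-second _) (joints-odd h k₂)))
                        (sym (cong isLeft (trans κ-zero (joints-odd g k₁))))

          I<N : suc (dbl k₁) ∸ suc (dbl j₁) < suc (dbl k₁) + suc (dbl k₂)
          I<N = ≤-<-trans (ℕₚ.m∸n≤m (suc (dbl k₁)) (suc (dbl j₁))) (ℕₚ.m<m+n (suc (dbl k₁)) (s≤s z≤n))

          self : ∀ j → suc j < k₂ → r (es h k₂) ≢ r (es h j)
          self j p e = dumbbell _ (suc (dbl k₁) + suc (dbl j)) walk (dbl-gap j₁<k₁) I<N (s≤s z≤n) far
            (inner ≤-refl ≤-refl) closing₁
            (trans (κ-second _) (trans (joints-odd h k₂) (trans (cong inj₂ e)
              (trans (sym (joints-odd h j)) (sym (κ-second _))))))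
            kinds innocent
            where
            far : suc (dbl k₁) + suc (dbl j) + 3 ≤ suc (dbl k₁) + suc (dbl k₂)
            far = subst (_≤ suc (dbl k₁) + suc (dbl k₂)) (sym (+-assoc (suc (dbl k₁)) (suc (dbl j)) 3))
              (+-monoʳ-≤ (suc (dbl k₁)) (s≤s (subst (_≤ dbl k₂) (+-comm 3 (dbl j))
                (≤-trans (n≤1+n _) (dbl-mono-≤ p)))))

          other : ∀ i → i < k₁ → r (es h k₂) ≢ r (es g i)
          other i i<k₁ e = dumbbell _ (suc (dbl k₁) ∸ suc (dbl i)) walk (dbl-gap j₁<k₁) I<N
            (ℕₚ.m<n⇒0<n∸m {dbl i} {dbl k₁} (≤-trans (n≤1+n _) (dbl-mono-< i<k₁))) far
            (inner ≤-refl ≤-refl) closing₁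
            (trans (κ-second _) (trans (joints-odd h k₂) (trans (cong inj₂ e)
              (trans (sym (joints-odd g i)) (sym (κ-first _ (s≤s (dbl-mono-≤ (<⇒≤ i<k₁)))))))))
            kinds innocent
            where
            3≤ : ∀ i k → r (es h k) ≡ r (es g i) → 3 ≤ suc (dbl i) + suc (dbl k)
            -- Here `g` and `h` would be parallel edges and the cycle would have length 2.
            3≤ zero zero e = ⊥-elim (rh≢rg e)
            3≤ zero (suc k) _ = s≤s (s≤s (s≤s z≤n))
            3≤ (suc i) k _ = s≤s (s≤s (s≤s z≤n))
            far : dbl k₁ ∸ dbl i + 3 ≤ suc (dbl k₁) + suc (dbl k₂)
            far = ≤-trans (+-monoʳ-≤ (dbl k₁ ∸ dbl i) (3≤ i k₂ e)) (ℕₚ.≤-reflexive (trans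
              (sym (+-assoc (dbl k₁ ∸ dbl i) (suc (dbl i)) (suc (dbl k₂))))
              (cong (_+ suc (dbl k₂)) (trans (+-suc _ (dbl i)) (cong suc (ℕₚ.m∸n+n≡m (dbl-mono-≤ (<⇒≤ i<k₁))))))))

        -- The end of the arm of `g` is a right label, the end at the member of `Z` a left label,
        -- which is the parity that a lollipop forbids. In `other` the cycle runs through the common
        -- start of the arms.
        module LoopSafe {k₁ k₂} (co₁ : Core g k₁) (co₂ : Core h (suc k₂)) (z∈Z : ms h k₂ ∈ Z)
          (disjoint : ∀ i j → i < k₁ → j < suc k₂ → r (es g i) ≢ r (es h j)) where
          open TwoCores co₁ co₂ (sym lh≡lg) unc disjoint (seg-core⁺ co₁) (seg-core co₂)

          kinds : isLeft (κ (suc (dbl k₁) + dbl (suc k₂))) ≡ not (isLeft (κ 0))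
          kinds = trans (cong isLeft (trans (κ-second _) (joints-even h k₂)))
                        (sym (cong (not ∘ isLeft) (trans κ-zero (joints-odd g k₁))))

          safe-end : Safe G (c (suc (dbl k₁) + dbl (suc k₂) ∸ 1))
          safe-end = subst (Safe G) (sym (trans (end (suc (dbl k₂)) refl) (interleave-odd (es h) (ms h) k₂))) (Z-safe _ z∈Z)

          self : ∀ j → suc j < k₁ → r (es g k₁) ≢ r (es g j)
          self j p e = lollipop _ walk (dbl-gap p)
            (≤-<-trans (ℕₚ.m∸n≤m (suc (dbl k₁)) (suc (dbl j))) (ℕₚ.m<m+n (suc (dbl k₁)) (s≤s z≤n)))
            (inner⁺ ≤-refl ≤-refl)
            (trans κ-zero (trans (joints-odd g k₁) (trans (cong inj₂ e) (trans (sym (joints-odd g j))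
              (sym (κ-first (suc (dbl j)) (s≤s (dbl-mono-≤ (<⇒≤ (<⇒≤ p))))))))))
            kinds safe-end

          other : ∀ i → i < suc k₂ → r (es g k₁) ≢ r (es h i)
          other i i<k e = lollipop (suc (dbl k₁) + suc (dbl i)) walk (3≤ k₁ i e) (+-monoʳ-< (suc (dbl k₁)) (dbl-mono-< i<k))
            (inner⁺ ≤-refl ≤-refl)
            (trans κ-zero (trans (joints-odd g k₁) (trans (cong inj₂ e) (trans (sym (joints-odd h i)) (sym (κ-second _))))))
            kinds safe-end
            where
            3≤ : ∀ k i → r (es g k) ≡ r (es h i) → 3 ≤ suc (dbl k) + suc (dbl i)
            3≤ zero zero e = ⊥-elim (rh≢rg (sym e))
            3≤ zero (suc k) _ = s≤s (s≤s (s≤s z≤n))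
            3≤ (suc i) k _ = s≤s (s≤s (s≤s z≤n))

        -- The joined walk has an even number of edges, hence is a path of odd length in `G` between
        -- two members of `Z`.
        safeSafe : ∀ {k₁ k₂} (co₁ : Core g (suc k₁)) (co₂ : Core h (suc k₂)) → ms g k₁ ∈ Z → ms h k₂ ∈ Z →
          (∀ i j → i < suc k₁ → j < suc k₂ → r (es g i) ≢ r (es h j)) → ⊥
        safeSafe {k₁} {k₂} co₁ co₂ z₁ z₂ disjoint with pth⇒Path (path ≤-refl ≤-refl)
          where open TwoCores co₁ co₂ (sym lh≡lg) unc disjoint (seg-core co₁) (seg-core co₂)
        ... | π , len≡ , first≡ , last≡ , _ = seg-odd (Pth.seg (path ≤-refl ≤-refl)) kinds (subst Even len≡ even-π)
          where
          open TwoCores co₁ co₂ (sym lh≡lg) unc disjoint (seg-core co₁) (seg-core co₂)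
          kinds : isLeft (κ (dbl (suc k₁) + dbl (suc k₂))) ≡ isLeft (κ 0)
          kinds = trans (cong isLeft (trans (κ-second _) (joints-even h k₂)))
                        (sym (cong isLeft (trans κ-zero (joints-even g k₁))))
          first-end : c 0 ≡ ms g k₁
          first-end = interleave-odd (es g) (ms g) k₁
          last-end : c (dbl (suc k₁) + dbl (suc k₂) ∸ 1) ≡ ms h k₂
          last-end = trans (end (suc (dbl k₂)) refl) (interleave-odd (es h) (ms h) k₂)
          ne : ms g k₁ ≢ ms h k₂
          ne e = disjoint k₁ k₂ ≤-refl ≤-refl (trans (sym (proj₂ (Core.matched co₁ k₁ ≤-refl)))
                   (trans (cong r e) (proj₂ (Core.matched co₂ k₂ ≤-refl))))
          even-π : Even (len π)
          even-π = Z-consistent _ _ z₁ z₂ ne π (inj₁ (trans first≡ first-end , trans last≡ last-end))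

      same-label : ∀ {g h} → l h ≡ l g → Improvement Z h → Improvement Z g
      same-label lh≡lg (N' , a , b , c , d , (n , n∈ , e)) = N' , a , b , c , d , (n , n∈ , trans e lh≡lg)

    -- One arm leaves the uncovered left label along `g`, the other along an edge `h` with a
    -- different right label. The second arm treats the right labels of the first as occupied, so
    -- the two stay disjoint until the second stops. Every combination of stops is contradictory.
    improvable : ∀ g → Need l r g → (∀ n → n ∈ N → l n ≢ l g) → ¬ ¬ Improvement Z g
    -- A member of `N` at the right label of `g` would also cover its left label, so `g` can simply
    -- be added: the exchange with k = K = 0.
    improvable g (inj₂ all) unc ¬imp = ¬imp (Exchange.improvement Z Z⊆N g unc 0 0 z≤n z≤n (λ _ ()) (λ _ ())
      (λ { zero zero _ _ _ → refl ; (suc _) _ (s≤s ()) ; zero (suc _) _ (s≤s ()) })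
      (λ { n (n∈N , e) → ⊥-elim (unc n n∈N (all n e)) }) λ ())
    improvable g (inj₁ (h , lh≡lg , rh≢rg)) unc ¬imp
      with arm Z Z⊆N {λ _ → ⊥} (λ _ → no id) g unc ¬imp
    ... | record { k = k₁ ; core = co₁ ; stop = loops j₁ j₁<k₁ loop₁ }
      -- The bound k₁ suffices, since the right label of e_{k₁} repeats an earlier one.
      with arm Z Z⊆N {λ q → ∃[ i ] (i < k₁ × r (es g i) ≡ q)} (λ q → ∃<? (λ i → r (es g i) ≟Q q) k₁) h
             (λ n n∈N e → unc n n∈N (trans e lh≡lg)) (¬imp ∘ same-label lh≡lg)
    ...   | record { k = k₂ ; core = co₂ ; avoid = av ; stop = hits (i , i<k , e) } =
      LoopLoop.other co₁ co₂ (λ i j p q e → av j q (i , p , e)) j₁ j₁<k₁ loop₁ i i<k (sym e)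
      where open Split lh≡lg rh≢rg unc
    ...   | record { k = k₂ ; core = co₂ ; avoid = av ; stop = loops j p e } =
      LoopLoop.self co₁ co₂ (λ i j p q e → av j q (i , p , e)) j₁ j₁<k₁ loop₁ j p e
      where open Split lh≡lg rh≢rg unc
    ...   | record { k = k₂ ; core = co₂ ; avoid = av ; stop = safe ¬t co₂⁺ z } =
      LoopSafe.self co₁ co₂⁺ z separated j₁ j₁<k₁ loop₁
      where
      open Split lh≡lg rh≢rg unc
      separated : ∀ i j → i < k₁ → j < suc k₂ → r (es g i) ≢ r (es h j)
      separated i j p (s≤s q) e with m≤n⇒m<n∨m≡n q
      ... | inj₁ q' = av j q' (i , p , e)
      ... | inj₂ refl = ¬t (i , p , e)
    improvable g (inj₁ (h , lh≡lg , rh≢rg)) unc ¬imp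
        | record { k = k₁ ; stop = safe _ co₁ z₁ }
      -- Here e_{k₁} has a new right label, which counts as occupied as well.
      with arm Z Z⊆N {λ q → ∃[ i ] (i < suc k₁ × r (es g i) ≡ q)} (λ q → ∃<? (λ i → r (es g i) ≟Q q) (suc k₁)) h
             (λ n n∈N e → unc n n∈N (trans e lh≡lg)) (¬imp ∘ same-label lh≡lg)
    ...   | record { k = k₂ ; core = co₂ ; avoid = av ; stop = hits (i , i<k , e) } =
      -- The arm of `g` is the one ending in `Z`, so `g` and `h` change roles.
      LoopSafe.other co₂ co₁ z₁ (λ i j p q e → av i p (j , q , sym e)) i i<k (sym e)
      where open Split (sym lh≡lg) (λ e → rh≢rg (sym e)) (λ n n∈N e → unc n n∈N (trans e lh≡lg))
    ...   | record { k = k₂ ; core = co₂ ; avoid = av ; stop = loops j p e } =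
      LoopSafe.self co₂ co₁ z₁ (λ i j p q e → av i p (j , q , sym e)) j p e
      where open Split (sym lh≡lg) (λ e → rh≢rg (sym e)) (λ n n∈N e → unc n n∈N (trans e lh≡lg))
    ...   | record { k = k₂ ; core = co₂ ; avoid = av ; stop = safe ¬t co₂⁺ z } = safeSafe co₁ co₂⁺ z₁ z separated
      where
      open Split lh≡lg rh≢rg unc
      separated : ∀ i j → i < suc k₁ → j < suc k₂ → r (es g i) ≢ r (es h j)
      separated i j p (s≤s q) e with m≤n⇒m<n∨m≡n q
      ... | inj₁ q' = av j q' (i , p , e)
      ... | inj₂ refl = ¬t (i , p , e)

swap-labelling : ∀ {G P Q} {l : V G → P} {r : V G → Q} → IsLabelling G l r → IsLabelling G r l
swap-labelling lab u v = (λ e → proj₁ (proj₁ (lab u v) e) , ⊎-swap (proj₂ (proj₁ (lab u v) e))) ,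
                         λ { (ne , s) → proj₂ (lab u v) (ne , ⊎-swap s) }

-- From covered labels to strong stable sets

module Coverable (G : Graph) {P Q : Set} (_≟P_ : (a b : P) → Dec (a ≡ b)) (_≟Q_ : (a b : Q) → Dec (a ≡ b))
  (l : V G → P) (r : V G → Q) (labelling : IsLabelling G l r) where
  open Coverage G
  open Graphs G

  cov? : ∀ N → Decidable (Cov l N)
  cov? N u = any? (λ n → (n ∈? N) ×-dec (l n ≟P l u))

  need? : Decidable (Need l r)
  need? u = any? (λ w → (l w ≟P l u) ×-dec ¬? (r w ≟Q r u)) ⊎-dec all? (λ w → (r w ≟Q r u) →-dec (l w ≟P l u))

  covered? : ∀ N → Decidable (λ u → Need l r u × Cov l N u)
  covered? N u = need? u ×-dec cov? N u

  covered : Subset (size G) → Subset (size G)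
  covered N = subsetOf (covered? N)

  covered-mono : ∀ {N N'} → (∀ u → Need l r u → Cov l N u → Cov l N' u) → covered N ⊆ covered N'
  covered-mono {N} {N'} h {u} m with ∈-subsetOf⁻ (covered? N) m
  ... | need , cov = ∈-subsetOf⁺ (covered? N') (need , h u need cov)

  covered-strict : ∀ {N N'} → (∀ u → Need l r u → Cov l N u → Cov l N' u) →
    ∀ g → Need l r g → ¬ Cov l N g → Cov l N' g → ∣ covered N ∣ < ∣ covered N' ∣
  covered-strict {N} {N'} h g need ¬cov cov = p⊂q⇒∣p∣<∣q∣ (covered-mono h , g ,
    ∈-subsetOf⁺ (covered? N') (need , cov) , λ m → ¬cov (proj₂ (∈-subsetOf⁻ (covered? N) m)))

  -- If `Need` fails at `v`, all of `K` has the right label of `v` as well, and some `w` outside the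
  -- left class has it too. Such a `w` is adjacent to all of `K`, against maximality.
  class-met : ∀ {N K v} → (∀ u → Need l r u → Cov l N u) → MaximalClique G K → v ∈ K →
    (∀ u → u ∈ K → l u ≡ l v) → ∃[ n ] (n ∈ K × n ∈ N)
  class-met {N} {K} {v} cov mc v∈K same with need? v
  ... | yes need with cov v need
  ...   | n , n∈N , e = n ,
    maximal-absorbs mc (λ u u∈K ne → proj₂ (labelling u n) (ne , inj₁ (trans (same u u∈K) (sym e)))) , n∈N
  class-met {N} {K} {v} cov mc v∈K same | no ¬need
    with any? (λ w → (r w ≟Q r v) ×-dec ¬? (l w ≟P l v))
  ... | no ¬w = ⊥-elim (¬need (inj₂ λ w e → decidable-stable (l w ≟P l v) (λ ne → ¬w (w , e , ne))))
  ... | yes (w , e , ne) = ⊥-elim (ne (same w (maximal-absorbs mc λ u u∈K u≢w →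
          proj₂ (labelling u w) (u≢w , inj₂ (trans (same-r u u∈K) (sym e))))))
    where
    same-r : ∀ u → u ∈ K → r u ≡ r v
    same-r u u∈K = decidable-stable (r u ≟Q r v) (λ ne' → ¬need (inj₁ (u , same u u∈K , ne')))

module StrongMatching (G : Graph) {P Q : Set} (_≟P_ : (a b : P) → Dec (a ≡ b)) (_≟Q_ : (a b : Q) → Dec (a ≡ b))
  (l : V G → P) (r : V G → Q) (labelling : IsLabelling G l r) where
  open Coverage G
  open Graphs G
  private
    module L = Coverable G _≟P_ _≟Q_ l r labelling
    module R = Coverable G _≟Q_ _≟P_ r l (swap-labelling {G} labelling)

  -- Three pairwise meeting edges of a bipartite multigraph have a common end, so a clique lies
  -- within a single left class or a single right class.
  covering⇒strong : ∀ {N} → Stable G N → (∀ u → Need l r u → Cov l N u) → (∀ u → Need r l u → Cov r N u) →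
    StrongStable G N
  covering⇒strong {N} st cl cr = st , meets
    where
    meets : ∀ K → MaximalClique G K → ∃[ n ] (n ∈ K × n ∈ N)
    meets K mc@(clique , (v , v∈K) , _) with any? (λ w → (w ∈? K) ×-dec ¬? (l w ≟P l v))
    ... | no ¬w = L.class-met cl mc v∈K (λ u u∈K → decidable-stable (l u ≟P l v) (λ ne → ¬w (u , u∈K , ne)))
    ... | yes (w , w∈K , lw≢lv) = R.class-met cr mc v∈K (λ u u∈K → decidable-stable (r u ≟Q r v) (absurd u u∈K))
      where
      shared : ∀ u u' → u ∈ K → u' ∈ K → l u ≡ l u' ⊎ r u ≡ r u'
      shared u u' p q with u ≟ u'
      ... | yes refl = inj₁ refl
      ... | no ne = proj₂ (proj₁ (labelling u u') (clique u u' p q ne))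
      absurd : ∀ u → u ∈ K → r u ≢ r v → ⊥
      absurd u u∈K ru≢rv with shared u v u∈K v∈K | shared w v w∈K v∈K | shared u w u∈K w∈K
      ... | inj₂ e | _ | _ = ru≢rv e
      ... | inj₁ _ | inj₁ e | _ = lw≢lv e
      ... | inj₁ e | inj₂ _ | inj₁ e' = lw≢lv (trans (sym e') e)
      ... | inj₁ _ | inj₂ e | inj₂ e' = ru≢rv (trans e' e)

  module _ (innocent : Innocent G) (Z : Subset (size G)) (safe : ∀ z → z ∈ Z → Safe G z) (con : Consistent G Z) where

    private
      μ : Subset (size G) → ℕ
      μ N = ∣ L.covered N ∣ + ∣ R.covered N ∣

      -- `m` is fuel: each improvement raises `μ`, which is at most twice the order of `G`. The
      -- conclusion ⊥ allows the use of an improvement that is known only up to double negation.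
      improve : (∀ N → StrongStable G N → ¬ (Z ⊆ N)) → ∀ m N → Stable G N → Z ⊆ N → size G + size G < μ N + m → ⊥
      improve none zero N _ _ p = <-irrefl refl (<-≤-trans p
        (≤-trans (ℕₚ.≤-reflexive (+-identityʳ (μ N))) (ℕₚ.+-mono-≤ (∣p∣≤n (L.covered N)) (∣p∣≤n (R.covered N)))))
      improve none (suc m) N st Z⊆N p
        with any? (λ u → L.need? u ×-dec ¬? (L.cov? N u)) | any? (λ u → R.need? u ×-dec ¬? (R.cov? N u))
      ... | yes (u , need , ¬cov) | _ = Augmenting.improvable G _≟P_ _≟Q_ l r labelling N st innocent Z Z⊆N safe con u need
        (λ n n∈N e → ¬cov (n , n∈N , e))
        λ { (N' , st' , Z⊆N' , keepL , keepR , cov) → improve none m N' st' Z⊆N'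
              (<-≤-trans p (subst (_≤ μ N' + m) (sym (+-suc (μ N) m)) (ℕₚ.+-monoˡ-≤ m
                (ℕₚ.+-mono-<-≤ (L.covered-strict keepL u need ¬cov cov)
                  (p⊆q⇒∣p∣≤∣q∣ (R.covered-mono (λ v _ → keepR v))))))) }
      ... | no _ | yes (u , need , ¬cov) =
        Augmenting.improvable G _≟Q_ _≟P_ r l (swap-labelling {G} labelling) N st innocent Z Z⊆N safe con u need
        (λ n n∈N e → ¬cov (n , n∈N , e))
        λ { (N' , st' , Z⊆N' , keepR , keepL , cov) → improve none m N' st' Z⊆N'
              (<-≤-trans p (subst (_≤ μ N' + m) (sym (+-suc (μ N) m)) (ℕₚ.+-monoˡ-≤ m
                (ℕₚ.+-mono-≤-< (p⊆q⇒∣p∣≤∣q∣ (L.covered-mono (λ v _ → keepL v)))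
                  (R.covered-strict keepR u need ¬cov cov))))) }
      ... | no ¬l | no ¬r = none N (covering⇒strong st
              (λ u need → decidable-stable (L.cov? N u) (λ ¬c → ¬l (u , need , ¬c)))
              (λ u need → decidable-stable (R.cov? N u) (λ ¬c → ¬r (u , need , ¬c)))) Z⊆N

    strong-superset : ¬ ¬ (∃[ S ] (StrongStable G S × Z ⊆ S))
    strong-superset ¬ex = improve (λ N s Z⊆N → ¬ex (N , s , Z⊆N)) (suc (size G + size G)) Z
      (consistent⇒stable con) id (ℕₚ.m≤n+m (suc (size G + size G)) (μ Z))

-- Induced subgraphs of a suspect

nth : ∀ {n} (W : Subset n) → Fin ∣ W ∣ → Fin n
nth (true ∷ W)  zero    = zero
nth (true ∷ W)  (suc i) = suc (nth W i)
nth (false ∷ W) i       = suc (nth W i)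

nth-∈ : ∀ {n} (W : Subset n) i → nth W i ∈ W
nth-∈ (true ∷ W)  zero    = here
nth-∈ (true ∷ W)  (suc i) = there (nth-∈ W i)
nth-∈ (false ∷ W) i       = there (nth-∈ W i)

nth-injective : ∀ {n} (W : Subset n) {i j} → nth W i ≡ nth W j → i ≡ j
nth-injective (true ∷ W)  {zero}  {zero}  e = refl
nth-injective (true ∷ W)  {suc i} {suc j} e = cong suc (nth-injective W (Finₚ.suc-injective e))
nth-injective (false ∷ W) e = nth-injective W (Finₚ.suc-injective e)

nth-surjective : ∀ {n} (W : Subset n) {v} → v ∈ W → ∃[ i ] nth W i ≡ v
nth-surjective (true ∷ W)  here = zero , refl
nth-surjective (true ∷ W)  (there m) with nth-surjective W m
... | i , e = suc i , cong suc e
nth-surjective (false ∷ W) (there m) with nth-surjective W m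
... | i , e = i , cong suc e

infixl 9 _[_]
_[_] : (G : Graph) → Subset (size G) → Graph
G [ W ] = record
  { size = ∣ W ∣
  ; adj = λ i j → adj G (nth W i) (nth W j)
  ; adj-sym = λ i j → adj-sym G (nth W i) (nth W j)
  ; adj-irrefl = λ i → adj-irrefl G (nth W i) }

module Induced (G : Graph) (W : Subset (size G)) where

  lift : ∀ {A R} → Embedding (G [ W ]) A R → Embedding G A R
  lift e = record
    { emb = λ a → nth W (emb e a)
    ; emb-inj = λ p → emb-inj e (nth-injective W p)
    ; emb-adj = emb-adj e }

  liftPath : Path (G [ W ]) → Path G
  liftPath π = record { len = len π ; pemb = lift (pemb π) }

  liftClown : Clown (G [ W ]) → Clown G
  liftClown D = record { ck = ck D ; ck-even = ck-even D ; ck-4 = ck-4 D ; cemb = lift (cemb D) }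

  liftBetween : ∀ {u v} π → PathBetween (G [ W ]) u v π → PathBetween G (nth W u) (nth W v) (liftPath π)
  liftBetween π (inj₁ (p , q)) = inj₁ (cong (nth W) p , cong (nth W) q)
  liftBetween π (inj₂ (p , q)) = inj₂ (cong (nth W) p , cong (nth W) q)

  innocent : Innocent G → Innocent (G [ W ])
  innocent (a , b , c , d , e) =
      (λ { (k , odd , 4≤k , h) → a (k , odd , 4≤k , lift h) })
    , (λ { (k , 6≤k , h) → b (k , 6≤k , lift h) })
    , (λ { (l , odd , h) → c (l , odd , lift h) })
    , (λ { (k , L , k' , p , q , r , s , t , h) → d (k , L , k' , p , q , r , s , t , lift h) })
    , (λ { (k , k' , p , q , r , s , h) → e (k , k' , p , q , r , s , lift h) })

  simplicial : ∀ {v} → Simplicial G (nth W v) → Simplicial (G [ W ]) v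
  simplicial s u w p q ne = s (nth W u) (nth W w) p q (λ e → ne (nth-injective W e))

  -- Clowns and paths of an induced subgraph are clowns and paths of `G`, with the same adjacencies
  -- and the same lengths.
  safe : ∀ {v} → Safe G (nth W v) → Safe (G [ W ]) v
  safe {v} (s , t) = simplicial {v} s , λ D π b away → t (liftClown D) (liftPath π) (liftBetween π b)
    (λ i ne j → let (p , q) = away i (λ e → ne (cong (nth W) e)) j in (λ e → p (nth-injective W e)) , q)

  module _ (Z : Subset (size G)) where

    member? : Decidable (λ i → nth W i ∈ Z)
    member? i = nth W i ∈? Z

    Z∩W : Subset ∣ W ∣
    Z∩W = subsetOf member?

    bad : ClawFree G → Innocent G → Consistent G Z → (∀ v → v ∈ Z → Safe G v) →
          ¬ (∃[ S ] (StrongStable (G [ W ]) S × Z∩W ⊆ S)) → Bad (G [ W ]) Z∩W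
    bad cf inn con sf none =
        (λ h → cf (lift h)) , innocent inn
      , (λ u v u∈ v∈ ne π b → con (nth W u) (nth W v) (∈-subsetOf⁻ member? u∈) (∈-subsetOf⁻ member? v∈)
           (λ e → ne (nth-injective W e)) (liftPath π) (liftBetween π b))
      , (λ v v∈ → safe (sf (nth W v) (∈-subsetOf⁻ member? v∈)))
      , none

  -- The maximal cliques of the induced subgraph, written as subsets of `G` so that later arguments
  -- need no renumbering of vertices.
  MaximalWithin : Subset (size G) → Set
  MaximalWithin K = K ⊆ W × Clique G K × (∃[ v ] v ∈ K) ×
    (∀ w → w ∈ W → (∀ u → u ∈ K → u ≢ w → E G u w) → w ∈ K)

  StrongWithin : Subset (size G) → Set
  StrongWithin S = S ⊆ W × Stable G S × (∀ K → MaximalWithin K → ∃[ v ] (v ∈ K × v ∈ S))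

  module _ {Z : Subset (size G)} (suspect : Suspect G Z) {v : V G} (v∉W : v ∉ W) where

    ∣W∣<size : ∣ W ∣ < size G
    ∣W∣<size = subst (∣ W ∣ <_) (Subsetₚ.∣⊤∣≡n (size G))
      (p⊂q⇒∣p∣<∣q∣ ((λ _ → Subsetₚ.∈⊤) , v , Subsetₚ.∈⊤ , v∉W))

    -- All of `Bad` except the absence of a strong set is inherited by the induced subgraph, so by
    -- minimality that absence must fail. This gives existence only up to double negation.
    strong-within : ¬ ¬ (∃[ S ] (StrongWithin S × (∀ {z} → z ∈ Z → z ∈ W → z ∈ S)))
    strong-within ¬ex = finish suspect
      where
      none : ¬ (∃[ S ] (StrongStable (G [ W ]) S × Z∩W Z ⊆ S))
      none (S , (st , meets) , Z⊆S) = ¬ex (S↑ , (S⊆W , stable , meets↑) , Z⊆S↑)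
        where
        S? : Decidable (λ u → ∃[ i ] (i ∈ S × nth W i ≡ u))
        S? u = any? (λ i → (i ∈? S) ×-dec (nth W i ≟ u))
        S↑ : Subset (size G)
        S↑ = subsetOf S?
        S⊆W : S↑ ⊆ W
        S⊆W m with ∈-subsetOf⁻ S? m
        ... | i , _ , refl = nth-∈ W i
        stable : Stable G S↑
        stable u w u∈ w∈ e with ∈-subsetOf⁻ S? u∈ | ∈-subsetOf⁻ S? w∈
        ... | i , i∈ , refl | j , j∈ , refl = st i j i∈ j∈ e
        Z⊆S↑ : ∀ {z} → z ∈ Z → z ∈ W → z ∈ S↑
        Z⊆S↑ {z} z∈ z∈W with nth-surjective W z∈W
        ... | i , refl = ∈-subsetOf⁺ S? (i , Z⊆S (∈-subsetOf⁺ (member? Z) z∈) , refl)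
        meets↑ : ∀ K → MaximalWithin K → ∃[ u ] (u ∈ K × u ∈ S↑)
        meets↑ K (K⊆W , cl , (k , k∈K) , max) with nth-surjective W (K⊆W k∈K)
        ... | k' , refl with meets (Z∩W K)
                (  (λ i j i∈ j∈ ne → cl _ _ (∈-subsetOf⁻ (member? K) i∈) (∈-subsetOf⁻ (member? K) j∈) (λ e → ne (nth-injective W e)))
                 , (k' , ∈-subsetOf⁺ (member? K) k∈K)
                 , λ K' cl' K⊆K' {i} i∈ → ∈-subsetOf⁺ (member? K) (max (nth W i) (nth-∈ W i) (absorb K' cl' K⊆K' i i∈)))
          where
          absorb : ∀ K' → Clique (G [ W ]) K' → Z∩W K ⊆ K' → ∀ i → i ∈ K' → ∀ u → u ∈ K → u ≢ nth W i → E G u (nth W i)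
          absorb K' cl' K⊆K' i i∈ u u∈ ne with nth-surjective W (K⊆W u∈)
          ... | j , refl = cl' j i (K⊆K' (∈-subsetOf⁺ (member? K) u∈)) i∈ (λ e → ne (cong (nth W) e))
        ...   | i , i∈K , i∈S = nth W i , ∈-subsetOf⁻ (member? K) i∈K , ∈-subsetOf⁺ S? (i , i∈S , refl)
      finish : Suspect G Z → ⊥
      finish ((cf , inn , con , sf , _) , min) =
        <-irrefl refl (<-≤-trans ∣W∣<size (min (G [ W ]) (Z∩W Z) (bad Z cf inn con sf none)))

-- Bisimplicial nonedges of cobipartite graphs

module Cobipartite (G : Graph) (X Y : Subset (size G))
  (X-clique : Clique G X) (Y-clique : Clique G Y) (X∩Y=∅ : ∀ {v} → v ∈ X → v ∉ Y)
  (no-antihole : ¬ HasLongAntihole G) where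
  open Graphs G

  data Side (v : V G) : Set where
    inX : v ∈ X → Side v
    inY : v ∈ Y → Side v

  -- Adjacency in the bipartite complement.
  H : V G → V G → Set
  H u v = ((u ∈ X × v ∈ Y) ⊎ (u ∈ Y × v ∈ X)) × ¬ E G u v

  H? : ∀ u v → Dec (H u v)
  H? u v = (((u ∈? X) ×-dec (v ∈? Y)) ⊎-dec ((u ∈? Y) ×-dec (v ∈? X))) ×-dec ¬? (E? u v)

  H-sym : ∀ {u v} → H u v → H v u
  H-sym (inj₁ (p , q) , n) = inj₂ (q , p) , λ e → n (E-sym e)
  H-sym (inj₂ (p , q) , n) = inj₁ (q , p) , λ e → n (E-sym e)

  H-sides : ∀ {u v} → H u v → Side u
  H-sides (inj₁ (p , _) , _) = inX p
  H-sides (inj₂ (p , _) , _) = inY p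

  H-XY : ∀ {u v} → H u v → v ∈ Y → u ∈ X
  H-XY (inj₁ (p , _) , _) _ = p
  H-XY (inj₂ (_ , p) , _) q = ⊥-elim (X∩Y=∅ p q)

  H-YX : ∀ {u v} → H u v → v ∈ X → u ∈ Y
  H-YX (inj₂ (p , _) , _) _ = p
  H-YX (inj₁ (_ , p) , _) q = ⊥-elim (X∩Y=∅ q p)

  ¬H⇒E : ∀ {u v} → Side u → Side v → u ≢ v → ¬ H u v → E G u v
  ¬H⇒E (inX p) (inX q) ne _ = X-clique _ _ p q ne
  ¬H⇒E (inY p) (inY q) ne _ = Y-clique _ _ p q ne
  ¬H⇒E (inX p) (inY q) ne n = decidable-stable (E? _ _) (λ ¬e → n (inj₁ (p , q) , ¬e))
  ¬H⇒E (inY p) (inX q) ne n = decidable-stable (E? _ _) (λ ¬e → n (inj₂ (p , q) , ¬e))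

  OrdAdj : ℕ → ℕ → ℕ → Set
  OrdAdj k i j = suc i ≡ j ⊎ (i ≡ 0 × suc j ≡ k)

  -- For distinct vertices of X ∪ Y, adjacency in `G` is the complement of `H`, so an induced cycle
  -- of `H` is an antihole of `G`. Pairs are compared in increasing order only; `OrdAdj` is cyclic
  -- adjacency on those.
  antihole : ∀ k (p : ℕ → V G) → 6 ≤ k → (∀ i → i < k → Side (p i)) →
    (∀ i j → i < j → j < k → p i ≢ p j) →
    (∀ i j → i < j → j < k → H (p i) (p j) → OrdAdj k i j) →
    (∀ i j → i < j → j < k → OrdAdj k i j → H (p i) (p j)) → ⊥
  antihole k p 6≤k sides distinct H⇒ ⇒H = no-antihole (k , 6≤k , record
    { emb = f ; emb-inj = f-inj ; emb-adj = f-adj })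
    where
    f : Fin k → V G
    f i = p (toℕ i)
    f-inj : Injective _≡_ _≡_ f
    f-inj {i} {j} e with <-cmp (toℕ i) (toℕ j)
    ... | tri< i<j _ _ = ⊥-elim (distinct _ _ i<j (toℕ<n j) e)
    ... | tri≈ _ i≡j _ = toℕ-injective i≡j
    ... | tri> _ _ j<i = ⊥-elim (distinct _ _ j<i (toℕ<n i) (sym e))
    from : ∀ i j → toℕ i < toℕ j → CycAdj k i j → H (f i) (f j)
    from i j i<j (inj₁ (inj₁ e)) = ⇒H _ _ i<j (toℕ<n j) (inj₁ e)
    from i j i<j (inj₁ (inj₂ e)) = ⊥-elim (ℕₚ.<-asym i<j (subst (toℕ j <_) e ≤-refl))
    from i j i<j (inj₂ (inj₁ (e , e'))) = ⇒H _ _ i<j (toℕ<n j) (inj₂ (e , e'))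
    from i j i<j (inj₂ (inj₂ (e , e'))) = ⊥-elim (ℕₚ.n≮0 (subst (toℕ i <_) e i<j))
    cyc-sym : ∀ {i j} → CycAdj k i j → CycAdj k j i
    cyc-sym (inj₁ (inj₁ e)) = inj₁ (inj₂ e)
    cyc-sym (inj₁ (inj₂ e)) = inj₁ (inj₁ e)
    cyc-sym (inj₂ (inj₁ h)) = inj₂ (inj₂ h)
    cyc-sym (inj₂ (inj₂ h)) = inj₂ (inj₁ h)
    ord⇒cyc : ∀ {i j} → OrdAdj k (toℕ i) (toℕ j) → CycAdj k i j
    ord⇒cyc (inj₁ e) = inj₁ (inj₁ e)
    ord⇒cyc (inj₂ h) = inj₂ (inj₁ h)
    f-adj : ∀ i j → (E G (f i) (f j) → AntiAdj k i j) × (AntiAdj k i j → E G (f i) (f j))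
    f-adj i j = to , back
      where
      to : E G (f i) (f j) → AntiAdj k i j
      to e = (λ { refl → E-irrefl e }) , cyc
        where
        cyc : ¬ CycAdj k i j
        cyc c with <-cmp (toℕ i) (toℕ j)
        ... | tri< i<j _ _ = proj₂ (from i j i<j c) e
        ... | tri≈ _ i≡j _ = E⇒≢ e (cong p i≡j)
        ... | tri> _ _ j<i = proj₂ (from j i j<i (cyc-sym {i} {j} c)) (E-sym e)
      back : AntiAdj k i j → E G (f i) (f j)
      back (ne , ¬c) = ¬H⇒E (sides _ (toℕ<n i)) (sides _ (toℕ<n j)) (λ e → ne (f-inj e)) ¬H
        where
        ¬H : ¬ H (f i) (f j)
        ¬H hh with <-cmp (toℕ i) (toℕ j)
        ... | tri< i<j _ _ = ¬c (ord⇒cyc {i} {j} (H⇒ _ _ i<j (toℕ<n j) hh))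
        ... | tri≈ _ i≡j _ = ne (toℕ-injective i≡j)
        ... | tri> _ _ j<i = ¬c (cyc-sym {j} {i} (ord⇒cyc {j} {i} (H⇒ _ _ j<i (toℕ<n i) (H-sym hh))))

  infixr 5 _∷_ _++ʷ_

  data Walk (S : V G → Set) : ℕ → V G → V G → Set where
    []  : ∀ {u} → Walk S 0 u u
    _∷_ : ∀ {n u v w} → H u v × S u × S v → Walk S n v w → Walk S (suc n) u w

  walk-map : ∀ {S T n u v} → (∀ {w} → S w → T w) → Walk S n u v → Walk T n u v
  walk-map f [] = []
  walk-map f ((h , s , t) ∷ w) = (h , f s , f t) ∷ walk-map f w

  _++ʷ_ : ∀ {S m n u v w} → Walk S m u v → Walk S n v w → Walk S (m + n) u w
  []      ++ʷ w' = w'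
  (e ∷ w) ++ʷ w' = e ∷ (w ++ʷ w')

  walk-reverse : ∀ {S n u v} → Walk S n u v → Walk S n v u
  walk-reverse [] = []
  walk-reverse {S} {suc n} {u} {v} ((h , s , t) ∷ w) =
    subst (λ k → Walk S k v u) (+-comm n 1) (walk-reverse w ++ʷ ((H-sym h , t , s) ∷ []))

  at : ∀ {S n u v} → Walk S n u v → ℕ → V G
  at {u = u} w zero = u
  at {u = u} [] (suc i) = u
  at (e ∷ w) (suc i) = at w i

  at-end : ∀ {S n u v} (w : Walk S n u v) → at w n ≡ v
  at-end []      = refl
  at-end (e ∷ w) = at-end w

  at-step : ∀ {S n u v} (w : Walk S n u v) i → i < n → H (at w i) (at w (suc i)) × S (at w i) × S (at w (suc i))
  at-step (e ∷ w) (suc i) (s≤s p) = at-step w i p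
  at-step (e ∷ []) zero _ = e
  at-step (e ∷ (e' ∷ w)) zero _ = e

  prefix : ∀ {S n u v} (w : Walk S n u v) i → i ≤ n → Walk S i u (at w i)
  prefix w zero _ = []
  prefix (e ∷ w) (suc i) (s≤s p) = e ∷ prefix w i p

  suffix : ∀ {S n u v} (w : Walk S n u v) i → i ≤ n → Walk S (n ∸ i) (at w i) v
  suffix w zero _ = w
  suffix (e ∷ w) (suc i) (s≤s p) = suffix w i p

  Away : Subset (size G) → V G → Set
  Away D u = u ∉ D × (∀ d → d ∈ D → ¬ H d u)

  -- A shortest walk through D closes to a hole of H with the edge x y, which is an antihole of G.
  module Detour (D : Subset (size G)) {x y x' y' : V G} (x∈X : x ∈ X) (y∈Y : y ∈ Y) (x'∈X : x' ∈ X) (y'∈Y : y' ∈ Y)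
    (Hxy : H x y) (Hx'y : H x' y) (Hxy' : H x y') (¬Hx'y' : ¬ H x' y') (x'≢x : x' ≢ x) (y'≢y : y' ≢ y)
    (awayx : Away D x) (awayy : Away D y) where

    D⁺ : V G → Set
    D⁺ w = w ∈ D ⊎ w ≡ x' ⊎ w ≡ y'

    x'≢y' : x' ≢ y'
    x'≢y' refl = X∩Y=∅ x'∈X y'∈Y

    module Shortest (n : ℕ) (walk : Walk D⁺ n x' y') (shorter : ∀ {m} → m < n → ¬ Walk D⁺ m x' y') where
      w : ℕ → V G
      w = at walk

      no-chord : ∀ i j → suc i < j → j ≤ n → ¬ H (w i) (w j)
      no-chord i (suc j) (s≤s i<j) j<n hh =
        shorter bound (prefix walk i (<⇒≤ i<n) ++ʷ
          ((hh , proj₁ (proj₂ (at-step walk i i<n)) , proj₂ (proj₂ (at-step walk j j<n)))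
           ∷ suffix walk (suc j) j<n))
        where
        i<n : i < n
        i<n = ℕₚ.<-trans i<j j<n
        bound : i + suc (n ∸ suc j) < n
        bound = <-≤-trans (ℕₚ.+-monoˡ-< (suc (n ∸ suc j)) i<j)
          (ℕₚ.≤-reflexive (trans (+-suc j _) (m+[n∸m]≡n j<n)))

      -- A repetition would make a chord from one copy to a neighbour of the other: the successor of
      -- the later one, or at the end of the walk the predecessor of the earlier one.
      distinct : ∀ i j → i < j → j ≤ n → w i ≢ w j
      distinct i j i<j j≤n e with m≤n⇒m<n∨m≡n j≤n
      ... | inj₁ j<n = no-chord i (suc j) (s≤s i<j) j<n (subst (λ z → H z (w (suc j))) (sym e) (proj₁ (at-step walk j j<n)))
      distinct zero j i<j j≤n e | inj₂ refl = x'≢y' (trans e (at-end walk))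
      distinct (suc i) j i<j j≤n e | inj₂ refl =
        no-chord i j i<j j≤n (subst (H (w i)) e (proj₁ (at-step walk i (ℕₚ.<-trans ≤-refl i<j))))

      interior : ∀ i → 0 < i → i < n → w i ∈ D
      interior i 0<i i<n with proj₁ (proj₂ (at-step walk i i<n))
      ... | inj₁ d = d
      ... | inj₂ (inj₁ e) = ⊥-elim (distinct 0 i 0<i (<⇒≤ i<n) (sym e))
      ... | inj₂ (inj₂ e) = ⊥-elim (distinct i n i<n ≤-refl (trans e (sym (at-end walk))))

      -- The ends lie on opposite sides and are not joined in `H`, which excludes lengths 0, 1 and
      -- 2. The cycle of 3 + n vertices thus has length at least 6.
      3≤ : ∀ {m} → Walk D⁺ m x' y' → 3 ≤ m
      3≤ w = lemma w refl refl
        where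
        lemma : ∀ {m a b} → Walk D⁺ m a b → a ≡ x' → b ≡ y' → 3 ≤ m
        lemma [] refl q = ⊥-elim (x'≢y' q)
        lemma ((e , _) ∷ []) refl refl = ⊥-elim (¬Hx'y' e)
        lemma ((e , _) ∷ ((e' , _) ∷ [])) refl refl = ⊥-elim (X∩Y=∅ x'∈X (H-YX' e e'))
          where
          H-YX' : ∀ {b} → H x' b → H b y' → x' ∈ Y
          H-YX' p q = ⊥-elim (X∩Y=∅ (H-XY q y'∈Y) (H-YX (H-sym p) x'∈X))
        lemma (_ ∷ (_ ∷ (_ ∷ _))) _ _ = s≤s (s≤s (s≤s z≤n))

      w-sides : ∀ i → i ≤ n → Side (w i)
      w-sides i i≤n with m≤n⇒m<n∨m≡n i≤n
      ... | inj₁ i<n = H-sides (proj₁ (at-step walk i i<n))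
      ... | inj₂ refl = subst Side (sym (at-end walk)) (inY y'∈Y)

      data Place (i : ℕ) : Set where
        initial  : i ≡ 0 → Place i
        middle : 0 < i → i < n → Place i
        final  : i ≡ n → Place i

      place : ∀ i → i ≤ n → Place i
      place zero _ = initial refl
      place (suc i) p with m≤n⇒m<n∨m≡n p
      ... | inj₁ q = middle (s≤s z≤n) q
      ... | inj₂ q = final q

      w≢x : ∀ i → i ≤ n → w i ≢ x
      w≢x i p e with place i p
      ... | initial refl = x'≢x e
      ... | middle a b = proj₁ awayx (subst (_∈ D) e (interior i a b))
      ... | final refl = X∩Y=∅ x∈X (subst (_∈ Y) (trans (sym (at-end walk)) e) y'∈Y)

      w≢y : ∀ i → i ≤ n → w i ≢ y
      w≢y i p e with place i p
      ... | initial refl = X∩Y=∅ x'∈X (subst (_∈ Y) (sym e) y∈Y)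
      ... | middle a b = proj₁ awayy (subst (_∈ D) e (interior i a b))
      ... | final refl = y'≢y (trans (sym (at-end walk)) e)

      Hwx : ∀ i → i ≤ n → H (w i) x → i ≡ n
      Hwx i p e with place i p
      ... | initial refl = ⊥-elim (X∩Y=∅ x'∈X (H-YX e x∈X))
      ... | middle a b = ⊥-elim (proj₂ awayx _ (interior i a b) e)
      ... | final q = q

      Hwy : ∀ i → i ≤ n → H (w i) y → i ≡ 0
      Hwy i p e with place i p
      ... | initial q = q
      ... | middle a b = ⊥-elim (proj₂ awayy _ (interior i a b) e)
      ... | final refl = ⊥-elim (X∩Y=∅ (H-XY e y∈Y) (subst (_∈ Y) (sym (at-end walk)) y'∈Y))

      data Index : ℕ → Set where
        on-walk : ∀ {i} → i ≤ n → Index i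
        at-x    : Index (suc n)
        at-y    : Index (suc (suc n))

      index : ∀ i → i < 3 + n → Index i
      index i (s≤s p) with m≤n⇒m<n∨m≡n p
      ... | inj₂ refl = at-y
      ... | inj₁ (s≤s q) with m≤n⇒m<n∨m≡n q
      ...   | inj₂ refl = at-x
      ...   | inj₁ (s≤s s) = on-walk s

      -- The cyclic order of the hole: the walk from x' to y', then `x`, then `y`.
      p : ℕ → V G
      p i with i ≤? n
      ... | yes _ = w i
      ... | no _ with i ℕₚ.≟ suc n
      ...   | yes _ = x
      ...   | no _ = y

      p-walk : ∀ {i} → i ≤ n → p i ≡ w i
      p-walk {i} q with i ≤? n
      ... | yes _ = refl
      ... | no ¬q = ⊥-elim (¬q q)

      p-x : p (suc n) ≡ x
      p-x with suc n ≤? n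
      ... | yes q = ⊥-elim (1+n≰n q)
      ... | no _ with suc n ℕₚ.≟ suc n
      ...   | yes _ = refl
      ...   | no ne = ⊥-elim (ne refl)

      p-y : p (suc (suc n)) ≡ y
      p-y with suc (suc n) ≤? n
      ... | yes q = ⊥-elim (1+n≰n (≤-trans (n≤1+n _) q))
      ... | no _ with suc (suc n) ℕₚ.≟ suc n
      ...   | yes e = ⊥-elim (1+n≢n e)
      ...   | no _ = refl

      contradictory : ⊥
      contradictory = antihole (3 + n) p (s≤s (s≤s (s≤s (3≤ walk)))) sides distinct' H⇒ ⇒H
        where
        sides : ∀ i → i < 3 + n → Side (p i)
        sides i q with index i q
        ... | on-walk s rewrite p-walk s = w-sides i s
        ... | at-x rewrite p-x = inX x∈X
        ... | at-y rewrite p-y = inY y∈Y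
        distinct' : ∀ i j → i < j → j < 3 + n → p i ≢ p j
        distinct' i j i<j q e with index i (ℕₚ.<-trans i<j q) | index j q
        ... | on-walk a | on-walk b rewrite p-walk a | p-walk b = distinct i j i<j b e
        ... | on-walk a | at-x rewrite p-walk a | p-x = w≢x i a e
        ... | on-walk a | at-y rewrite p-walk a | p-y = w≢y i a e
        ... | at-x | on-walk b = ℕₚ.<-asym i<j (s≤s b)
        ... | at-x | at-x = <-irrefl refl i<j
        ... | at-x | at-y rewrite p-x | p-y = X∩Y=∅ x∈X (subst (_∈ Y) (sym e) y∈Y)
        ... | at-y | on-walk b = <-irrefl refl (ℕₚ.<-trans (ℕₚ.<-trans i<j (s≤s b)) ≤-refl)
        ... | at-y | at-x = ℕₚ.<-asym i<j ≤-refl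
        ... | at-y | at-y = <-irrefl refl i<j
        H⇒ : ∀ i j → i < j → j < 3 + n → H (p i) (p j) → OrdAdj (3 + n) i j
        H⇒ i j i<j q e with index i (ℕₚ.<-trans i<j q) | index j q
        ... | on-walk a | at-x rewrite p-walk a | p-x = inj₁ (cong suc (Hwx i a e))
        ... | on-walk a | at-y rewrite p-walk a | p-y = inj₂ (Hwy i a e , refl)
        ... | at-x | on-walk b = ⊥-elim (ℕₚ.<-asym i<j (s≤s b))
        ... | at-x | at-x = ⊥-elim (<-irrefl refl i<j)
        ... | at-x | at-y = inj₁ refl
        ... | at-y | on-walk b = ⊥-elim (<-irrefl refl (ℕₚ.<-trans (ℕₚ.<-trans i<j (s≤s b)) ≤-refl))
        ... | at-y | at-x = ⊥-elim (ℕₚ.<-asym i<j ≤-refl)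
        ... | at-y | at-y = ⊥-elim (<-irrefl refl i<j)
        ... | on-walk a | on-walk b rewrite p-walk a | p-walk b with m≤n⇒m<n∨m≡n i<j
        ...   | inj₁ far = ⊥-elim (no-chord i j far b e)
        ...   | inj₂ next = inj₁ next
        ⇒H : ∀ i j → i < j → j < 3 + n → OrdAdj (3 + n) i j → H (p i) (p j)
        ⇒H i j i<j q (inj₁ refl) with index i (ℕₚ.<-trans i<j q) | index (suc i) q
        ... | on-walk a | on-walk b rewrite p-walk a | p-walk b = proj₁ (at-step walk i b)
        ... | on-walk a | at-x rewrite p-walk a | p-x | at-end walk = H-sym Hxy'
        ... | on-walk a | at-y = ⊥-elim (1+n≰n a)
        ... | at-x | on-walk b = ⊥-elim (ℕₚ.<-asym i<j (s≤s b))
        ... | at-x | at-y rewrite p-x | p-y = Hxy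
        ... | at-y | on-walk b = ⊥-elim (1+n≰n (≤-trans (n≤1+n _) (≤-trans (n≤1+n _) b)))
        ⇒H zero j i<j q (inj₂ (refl , refl)) rewrite p-walk {0} z≤n | p-y = Hx'y

    -- Strong induction on the length provides the assumption that the walk is shortest.
    no-walk : ∀ n → ¬ Walk D⁺ n x' y'
    no-walk = <-rec _ (λ n shorter walk → Shortest.contradictory n walk (λ m<n → shorter m<n))

  HasEdge : Subset (size G) → Set
  HasEdge F = ∃[ x ] ∃[ y ] (x ∈ F × y ∈ F × x ∈ X × y ∈ Y × H x y)

  Bisimplicial : Subset (size G) → V G → V G → Set
  Bisimplicial F x y = ∀ x' y' → x' ∈ F → y' ∈ F → H x' y → H x y' → H x' y'

  HasBisimplicial : Subset (size G) → Set
  HasBisimplicial F = ∃[ x ] ∃[ y ] (x ∈ F × y ∈ F × x ∈ X × y ∈ Y × H x y × Bisimplicial F x y)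

  away? : ∀ D → Decidable (Away D)
  away? D u = ¬? (u ∈? D) ×-dec all? (λ d → (d ∈? D) →-dec ¬? (H? d u))

  Outside? : ∀ F D → Decidable (λ u → u ∈ F × Away D u)
  Outside? F D u = (u ∈? F) ×-dec away? D u

  outside : Subset (size G) → Subset (size G) → Subset (size G)
  outside F D = subsetOf (Outside? F D)

  hasEdge? : ∀ F → Dec (HasEdge F)
  hasEdge? F = any? λ x → any? λ y → (x ∈? F) ×-dec (y ∈? F) ×-dec (x ∈? X) ×-dec (y ∈? Y) ×-dec H? x y

  _∪₁_ : Subset (size G) → V G → Subset (size G)
  D ∪₁ s = subsetOf (λ u → (u ∈? D) ⊎-dec (u ≟ s))

  ∪₁⁻ : ∀ {D s u} → u ∈ D ∪₁ s → u ∈ D ⊎ u ≡ s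
  ∪₁⁻ {D} {s} = ∈-subsetOf⁻ (λ u → (u ∈? D) ⊎-dec (u ≟ s))

  ∪₁⁺ : ∀ {D s u} → u ∈ D ⊎ u ≡ s → u ∈ D ∪₁ s
  ∪₁⁺ {D} {s} = ∈-subsetOf⁺ (λ u → (u ∈? D) ⊎-dec (u ≟ s))

  module Separation (F : Subset (size G)) (v : V G) (v∈F : v ∈ F)
    (smaller : ∀ F' → F' ⊆ F → v ∉ F' → HasEdge F' → HasBisimplicial F') where

    ConnectedTo : Subset (size G) → Set
    ConnectedTo D = v ∈ D × (∀ d → d ∈ D → ∃[ n ] Walk (_∈ D) n v d)

    extend : ∀ {D s d} → ConnectedTo D → d ∈ D → H d s → ConnectedTo (D ∪₁ s)
    extend {D} {s} {d} (v∈D , con) d∈D e = ∪₁⁺ (inj₁ v∈D) , con⁺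
      where
      con⁺ : ∀ u → u ∈ D ∪₁ s → ∃[ n ] Walk (_∈ D ∪₁ s) n v u
      con⁺ u m with ∪₁⁻ m
      ... | inj₁ u∈D = proj₁ (con u u∈D) , walk-map (λ p → ∪₁⁺ (inj₁ p)) (proj₂ (con u u∈D))
      ... | inj₂ refl = proj₁ (con d d∈D) + 1 , walk-map (λ p → ∪₁⁺ (inj₁ p)) (proj₂ (con d d∈D))
              ++ʷ ((e , ∪₁⁺ (inj₁ d∈D) , ∪₁⁺ (inj₂ refl)) ∷ [])

    Frontier : Subset (size G) → V G → Set
    Frontier D s = s ∈ F × s ∉ D × ∃[ d ] (d ∈ D × H d s)

    frontier? : ∀ D → Decidable (Frontier D)
    frontier? D s = (s ∈? F) ×-dec ¬? (s ∈? D) ×-dec any? (λ d → (d ∈? D) ×-dec H? d s)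

    -- A bisimplicial edge of the part away from `D` stays bisimplicial in `F`: new neighbours of
    -- its ends lie on the frontier. A frontier vertex meets every edge of that part, which settles
    -- pairs with one frontier vertex; two frontier vertices that are not joined would close a long
    -- hole through the connected set `D`.
    finish : ∀ D → ConnectedTo D → HasEdge (outside F D) →
      (∀ s → Frontier D s → ¬ HasEdge (outside F (D ∪₁ s))) → HasBisimplicial F
    finish D (v∈D , con) edge maximal
      with smaller (outside F D) (λ m → proj₁ (∈-subsetOf⁻ (Outside? F D) m))
             (λ m → proj₁ (proj₂ (∈-subsetOf⁻ (Outside? F D) m)) v∈D) edge
    ... | x , y , x∈ , y∈ , x∈X , y∈Y , Hxy , bis
      with ∈-subsetOf⁻ (Outside? F D) x∈ | ∈-subsetOf⁻ (Outside? F D) y∈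
    ...   | x∈F , awayx | y∈F , awayy = x , y , x∈F , y∈F , x∈X , y∈Y , Hxy , bis⁺
      where
      side? : ∀ u → u ∈ F → u ∉ D → u ∈ outside F D ⊎ Frontier D u
      side? u u∈F u∉D with frontier? D u
      ... | yes f = inj₂ f
      ... | no ¬f = inj₁ (∈-subsetOf⁺ (Outside? F D) (u∈F , u∉D , λ d d∈D e → ¬f (u∈F , u∉D , d , d∈D , e)))
      -- By maximality of D a frontier vertex meets every edge outside D.
      meets : ∀ s a b → Frontier D s → a ∈ outside F D → b ∈ outside F D → a ∈ X → b ∈ Y → H a b → ¬ H s a → ¬ H s b → ⊥
      meets s a b f@(_ , _ , d , d∈D , e) a∈ b∈ a∈X b∈Y Hab ¬sa ¬sb =
        maximal s f (a , b , out a∈ ¬sa , out b∈ ¬sb , a∈X , b∈Y , Hab)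
        where
        out : ∀ {u} → u ∈ outside F D → ¬ H s u → u ∈ outside F (D ∪₁ s)
        out {u} m ¬su with ∈-subsetOf⁻ (Outside? F D) m
        ... | u∈F , u∉D , away = ∈-subsetOf⁺ (Outside? F (D ∪₁ s))
          (u∈F , (λ m' → case ∪₁⁻ m' of λ { (inj₁ p) → u∉D p ; (inj₂ refl) → away d d∈D e })
               , λ w m' → case ∪₁⁻ m' of λ { (inj₁ p) → away w p ; (inj₂ refl) → ¬su })
      bis⁺ : Bisimplicial F x y
      bis⁺ x' y' x'∈F y'∈F Hx'y Hxy'
        with side? x' x'∈F (λ p → proj₂ awayy x' p Hx'y) | side? y' y'∈F (λ p → proj₂ awayx y' p (H-sym Hxy'))
      ... | inj₁ p | inj₁ q = bis x' y' p q Hx'y Hxy'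
      ... | inj₂ f | inj₁ q = decidable-stable (H? x' y') (λ ¬h →
              meets x' x y' f x∈ q x∈X (H-YX (H-sym Hxy') x∈X) Hxy' (λ e → X∩Y=∅ (H-XY Hx'y y∈Y) (H-YX e x∈X)) ¬h)
      ... | inj₁ p | inj₂ f = decidable-stable (H? x' y') (λ ¬h →
              meets y' x' y f p y∈ (H-XY Hx'y y∈Y) y∈Y Hx'y (λ e → ¬h (H-sym e))
                (λ e → X∩Y=∅ (H-XY e y∈Y) (H-YX (H-sym Hxy') x∈X)))
      ... | inj₂ (_ , _ , d , d∈D , e) | inj₂ (_ , _ , d' , d'∈D , e') = decidable-stable (H? x' y') (λ ¬h →
              Detour.no-walk D x∈X y∈Y (H-XY Hx'y y∈Y) (H-YX (H-sym Hxy') x∈X) Hxy Hx'y Hxy' ¬h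
                (λ { refl → proj₂ awayx d d∈D e }) (λ { refl → proj₂ awayy d' d'∈D e' }) awayx awayy _
                (((H-sym e , inj₂ (inj₁ refl) , inj₁ d∈D) ∷ [])
                 ++ʷ walk-map inj₁ (walk-reverse (proj₂ (con d d∈D)))
                 ++ʷ walk-map inj₁ (proj₂ (con d' d'∈D))
                 ++ʷ ((e' , inj₁ d'∈D , inj₂ (inj₂ refl)) ∷ [])))

    grow : ∀ m D → size G < ∣ D ∣ + m → ConnectedTo D → HasEdge (outside F D) → HasBisimplicial F
    grow m D bound con edge with any? (λ s → frontier? D s ×-dec hasEdge? (outside F (D ∪₁ s)))
    ... | no none = finish D con edge (λ s f h → none (s , f , h))
    grow zero D bound con edge | yes _ =
      ⊥-elim (<-irrefl refl (<-≤-trans bound (≤-trans (ℕₚ.≤-reflexive (+-identityʳ _)) (∣p∣≤n D))))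
    grow (suc m) D bound con edge | yes (s , (s∈F , s∉D , d , d∈D , e) , edge') =
      grow m (D ∪₁ s) (<-≤-trans bound (subst (_≤ ∣ D ∪₁ s ∣ + m) (sym (+-suc ∣ D ∣ m)) (ℕₚ.+-monoˡ-≤ m
        (p⊂q⇒∣p∣<∣q∣ ((λ p → ∪₁⁺ (inj₁ p)) , s , ∪₁⁺ (inj₂ refl) , s∉D))))) (extend con d∈D e) edge'

  private
    Apart : Subset (size G) → V G → Set
    Apart F v = v ∈ F × ∃[ x ] ∃[ y ] (x ∈ F × y ∈ F × x ∈ X × y ∈ Y × H x y × x ≢ v × y ≢ v × ¬ H v x × ¬ H v y)

    apart? : ∀ F → Decidable (Apart F)
    apart? F v = (v ∈? F) ×-dec any? λ x → any? λ y → (x ∈? F) ×-dec (y ∈? F) ×-dec (x ∈? X) ×-dec (y ∈? Y)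
      ×-dec H? x y ×-dec ¬? (x ≟ v) ×-dec ¬? (y ≟ v) ×-dec ¬? (H? v x) ×-dec ¬? (H? v y)

  -- If no vertex is apart from an edge, every edge is bisimplicial: an unjoined pair x', y' would
  -- leave x' apart from the edge x y'. Otherwise a vertex `v` apart from some edge starts the
  -- growing set as D = {v}.
  bisimplicial-within : ∀ m F → ∣ F ∣ < m → HasEdge F → HasBisimplicial F
  bisimplicial-within (suc m) F (s≤s ∣F∣≤m) edge@(x , y , x∈F , y∈F , x∈X , y∈Y , Hxy) with any? (apart? F)
  ... | no none = x , y , x∈F , y∈F , x∈X , y∈Y , Hxy , λ x' y' x'∈F y'∈F Hx'y Hxy' →
          decidable-stable (H? x' y') (λ ¬h → none (x' , x'∈F , x , y' , x∈F , y'∈F , x∈X , H-YX (H-sym Hxy') x∈X , Hxy' ,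
            (λ { refl → ¬h Hxy' }) , (λ { refl → X∩Y=∅ (H-XY Hx'y y∈Y) (H-YX (H-sym Hxy') x∈X) }) ,
            (λ e → X∩Y=∅ (H-XY Hx'y y∈Y) (H-YX e x∈X)) , ¬h))
  ... | yes (v , v∈F , a , b , a∈F , b∈F , a∈X , b∈Y , Hab , a≢v , b≢v , ¬va , ¬vb) =
    grow (suc (size G)) D (ℕₚ.m≤n+m (suc (size G)) ∣ D ∣)
      (D∋v , λ { d d∈ → case ∈-subsetOf⁻ (_≟ v) d∈ of λ { refl → 0 , [] } })
      (a , b , out a∈F a≢v ¬va , out b∈F b≢v ¬vb , a∈X , b∈Y , Hab)
    where
    open Separation F v v∈F (λ F' F'⊆F v∉F' → bisimplicial-within m F'
      (<-≤-trans (p⊂q⇒∣p∣<∣q∣ (F'⊆F , v , v∈F , v∉F')) ∣F∣≤m))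
    D : Subset (size G)
    D = subsetOf (_≟ v)
    D∋v : v ∈ D
    D∋v = ∈-subsetOf⁺ (_≟ v) refl
    out : ∀ {u} → u ∈ F → u ≢ v → ¬ H v u → u ∈ outside F D
    out u∈F u≢v ¬h = ∈-subsetOf⁺ (Outside? F D) (u∈F , (λ m → u≢v (∈-subsetOf⁻ (_≟ v) m)) ,
      λ d d∈ e → case ∈-subsetOf⁻ (_≟ v) d∈ of λ { refl → ¬h e })

  bisimplicial-nonedge : ∀ x y → x ∈ X → y ∈ Y → ¬ E G x y →
    ∃[ p ] ∃[ q ] (p ∈ X × q ∈ Y × ¬ E G p q × (∀ p' q' → p' ∈ X → q' ∈ Y → ¬ E G p' q → ¬ E G p q' → ¬ E G p' q'))
  bisimplicial-nonedge x y x∈X y∈Y ¬e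
    with bisimplicial-within (suc (size G)) Subset.⊤ (s≤s (∣p∣≤n Subset.⊤))
           (x , y , Subsetₚ.∈⊤ , Subsetₚ.∈⊤ , x∈X , y∈Y , inj₁ (x∈X , y∈Y) , ¬e)
  ... | p , q , _ , _ , p∈X , q∈Y , (_ , ¬pq) , bis = p , q , p∈X , q∈Y , ¬pq , λ p' q' p'∈X q'∈Y a b →
          proj₂ (bis p' q' Subsetₚ.∈⊤ Subsetₚ.∈⊤ (inj₁ (p'∈X , q∈Y) , a) (inj₁ (p∈X , q'∈Y) , b))

-- Maxima, smooth pairs of cliques and explicit small subgraphs

maximum : ∀ {n} {P : Fin n → Set} {_≲_ : Fin n → Fin n → Set} → Decidable P →
  (∀ {x y z} → x ≲ y → y ≲ z → x ≲ z) → (∀ x y → P x → P y → x ≲ y ⊎ y ≲ x) →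
  ∃ P → ∃[ m ] (P m × (∀ x → P x → x ≲ m))
maximum {suc n} {P} {_≲_} P? tr total (x₀ , px₀) with any? (P? ∘ suc)
... | no none with x₀ in eq
...   | zero = zero , px₀ , λ { zero p → [ id , id ]′ (total zero zero p p) ; (suc x) p → ⊥-elim (none (x , p)) }
...   | suc x = ⊥-elim (none (x , px₀))
maximum {suc n} {P} {_≲_} P? tr total (x₀ , px₀) | yes ex
  with maximum {n} {P ∘ suc} {λ x y → suc x ≲ suc y} (P? ∘ suc) tr (λ x y → total (suc x) (suc y)) ex | P? zero
... | m , pm , mx | no ¬p0 = suc m , pm , λ { zero p → ⊥-elim (¬p0 p) ; (suc x) p → mx x p }
... | m , pm , mx | yes p0 with total zero (suc m) p0 pm
...   | inj₁ le = suc m , pm , λ { zero p → le ; (suc x) p → mx x p }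
...   | inj₂ ge = zero , p0 , λ { zero p → [ id , id ]′ (total zero zero p p) ; (suc x) p → tr (mx x p) ge }

-- A pair (Xᵢ , Yᵢ) as it is seen from `G`. The field `apart` is the flatness of the augmented edge,
-- and the homogeneity fields say that an outside vertex sees all or nothing of each side.
record SmoothPair (G : Graph) (X Y : Subset (size G)) : Set where
  field
    X-clique : Clique G X
    Y-clique : Clique G Y
    disjoint : ∀ {v} → v ∈ X → v ∉ Y
    smooth-X : ∀ {u} → u ∈ X → ∃[ v ] (v ∈ Y × E G u v)
    smooth-Y : ∀ {v} → v ∈ Y → ∃[ u ] (u ∈ X × E G v u)
    homog-X  : ∀ {w u u'} → w ∉ X × w ∉ Y → u ∈ X → u' ∈ X → E G w u → E G w u'
    homog-Y  : ∀ {w v v'} → w ∉ X × w ∉ Y → v ∈ Y → v' ∈ Y → E G w v → E G w v'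
    apart    : ∀ {w u v} → w ∉ X × w ∉ Y → u ∈ X → v ∈ Y → E G w u → ¬ E G w v

flip-pair : ∀ {G X Y} → SmoothPair G X Y → SmoothPair G Y X
flip-pair s = record
  { X-clique = Y-clique ; Y-clique = X-clique ; disjoint = λ p q → disjoint q p
  ; smooth-X = smooth-Y ; smooth-Y = smooth-X
  ; homog-X = homog-Y ∘ swap ; homog-Y = homog-X ∘ swap
  ; apart = λ o a b e e' → apart (swap o) b a e' e }
  where open SmoothPair s

-- When X and Y are disjoint cliques these data give an induced four-cycle; p₁ ≠ p₂ and q₁ ≠ q₂
-- follow from the listed edges and nonedges.
record Square (G : Graph) (X Y : Subset (size G)) (p₁ p₂ q₁ q₂ : V G) : Set where
  field
    p₁∈X : p₁ ∈ X
    p₂∈X : p₂ ∈ X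
    q₁∈Y : q₁ ∈ Y
    q₂∈Y : q₂ ∈ Y
    e₁   : E G p₁ q₁
    e₂   : E G p₂ q₂
    n₁   : ¬ E G p₁ q₂
    n₂   : ¬ E G p₂ q₁

flip-square : ∀ {G X Y p₁ p₂ q₁ q₂} → Square G X Y p₁ p₂ q₁ q₂ → Square G Y X q₁ q₂ p₁ p₂
flip-square {G} s = record
  { p₁∈X = q₁∈Y ; p₂∈X = q₂∈Y ; q₁∈Y = p₁∈X ; q₂∈Y = p₂∈X
  ; e₁ = E-sym e₁ ; e₂ = E-sym e₂ ; n₁ = λ e → n₂ (E-sym e) ; n₂ = λ e → n₁ (E-sym e) }
  where
  open Square s
  open Graphs G

Trivial : (G : Graph) (X Y : Subset (size G)) → Set
Trivial G X Y = (∀ u v → u ∈ X → v ∈ X → u ≡ v) × (∀ u v → u ∈ Y → v ∈ Y → u ≡ v)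

IsSquare : (G : Graph) (X Y : Subset (size G)) → Set
IsSquare G X Y = ∃[ p₁ ] ∃[ p₂ ] ∃[ q₁ ] ∃[ q₂ ] (Square G X Y p₁ p₂ q₁ q₂ ×
  (∀ u → u ∈ X → u ≡ p₁ ⊎ u ≡ p₂) × (∀ v → v ∈ Y → v ≡ q₁ ⊎ v ≡ q₂))

tableEmbedding : (G : Graph) {A : Set} {R : A → A → Set} (R? : ∀ a b → Dec (R a b)) (f : A → V G) →
  Injective _≡_ _≡_ f → (∀ a b → adj G (f a) (f b) ≡ does (R? a b)) → Embedding G A R
tableEmbedding G {A} {R} R? f f-inj table = record { emb = f ; emb-inj = f-inj ; emb-adj = f-adj }
  where
  f-adj : ∀ a b → (E G (f a) (f b) → R a b) × (R a b → E G (f a) (f b))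
  f-adj a b with R? a b | table a b
  ... | yes p | e = (λ _ → p) , λ _ → e
  ... | no ¬p | e = (λ e' → case trans (sym e) e' of λ ()) , λ p → ⊥-elim (¬p p)

natAdj? : ∀ i j → Dec (NatAdj i j)
natAdj? i j = (suc i ℕₚ.≟ j) ⊎-dec (suc j ℕₚ.≟ i)

cycAdj? : ∀ k i j → Dec (CycAdj k i j)
cycAdj? k i j = natAdj? (toℕ i) (toℕ j) ⊎-dec
  (((toℕ i ℕₚ.≟ 0) ×-dec (suc (toℕ j) ℕₚ.≟ k)) ⊎-dec ((toℕ j ℕₚ.≟ 0) ×-dec (suc (toℕ i) ℕₚ.≟ k)))

clownAdj? : ∀ k a b → Dec (ClownAdj k a b)
clownAdj? k (inj₁ _) (inj₁ _) = no id
clownAdj? k (inj₁ _) (inj₂ j) = toℕ j <? 2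
clownAdj? k (inj₂ i) (inj₁ _) = toℕ i <? 2
clownAdj? k (inj₂ i) (inj₂ j) = cycAdj? k i j

module SmallGraphs (G : Graph) where
  open Graphs G

  ¬E⇒false : ∀ {u v} → ¬ E G u v → adj G u v ≡ false
  ¬E⇒false {u} {v} ¬e with adj G u v
  ... | true  = ⊥-elim (¬e refl)
  ... | false = refl

  Row : ∀ {n} → V G → Vec (V G) n → (Fin n → Bool) → Set
  Row u []       b = ⊤
  Row u (v ∷ vs) b = (u ≢ v × adj G u v ≡ b zero) × Row u vs (b ∘ suc)

  -- Only the entries above the diagonal.
  Table : ∀ {n} → Vec (V G) n → (Fin n → Fin n → Bool) → Set
  Table []       m = ⊤
  Table (v ∷ vs) m = Row v vs (m zero ∘ suc) × Table vs (λ i j → m (suc i) (suc j))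

  row-entry : ∀ {n u} (vs : Vec (V G) n) {b} → Row u vs b → ∀ j → u ≢ lookup vs j × adj G u (lookup vs j) ≡ b j
  row-entry (v ∷ vs) (e , row) zero    = e
  row-entry (v ∷ vs) (e , row) (suc j) = row-entry vs row j

  table-injective : ∀ {n} (vs : Vec (V G) n) m → Table vs m → ∀ i j → lookup vs i ≡ lookup vs j → i ≡ j
  table-injective (v ∷ vs) m (row , t) zero    zero    e = refl
  table-injective (v ∷ vs) m (row , t) zero    (suc j) e = ⊥-elim (proj₁ (row-entry vs row j) e)
  table-injective (v ∷ vs) m (row , t) (suc i) zero    e = ⊥-elim (proj₁ (row-entry vs row i) (sym e))
  table-injective (v ∷ vs) m (row , t) (suc i) (suc j) e = cong suc (table-injective vs (λ i j → m (suc i) (suc j)) t i j e)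

  table-adj : ∀ {n} (vs : Vec (V G) n) m → Table vs m → (∀ i j → m i j ≡ m j i) → (∀ i → m i i ≡ false) →
    ∀ i j → adj G (lookup vs i) (lookup vs j) ≡ m i j
  table-adj (v ∷ vs) m (row , t) s d zero    zero    = trans (adj-irrefl G v) (sym (d zero))
  table-adj (v ∷ vs) m (row , t) s d zero    (suc j) = proj₂ (row-entry vs row j)
  table-adj (v ∷ vs) m (row , t) s d (suc i) zero    =
    trans (adj-sym G _ v) (trans (proj₂ (row-entry vs row i)) (s zero (suc i)))
  table-adj (v ∷ vs) m (row , t) s d (suc i) (suc j) =
    table-adj vs (λ i j → m (suc i) (suc j)) t (λ i j → s (suc i) (suc j)) (d ∘ suc) i j

  joined : ∀ {u v} → E G u v → u ≢ v × adj G u v ≡ true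
  joined e = E⇒≢ e , e

  unjoined : ∀ {u v} → u ≢ v → ¬ E G u v → u ≢ v × adj G u v ≡ false
  unjoined ne ¬e = ne , ¬E⇒false ¬e

  pathMatrix : ∀ {n} → Fin n → Fin n → Bool
  pathMatrix i j = does (natAdj? (toℕ i) (toℕ j))

  point : V G → Path G
  point v = record { len = 0 ; pemb = tableEmbedding G (λ i j → natAdj? (toℕ i) (toℕ j)) (λ _ → v)
    (λ { {zero} {zero} _ → refl }) (λ { zero zero → adj-irrefl G v }) }

  path₄ : ∀ {a b c d} → E G a b → E G b c → E G c d → ¬ E G a c → ¬ E G b d → ¬ E G a d → a ≢ c → b ≢ d → a ≢ d →
    Σ[ π ∈ Path G ] (first π ≡ a × last π ≡ d × len π ≡ 3)
  path₄ {a} {b} {c} {d} ab bc cd ac bd ad a≢c b≢d a≢d = record { len = 3 ; pemb =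
      tableEmbedding G (λ i j → natAdj? (toℕ i) (toℕ j)) (lookup vs) (λ {i} {j} → table-injective vs pathMatrix table i j)
        (table-adj vs pathMatrix table
          (toWitness {a? = all? λ i → all? λ j → pathMatrix {4} i j Boolₚ.≟ pathMatrix j i} tt)
          (toWitness {a? = all? λ i → pathMatrix {4} i i Boolₚ.≟ false} tt)) } , refl , refl , refl
    where
    vs : Vec (V G) 4
    vs = a ∷ b ∷ c ∷ d ∷ []
    table : Table vs pathMatrix
    table = (joined ab , unjoined a≢c ac , unjoined a≢d ad , tt) ,
            (joined bc , unjoined b≢d bd , tt) , (joined cd , tt) , tt , tt

  -- z is the hat of a clown whose hole is a - b - c - d - a.
  clown₄ : ∀ {z a b c d} → E G a b → E G b c → E G c d → E G d a → ¬ E G a c → ¬ E G b d →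
    E G z a → E G z b → ¬ E G z c → ¬ E G z d → a ≢ c → b ≢ d → z ≢ c → z ≢ d → Σ[ D ∈ Clown G ] hat D ≡ z
  clown₄ {z} {a} {b} {c} {d} ab bc cd da ac bd za zb zc zd a≢c b≢d z≢c z≢d = record
      { ck = 4 ; ck-even = divides 2 refl ; ck-4 = ≤-refl
      ; cemb = tableEmbedding G (clownAdj? 4) (lookup vs ∘ encode)
          (λ {p} {q} e → encode-injective p q (table-injective vs matrix table _ _ e))
          (λ p q → trans (table-adj vs matrix table
            (toWitness {a? = all? λ i → all? λ j → matrix i j Boolₚ.≟ matrix j i} tt)
            (toWitness {a? = all? λ i → matrix i i Boolₚ.≟ false} tt) (encode p) (encode q))
            (cong₂ (λ p q → does (clownAdj? 4 p q)) (decode-encode p) (decode-encode q))) } , refl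
    where
    encode : ⊤ ⊎ Fin 4 → Fin 5
    encode (inj₁ _) = zero
    encode (inj₂ i) = suc i
    decode : Fin 5 → ⊤ ⊎ Fin 4
    decode zero    = inj₁ tt
    decode (suc i) = inj₂ i
    decode-encode : ∀ p → decode (encode p) ≡ p
    decode-encode (inj₁ _) = refl
    decode-encode (inj₂ _) = refl
    encode-injective : ∀ p q → encode p ≡ encode q → p ≡ q
    encode-injective p q e = trans (sym (decode-encode p)) (trans (cong decode e) (decode-encode q))
    matrix : Fin 5 → Fin 5 → Bool
    matrix i j = does (clownAdj? 4 (decode i) (decode j))
    vs : Vec (V G) 5
    vs = z ∷ a ∷ b ∷ c ∷ d ∷ []
    table : Table vs matrix
    table = (joined za , joined zb , unjoined z≢c zc , unjoined z≢d zd , tt) ,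
            (joined ab , unjoined a≢c ac , joined (E-sym da) , tt) ,
            (joined bc , unjoined b≢d bd , tt) , (joined cd , tt) , tt , tt

-- Smooth homogeneous pairs of cliques in a suspect

module SuspectPair {G : Graph} {Z : Subset (size G)} (suspect : Suspect G Z) where
  open Graphs G
  open SmallGraphs G

  private
    innocent : Innocent G
    innocent = proj₁ (proj₂ (proj₁ suspect))

    consistent : Consistent G Z
    consistent = proj₁ (proj₂ (proj₂ (proj₁ suspect)))

    all-safe : ∀ v → v ∈ Z → Safe G v
    all-safe = proj₁ (proj₂ (proj₂ (proj₂ (proj₁ suspect))))

    Z-stable : Stable G Z
    Z-stable = consistent⇒stable consistent

    none-strong : ∀ S → StrongStable G S → ¬ (Z ⊆ S)
    none-strong S st Z⊆S = proj₂ (proj₂ (proj₂ (proj₂ (proj₁ suspect)))) (S , st , Z⊆S)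

  module Sides {X Y : Subset (size G)} (pair : SmoothPair G X Y) where
    open SmoothPair pair

    ≢-sides : ∀ {u v} → u ∈ X → v ∈ Y → u ≢ v
    ≢-sides p q refl = disjoint p q

    Outer : V G → Set
    Outer w = w ∉ X × w ∉ Y

    data Position (v : V G) : Set where
      inX : v ∈ X → Position v
      inY : v ∈ Y → Position v
      out : Outer v → Position v

    position : ∀ v → Position v
    position v with v ∈? X | v ∈? Y
    ... | yes p | _ = inX p
    ... | no _ | yes q = inY q
    ... | no p | no q = out (p , q)

    outer? : Decidable Outer
    outer? w = ¬? (w ∈? X) ×-dec ¬? (w ∈? Y)

    outer≢X : ∀ {w u} → Outer w → u ∈ X → w ≢ u
    outer≢X (p , _) q refl = p q

    outer≢Y : ∀ {w u} → Outer w → u ∈ Y → w ≢ u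
    outer≢Y (_ , p) q refl = p q

    -- The outer vertex `w` sees `k` in X, so by `apart` the clique has no vertex in Y; its other
    -- outer vertices see all of X by homogeneity.
    mixed-X : ∀ {K w} → MaximalClique G K → w ∈ K → Outer w → ∀ {k} → k ∈ K → k ∈ X → ∀ {p} → p ∈ X → p ∈ K
    mixed-X {K} {w} mc w∈K ow {k} k∈K k∈X {p} p∈X = maximal-absorbs mc go
      where
      go : ∀ u → u ∈ K → u ≢ p → E G u p
      go u u∈K ne with position u
      ... | inX q = X-clique u p q p∈X ne
      ... | inY q = ⊥-elim (apart ow k∈X q
                      (proj₁ mc w k w∈K k∈K (outer≢X ow k∈X)) (proj₁ mc w u w∈K u∈K (outer≢Y ow q)))
      ... | out q = homog-X q k∈X p∈X (proj₁ mc u k u∈K k∈K (outer≢X q k∈X))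

  module _ {X Y : Subset (size G)} (pair : SmoothPair G X Y) where
    open SmoothPair pair
    open Sides pair

    mixed-Y : ∀ {K w} → MaximalClique G K → w ∈ K → Outer w → ∀ {k} → k ∈ K → k ∈ Y → ∀ {q} → q ∈ Y → q ∈ K
    mixed-Y mc w∈K ow = Sides.mixed-X (flip-pair pair) mc w∈K (swap ow)

    -- Strength is split according to whether a clique leaves X ∪ Y. Cliques that do are met by
    -- passing to a restricted graph; the others concern the pair alone.
    OuterMet InnerMet : Subset (size G) → Set
    OuterMet S = ∀ K → MaximalClique G K → ∀ w → w ∈ K → Outer w → ∃[ v ] (v ∈ K × v ∈ S)
    InnerMet S = ∀ K → MaximalClique G K → (∀ w → w ∈ K → ¬ Outer w) → ∃[ v ] (v ∈ K × v ∈ S)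

    not-strong : ∀ {S} → Stable G S → Z ⊆ S → OuterMet S → InnerMet S → ⊥
    not-strong {S} st Z⊆S om im = none-strong S (st , meets) Z⊆S
      where
      meets : ∀ K → MaximalClique G K → ∃[ v ] (v ∈ K × v ∈ S)
      meets K mc with any? (λ w → (w ∈? K) ×-dec outer? w)
      ... | yes (w , w∈K , ow) = om K mc w w∈K ow
      ... | no none = im K mc (λ w w∈K ow → none (w , w∈K , ow))

    Bisimplicial′ : V G → V G → Set
    Bisimplicial′ p q = ∀ p' q' → p' ∈ X → q' ∈ Y → ¬ E G p' q → ¬ E G p q' → ¬ E G p' q'

    -- A clique that avoids both has a vertex missing `p`, necessarily in Y, and a vertex missing
    -- `q`, necessarily in X. Bisimpliciality makes these two nonadjacent.
    bisimplicial⇒inner : ∀ {S p q} → p ∈ X → q ∈ Y → p ∈ S → q ∈ S → Bisimplicial′ p q → InnerMet S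
    bisimplicial⇒inner {S} {p} {q} p∈X q∈Y p∈S q∈S bis K mc inside with p ∈? K | q ∈? K
    ... | yes m | _ = p , m , p∈S
    ... | no _ | yes m = q , m , q∈S
    ... | no p∉K | no q∉K with missed p p∉K | missed q q∉K
      where
      missed : ∀ w → w ∉ K → ∃[ u ] (u ∈ K × u ≢ w × ¬ E G u w)
      missed w w∉K with any? (λ u → (u ∈? K) ×-dec ¬? (u ≟ w) ×-dec ¬? (E? u w))
      ... | yes h = h
      ... | no none = ⊥-elim (w∉K (maximal-absorbs mc λ u u∈K ne → decidable-stable (E? u w) (λ ¬e → none (u , u∈K , ne , ¬e))))
    ...   | u , u∈K , u≢p , ¬up | v , v∈K , v≢q , ¬vq with position u | position v
    ...     | inX a | _ = ⊥-elim (¬up (X-clique u p a p∈X u≢p))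
    ...     | out a | _ = ⊥-elim (inside u u∈K a)
    ...     | inY a | inY b = ⊥-elim (¬vq (Y-clique v q b q∈Y v≢q))
    ...     | inY a | out b = ⊥-elim (inside v v∈K b)
    ...     | inY a | inX b = ⊥-elim (bis v u b a ¬vq (λ e → ¬up (E-sym e)) (proj₁ mc v u v∈K u∈K (≢-sides b a)))

    OuterOr? : {T : V G → Set} → Decidable T → Decidable (λ u → Outer u ⊎ T u)
    OuterOr? T? u = outer? u ⊎-dec T? u

    outerOr : {T : V G → Set} → Decidable T → Subset (size G)
    outerOr T? = subsetOf (OuterOr? T?)

    module Restriction {T : V G → Set} (T? : Decidable T) {p q : V G} (p∈X : p ∈ X) (q∈Y : q ∈ Y) (Tp : T p) (Tq : T q)
      (T-inner : ∀ {u} → T u → ¬ Outer u) where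

      W : Subset (size G)
      W = outerOr T?

      open Induced G W

      W⁺ : ∀ {u} → Outer u ⊎ T u → u ∈ W
      W⁺ = ∈-subsetOf⁺ (OuterOr? T?)

      W⁻ : ∀ {u} → u ∈ W → Outer u ⊎ T u
      W⁻ = ∈-subsetOf⁻ (OuterOr? T?)

      -- A maximal clique that leaves X ∪ Y stays maximal when it is cut down to W.
      outer-met : ∀ {S} → StrongWithin S → OuterMet S
      outer-met {S} (_ , _ , meets) K mc w w∈K ow with meets K∩W (K∩W⊆W , cl , (w , in⁺ w∈K (W⁺ (inj₁ ow))) , max)
        where
        in? : Decidable (λ u → u ∈ K × u ∈ W)
        in? u = (u ∈? K) ×-dec (u ∈? W)
        K∩W : Subset (size G)
        K∩W = subsetOf in?
        in⁺ : ∀ {u} → u ∈ K → u ∈ W → u ∈ K∩W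
        in⁺ a b = ∈-subsetOf⁺ in? (a , b)
        K∩W⊆W : K∩W ⊆ W
        K∩W⊆W m = proj₂ (∈-subsetOf⁻ in? m)
        cl : Clique G K∩W
        cl u v a b = proj₁ mc u v (proj₁ (∈-subsetOf⁻ in? a)) (proj₁ (∈-subsetOf⁻ in? b))
        max : ∀ u → u ∈ W → (∀ k → k ∈ K∩W → k ≢ u → E G k u) → u ∈ K∩W
        max u u∈W h = in⁺ (maximal-absorbs mc go) u∈W
          where
          go : ∀ k → k ∈ K → k ≢ u → E G k u
          go k k∈K ne with k ∈? W | position k
          ... | yes k∈W | _ = h k (in⁺ k∈K k∈W) ne
          ... | no k∉W | out o = ⊥-elim (k∉W (W⁺ (inj₁ o)))
          ... | no k∉W | inX a with position u
          ...   | inX b = X-clique k u a b ne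
          ...   | inY b = ⊥-elim (apart ow a b (proj₁ mc w k w∈K k∈K (outer≢X ow a))
                            (h w (in⁺ w∈K (W⁺ (inj₁ ow))) (outer≢Y ow b)))
          ...   | out b = E-sym (homog-X b p∈X a
                            (E-sym (h p (in⁺ (mixed-X mc w∈K ow k∈K a p∈X) (W⁺ (inj₂ Tp))) (λ e → outer≢X b p∈X (sym e)))))
          go k k∈K ne | no k∉W | inY a with position u
          ...   | inY b = Y-clique k u a b ne
          ...   | inX b = ⊥-elim (apart ow b a
                            (h w (in⁺ w∈K (W⁺ (inj₁ ow))) (outer≢X ow b)) (proj₁ mc w k w∈K k∈K (outer≢Y ow a)))
          ...   | out b = E-sym (homog-Y b q∈Y a
                            (E-sym (h q (in⁺ (mixed-Y mc w∈K ow k∈K a q∈Y) (W⁺ (inj₂ Tq))) (λ e → outer≢Y b q∈Y (sym e)))))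
      ... | v , v∈ , v∈S = v , proj₁ (∈-subsetOf⁻ (λ u → (u ∈? K) ×-dec (u ∈? W)) v∈) , v∈S

      -- No outer vertex sees both ends, by `apart`; with `isolated` this makes the edge a maximal
      -- clique of the restricted graph.
      edge-met : ∀ {S} → StrongWithin S → ∀ {u v} → u ∈ X → v ∈ Y → T u → T v → E G u v →
        (∀ w → T w → w ≢ u → w ≢ v → E G w u → ¬ E G w v) → u ∈ S ⊎ v ∈ S
      edge-met (_ , _ , meets) {u} {v} u∈X v∈Y Tu Tv e isolated with meets K (K⊆W , cl , (u , K⁺ (inj₁ refl)) , max)
        where
        K? : Decidable (λ w → w ≡ u ⊎ w ≡ v)
        K? w = (w ≟ u) ⊎-dec (w ≟ v)
        K : Subset (size G)
        K = subsetOf K?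
        K⁺ : ∀ {w} → w ≡ u ⊎ w ≡ v → w ∈ K
        K⁺ = ∈-subsetOf⁺ K?
        K⊆W : K ⊆ W
        K⊆W m with ∈-subsetOf⁻ K? m
        ... | inj₁ refl = W⁺ (inj₂ Tu)
        ... | inj₂ refl = W⁺ (inj₂ Tv)
        cl : Clique G K
        cl a b a∈ b∈ ne with ∈-subsetOf⁻ K? a∈ | ∈-subsetOf⁻ K? b∈
        ... | inj₁ refl | inj₁ refl = ⊥-elim (ne refl)
        ... | inj₁ refl | inj₂ refl = e
        ... | inj₂ refl | inj₁ refl = E-sym e
        ... | inj₂ refl | inj₂ refl = ⊥-elim (ne refl)
        max : ∀ w → w ∈ W → (∀ k → k ∈ K → k ≢ w → E G k w) → w ∈ K
        max w w∈W h with w ≟ u | w ≟ v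
        ... | yes a | _ = K⁺ (inj₁ a)
        ... | no _ | yes b = K⁺ (inj₂ b)
        ... | no a | no b = ⊥-elim (case W⁻ w∈W of λ
          { (inj₁ o) → apart o u∈X v∈Y wu wv ; (inj₂ Tw) → isolated w Tw a b wu wv })
          where
          wu : E G w u
          wu = E-sym (h u (K⁺ (inj₁ refl)) (λ p → a (sym p)))
          wv : E G w v
          wv = E-sym (h v (K⁺ (inj₂ refl)) (λ p → b (sym p)))
      ... | k , k∈K , k∈S with ∈-subsetOf⁻ (λ w → (w ≟ u) ⊎-dec (w ≟ v)) k∈K
      ...   | inj₁ refl = inj₁ k∈S
      ...   | inj₂ refl = inj₂ k∈S

      Z⊆W : (∀ z → z ∈ Z → ¬ Outer z → T z) → Z ⊆ W
      Z⊆W h {z} z∈Z with outer? z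
      ... | yes o = W⁺ (inj₁ o)
      ... | no ¬o = W⁺ (inj₂ (h z z∈Z ¬o))

      v∉W : ∀ {v} → ¬ Outer v → ¬ T v → v ∉ W
      v∉W ¬o ¬t m = [ ¬o , ¬t ]′ (W⁻ m)

    X-inner : ∀ {u} → u ∈ X → ¬ Outer u
    X-inner p (q , _) = q p

    Y-inner : ∀ {u} → u ∈ Y → ¬ Outer u
    Y-inner p (_ , q) = q p

    -- Only `p` and `q` are kept from X ∪ Y. Then the edge p q is a maximal clique, so a strong set
    -- contains `p` or `q`, and in `G` each of these lies in every maximal clique inside X ∪ Y.
    -- Hence nothing can have been removed.
    full⇒trivial : ∀ {p q} → p ∈ X → q ∈ Y → (∀ v → v ∈ Y → E G p v) → (∀ u → u ∈ X → E G u q) →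
      (∀ z → z ∈ Z → ¬ Outer z → z ≡ p ⊎ z ≡ q) → ¬ ¬ Trivial G X Y
    full⇒trivial {p} {q} p∈X q∈Y full-p full-q Z-inner ¬triv
      with any? (λ v → ((v ∈? X) ⊎-dec (v ∈? Y)) ×-dec ¬? (v ≟ p) ×-dec ¬? (v ≟ q))
    ... | no none = ¬triv ((λ u v a b → trans (only-p u a) (sym (only-p v b))) ,
        λ u v a b → trans (only-q u a) (sym (only-q v b)))
      where
      only-p : ∀ u → u ∈ X → u ≡ p
      only-p u a = decidable-stable (u ≟ p) (λ ne → none (u , inj₁ a , ne , ≢-sides a q∈Y))
      only-q : ∀ u → u ∈ Y → u ≡ q
      only-q u a = decidable-stable (u ≟ q) (λ ne → none (u , inj₂ a , (λ e → ≢-sides p∈X a (sym e)) , ne))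
    ... | yes (v , v-inner , v≢p , v≢q) = Induced.strong-within G W suspect
        (v∉W (λ o → [ (λ a → X-inner a o) , (λ a → Y-inner a o) ]′ v-inner) [ v≢p , v≢q ]′)
        λ { (S , sw , Z∩W⊆S) → not-strong (proj₁ (proj₂ sw)) (λ z∈Z → Z∩W⊆S z∈Z (Z⊆W Z-inner z∈Z)) (outer-met sw)
              (inner S (edge-met sw p∈X q∈Y (inj₁ refl) (inj₂ refl)
               (full-p q q∈Y) (λ { w (inj₁ refl) ne _ _ _ → ne refl ; w (inj₂ refl) _ ne _ _ → ne refl }))) }
      where
      T? : Decidable (λ u → u ≡ p ⊎ u ≡ q)
      T? u = (u ≟ p) ⊎-dec (u ≟ q)
      T-inner : ∀ {u} → u ≡ p ⊎ u ≡ q → ¬ Outer u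
      T-inner (inj₁ refl) = X-inner p∈X
      T-inner (inj₂ refl) = Y-inner q∈Y
      open Restriction T? p∈X q∈Y (inj₁ refl) (inj₂ refl) T-inner
      inner : ∀ S → p ∈ S ⊎ q ∈ S → InnerMet S
      inner S h K mc inside = [ (λ s → p , absorb-p , s) , (λ s → q , absorb-q , s) ]′ h
        where
        absorb-p : p ∈ K
        absorb-p = maximal-absorbs mc λ u u∈K ne → case position u of λ
          { (inX a) → X-clique u p a p∈X ne ; (inY a) → E-sym (full-p u a) ; (out o) → ⊥-elim (inside u u∈K o) }
        absorb-q : q ∈ K
        absorb-q = maximal-absorbs mc λ u u∈K ne → case position u of λ
          { (inX a) → full-q u a ; (inY a) → Y-clique u q a q∈Y ne ; (out o) → ⊥-elim (inside u u∈K o) }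

    -- Every maximal clique inside X ∪ Y meets a bisimplicial nonedge, so it can serve all of X ∪ Y.
    square-exact : ∀ {p₁ p₂ q₁ q₂} → Square G X Y p₁ p₂ q₁ q₂ → (∀ z → z ∈ Z → Outer z) → ¬ ¬ IsSquare G X Y
    square-exact {p₁} {p₂} {q₁} {q₂} sq Z-outer ¬exact
      with any? (λ v → ((v ∈? X) ⊎-dec (v ∈? Y)) ×-dec ¬? (T? v))
      where
      T? : Decidable (λ u → (u ≡ p₁ ⊎ u ≡ p₂) ⊎ (u ≡ q₁ ⊎ u ≡ q₂))
      T? u = ((u ≟ p₁) ⊎-dec (u ≟ p₂)) ⊎-dec ((u ≟ q₁) ⊎-dec (u ≟ q₂))
    ... | no none = ¬exact (p₁ , p₂ , q₁ , q₂ , sq , only-p , only-q)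
      where
      open Square sq
      only-p : ∀ u → u ∈ X → u ≡ p₁ ⊎ u ≡ p₂
      only-p u a = decidable-stable ((u ≟ p₁) ⊎-dec (u ≟ p₂)) (λ ¬h → none (u , inj₁ a ,
        [ ¬h , (λ { (inj₁ refl) → disjoint a q₁∈Y ; (inj₂ refl) → disjoint a q₂∈Y }) ]′))
      only-q : ∀ u → u ∈ Y → u ≡ q₁ ⊎ u ≡ q₂
      only-q u a = decidable-stable ((u ≟ q₁) ⊎-dec (u ≟ q₂)) (λ ¬h → none (u , inj₂ a ,
        [ (λ { (inj₁ refl) → disjoint p₁∈X a ; (inj₂ refl) → disjoint p₂∈X a }) , ¬h ]′))
    ... | yes (v , v-inner , ¬Tv) = bisimplicial-case (Cobipartite.bisimplicial-nonedge G X Y X-clique Y-clique disjoint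
            (proj₁ (proj₂ innocent)) p₁ q₂ p₁∈X q₂∈Y n₁)
      where
      open Square sq
      T : V G → Set
      T u = (u ≡ p₁ ⊎ u ≡ p₂) ⊎ (u ≡ q₁ ⊎ u ≡ q₂)
      T? : Decidable T
      T? u = ((u ≟ p₁) ⊎-dec (u ≟ p₂)) ⊎-dec ((u ≟ q₁) ⊎-dec (u ≟ q₂))
      T-inner : ∀ {u} → T u → ¬ Outer u
      T-inner (inj₁ (inj₁ refl)) = X-inner p₁∈X
      T-inner (inj₁ (inj₂ refl)) = X-inner p₂∈X
      T-inner (inj₂ (inj₁ refl)) = Y-inner q₁∈Y
      T-inner (inj₂ (inj₂ refl)) = Y-inner q₂∈Y
      open Restriction T? p₁∈X q₁∈Y (inj₁ (inj₁ refl)) (inj₂ (inj₁ refl)) T-inner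
      p₁≢p₂ : p₁ ≢ p₂
      p₁≢p₂ refl = n₂ e₁
      q₁≢q₂ : q₁ ≢ q₂
      q₁≢q₂ refl = n₁ e₁
      bisimplicial-case : ∃[ p ] ∃[ q ] (p ∈ X × q ∈ Y × ¬ E G p q × Bisimplicial′ p q) → ⊥
      bisimplicial-case (p , q , p∈X , q∈Y , ¬pq , bis) = Induced.strong-within G W suspect
          (v∉W (λ o → [ (λ a → X-inner a o) , (λ a → Y-inner a o) ]′ v-inner) ¬Tv)
          λ { (S , sw , Z∩W⊆S) → replace S sw (λ z∈Z → Z∩W⊆S z∈Z (W⁺ (inj₁ (Z-outer _ z∈Z)))) (represent S sw) }
        where
        -- The edges p₁ q₁ and p₂ q₂ are maximal cliques of the restricted graph, and stability
        -- allows at most one vertex from each side.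
        represent : ∀ S → Induced.StrongWithin G W S → ∃[ a ] ∃[ b ] (a ∈ X × b ∈ Y × a ∈ S × b ∈ S)
        represent S sw with edge-met sw p₁∈X q₁∈Y (inj₁ (inj₁ refl)) (inj₂ (inj₁ refl)) e₁
              (λ { w (inj₁ (inj₁ refl)) ne _ _ _ → ne refl ; w (inj₁ (inj₂ refl)) _ _ _ e → n₂ e
                 ; w (inj₂ (inj₁ refl)) _ ne _ _ → ne refl ; w (inj₂ (inj₂ refl)) _ _ e _ → n₁ (E-sym e) })
            | edge-met sw p₂∈X q₂∈Y (inj₁ (inj₂ refl)) (inj₂ (inj₂ refl)) e₂
              (λ { w (inj₁ (inj₁ refl)) _ _ _ e → n₁ e ; w (inj₁ (inj₂ refl)) ne _ _ _ → ne refl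
                 ; w (inj₂ (inj₁ refl)) _ _ e _ → n₂ (E-sym e) ; w (inj₂ (inj₂ refl)) _ ne _ _ → ne refl })
        ... | inj₁ a | inj₁ b = ⊥-elim (proj₁ (proj₂ sw) _ _ a b (X-clique _ _ p₁∈X p₂∈X p₁≢p₂))
        ... | inj₁ a | inj₂ b = p₁ , q₂ , p₁∈X , q₂∈Y , a , b
        ... | inj₂ a | inj₁ b = p₂ , q₁ , p₂∈X , q₁∈Y , b , a
        ... | inj₂ a | inj₂ b = ⊥-elim (proj₁ (proj₂ sw) _ _ a b (Y-clique _ _ q₁∈Y q₂∈Y q₁≢q₂))
        -- The outer part of `S` misses a in X and b in Y, hence by homogeneity it also misses `p`
        -- and `q`, which take their places.
        replace : ∀ S → Induced.StrongWithin G W S → Z ⊆ S → ∃[ a ] ∃[ b ] (a ∈ X × b ∈ Y × a ∈ S × b ∈ S) → ⊥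
        replace S sw Z⊆S (a , b , a∈X , b∈Y , a∈S , b∈S) =
          not-strong stable Z⊆S' met (bisimplicial⇒inner p∈X q∈Y (S'⁺ (inj₂ (inj₁ refl))) (S'⁺ (inj₂ (inj₂ refl))) bis)
          where
          S'? : Decidable (λ u → (u ∈ S × Outer u) ⊎ (u ≡ p ⊎ u ≡ q))
          S'? u = ((u ∈? S) ×-dec outer? u) ⊎-dec ((u ≟ p) ⊎-dec (u ≟ q))
          S' : Subset (size G)
          S' = subsetOf S'?
          S'⁺ : ∀ {u} → (u ∈ S × Outer u) ⊎ (u ≡ p ⊎ u ≡ q) → u ∈ S'
          S'⁺ = ∈-subsetOf⁺ S'?
          S-stable : Stable G S
          S-stable = proj₁ (proj₂ sw)
          far-p : ∀ {u} → u ∈ S → Outer u → ¬ E G u p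
          far-p u∈S o e = S-stable _ a u∈S a∈S (homog-X o p∈X a∈X e)
          far-q : ∀ {u} → u ∈ S → Outer u → ¬ E G u q
          far-q u∈S o e = S-stable _ b u∈S b∈S (homog-Y o q∈Y b∈Y e)
          stable : Stable G S'
          stable u w u∈ w∈ e with ∈-subsetOf⁻ S'? u∈ | ∈-subsetOf⁻ S'? w∈
          ... | inj₁ (s , o) | inj₁ (s' , _) = S-stable u w s s' e
          ... | inj₁ (s , o) | inj₂ (inj₁ refl) = far-p s o e
          ... | inj₁ (s , o) | inj₂ (inj₂ refl) = far-q s o e
          ... | inj₂ (inj₁ refl) | inj₁ (s , o) = far-p s o (E-sym e)
          ... | inj₂ (inj₂ refl) | inj₁ (s , o) = far-q s o (E-sym e)
          ... | inj₂ (inj₁ refl) | inj₂ (inj₁ refl) = E-irrefl e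
          ... | inj₂ (inj₁ refl) | inj₂ (inj₂ refl) = ¬pq e
          ... | inj₂ (inj₂ refl) | inj₂ (inj₁ refl) = ¬pq (E-sym e)
          ... | inj₂ (inj₂ refl) | inj₂ (inj₂ refl) = E-irrefl e
          Z⊆S' : Z ⊆ S'
          Z⊆S' z∈Z = S'⁺ (inj₁ (Z⊆S z∈Z , Z-outer _ z∈Z))
          met : OuterMet S'
          met K mc w w∈K ow with outer-met sw K mc w w∈K ow
          ... | u , u∈K , u∈S with position u
          ...   | out o = u , u∈K , S'⁺ (inj₁ (u∈S , o))
          ...   | inX m = p , mixed-X mc w∈K ow u∈K m p∈X , S'⁺ (inj₂ (inj₁ refl))
          ...   | inY m = q , mixed-Y mc w∈K ow u∈K m q∈Y , S'⁺ (inj₂ (inj₂ refl))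

    -- A simplicial vertex of X would be the hat of a clown on the square.
    square⇒Z∩X=∅ : ∀ {p₁ p₂ q₁ q₂} → Square G X Y p₁ p₂ q₁ q₂ → ∀ z → z ∈ Z → z ∉ X
    square⇒Z∩X=∅ {p₁} {p₂} {q₁} {q₂} sq z z∈Z z∈X
      with clown₄ (X-clique _ _ p₁∈X p₂∈X p₁≢p₂) e₂ (Y-clique _ _ q₂∈Y q₁∈Y (λ e → q₁≢q₂ (sym e))) (E-sym e₁) n₁ n₂
             (X-clique _ _ z∈X p₁∈X z≢p₁) (X-clique _ _ z∈X p₂∈X z≢p₂) ¬zq₂ ¬zq₁ (≢-sides p₁∈X q₂∈Y) (≢-sides p₂∈X q₁∈Y)
             (≢-sides z∈X q₂∈Y) (≢-sides z∈X q₁∈Y)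
      where
      open Square sq
      p₁≢p₂ : p₁ ≢ p₂
      p₁≢p₂ refl = n₂ e₁
      q₁≢q₂ : q₁ ≢ q₂
      q₁≢q₂ refl = n₁ e₁
      simp : Simplicial G z
      simp = proj₁ (all-safe z z∈Z)
      ¬zq₁ : ¬ E G z q₁
      ¬zq₁ e with z ≟ p₂
      ... | yes refl = n₂ e
      ... | no ne = n₂ (simp p₂ q₁ (X-clique z p₂ z∈X p₂∈X ne) e (≢-sides p₂∈X q₁∈Y))
      ¬zq₂ : ¬ E G z q₂
      ¬zq₂ e with z ≟ p₁
      ... | yes refl = n₁ e
      ... | no ne = n₁ (simp p₁ q₂ (X-clique z p₁ z∈X p₁∈X ne) e (≢-sides p₁∈X q₂∈Y))
      z≢p₁ : z ≢ p₁
      z≢p₁ refl = ¬zq₁ e₁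
      z≢p₂ : z ≢ p₂
      z≢p₂ refl = ¬zq₂ e₂
    -- The hat is `z` itself, at even distance 0.
    ... | D , refl = proj₂ (all-safe z z∈Z) D (point z) (inj₁ (refl , refl)) (λ _ ne → ⊥-elim (ne refl)) (2 ∣0)

    -- If every strong set of the restricted graph containing `Z` must contain `p` and `q`, these
    -- already meet all cliques inside X ∪ Y, so that set would be strong in `G`.
    pair-case : ∀ {T : V G → Set} (T? : Decidable T) {p q v} → p ∈ X → q ∈ Y → T p → T q → (∀ {u} → T u → ¬ Outer u) →
      ¬ Outer v → ¬ T v → (∀ z → z ∈ Z → ¬ Outer z → T z) → Bisimplicial′ p q →
      (∀ S → Induced.StrongWithin G (outerOr T?) S → Z ⊆ S → p ∈ S × q ∈ S) → ⊥
    pair-case T? p∈X q∈Y Tp Tq T-inner v-inner ¬Tv Z-inner bis both = Induced.strong-within G W suspect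
        (v∉W v-inner ¬Tv)
        λ { (S , sw , Z∩W⊆S) → finish S sw (λ z∈Z → Z∩W⊆S z∈Z (Z⊆W Z-inner z∈Z)) }
      where
      open Restriction T? p∈X q∈Y Tp Tq T-inner
      finish : ∀ S → Induced.StrongWithin G W S → Z ⊆ S → ⊥
      finish S sw Z⊆S = not-strong (proj₁ (proj₂ sw)) Z⊆S (outer-met sw)
        (bisimplicial⇒inner p∈X q∈Y (proj₁ (both S sw Z⊆S)) (proj₂ (both S sw Z⊆S)) bis)

    Nested : Set
    Nested = ∀ u u' v v' → u ∈ X → u' ∈ X → v ∈ Y → v' ∈ Y → E G u v → E G u' v' → E G u v' ⊎ E G u' v

    largest : Nested → {C : V G → Set} → Decidable C → ∃[ v ] (v ∈ Y × C v) →
      ∃[ q ] ((q ∈ Y × C q) × (∀ v → v ∈ Y × C v → ∀ u → u ∈ X → E G u v → E G u q))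
    largest nested C? = maximum {_≲_ = λ v q → ∀ u → u ∈ X → E G u v → E G u q} (λ v → (v ∈? Y) ×-dec C? v)
      (λ f g u a e → g u a (f u a e)) total
      where
      total : ∀ v q → _ → _ → _ ⊎ _
      total v q (v∈Y , _) (q∈Y , _) with any? (λ u → (u ∈? X) ×-dec E? u v ×-dec ¬? (E? u q))
      ... | no none = inj₁ λ u a e → decidable-stable (E? u q) (λ ¬e → none (u , a , e , ¬e))
      ... | yes (u , u∈X , e , ¬e) = inj₂ λ u' u'∈X e' → case nested u u' v q u∈X u'∈X v∈Y q∈Y e e' of λ
            { (inj₁ h) → ⊥-elim (¬e h) ; (inj₂ h) → h }

    -- By smoothness each vertex of X has some neighbour in Y, and the largest neighbourhood
    -- contains that vertex too.
    largest-full : Nested → ∃ (_∈ Y) → ∃[ q ] (q ∈ Y × (∀ u → u ∈ X → E G u q))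
    largest-full nested (v , v∈Y) with largest nested {λ _ → ⊤} (λ _ → yes tt) (v , v∈Y , tt)
    ... | q , (q∈Y , _) , max = q , q∈Y , λ u u∈X → let (v' , v'∈Y , e) = smooth-X u∈X in max v' (v'∈Y , tt) u u∈X e

    -- If `z` sees all of Y, its neighbours in Y see all of X because `z` is simplicial. Otherwise
    -- `z` is completed to a bisimplicial nonedge, by a member of `Z` in Y if there is one, and else
    -- by the nonneighbour with the largest neighbourhood.
    Z-in-X : Nested → ∀ z → z ∈ Z → z ∈ X → ¬ ¬ Trivial G X Y
    Z-in-X nested z z∈Z z∈X ¬triv with any? (λ v → (v ∈? Y) ×-dec ¬? (E? z v))
    ... | no none = full⇒trivial z∈X q∈Y full-z full-q Z-inner ¬triv
      where
      full-z : ∀ v → v ∈ Y → E G z v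
      full-z v v∈Y = decidable-stable (E? z v) (λ ¬e → none (v , v∈Y , ¬e))
      q : V G
      q = proj₁ (smooth-X z∈X)
      q∈Y : q ∈ Y
      q∈Y = proj₁ (proj₂ (smooth-X z∈X))
      full-q : ∀ u → u ∈ X → E G u q
      full-q u u∈X with z ≟ u
      ... | yes refl = full-z q q∈Y
      ... | no ne = proj₁ (all-safe z z∈Z) u q (X-clique z u z∈X u∈X ne) (full-z q q∈Y) (≢-sides u∈X q∈Y)
      Z-inner : ∀ z' → z' ∈ Z → ¬ Outer z' → z' ≡ z ⊎ z' ≡ q
      Z-inner z' z'∈Z ¬o with position z'
      ... | out o = ⊥-elim (¬o o)
      ... | inX a = inj₁ (decidable-stable (z' ≟ z) (λ ne → Z-stable z' z z'∈Z z∈Z (X-clique z' z a z∈X ne)))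
      ... | inY a = ⊥-elim (Z-stable z z' z∈Z z'∈Z (full-z z' a))
    ... | yes (q₀ , q₀∈Y , ¬zq₀) with any? (λ v → (v ∈? Y) ×-dec (v ∈? Z))
    ...   | yes (z' , z'∈Y , z'∈Z) = pair-case (λ u → (u ≟ z) ⊎-dec (u ≟ z')) z∈X z'∈Y (inj₁ refl) (inj₂ refl)
              (λ { (inj₁ refl) → X-inner z∈X ; (inj₂ refl) → Y-inner z'∈Y })
              -- A neighbour of `z` in Y exists by smoothness and is among the deleted vertices, so
              -- the restricted graph is smaller.
              (Y-inner nb∈Y) [ (λ e → disjoint z∈X (subst (_∈ Y) e nb∈Y)) , (λ e → ¬zz' (subst (E G z) e z-nb)) ]′
              Z-inner bis (λ S sw Z⊆S → Z⊆S z∈Z , Z⊆S z'∈Z)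
      where
      nb : V G
      nb = proj₁ (smooth-X z∈X)
      nb∈Y : nb ∈ Y
      nb∈Y = proj₁ (proj₂ (smooth-X z∈X))
      z-nb : E G z nb
      z-nb = proj₂ (proj₂ (smooth-X z∈X))
      ¬zz' : ¬ E G z z'
      ¬zz' = Z-stable z z' z∈Z z'∈Z
      Z-inner : ∀ u → u ∈ Z → ¬ Outer u → u ≡ z ⊎ u ≡ z'
      Z-inner u u∈Z ¬o with position u
      ... | out o = ⊥-elim (¬o o)
      ... | inX a = inj₁ (decidable-stable (u ≟ z) (λ ne → Z-stable u z u∈Z z∈Z (X-clique u z a z∈X ne)))
      ... | inY a = inj₂ (decidable-stable (u ≟ z') (λ ne → Z-stable u z' u∈Z z'∈Z (Y-clique u z' a z'∈Y ne)))
      bis : Bisimplicial′ z z'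
      -- A failure of bisimpliciality is an induced path z - p - q - z' of odd length 3 between
      -- members of `Z`.
      bis p q p∈X q∈Y ¬pz' ¬zq pq with path₄ (X-clique z p z∈X p∈X (λ { refl → ¬zq pq })) pq
            (Y-clique q z' q∈Y z'∈Y (λ { refl → ¬pz' pq })) ¬zq ¬pz' ¬zz'
            (≢-sides z∈X q∈Y) (≢-sides p∈X z'∈Y) (≢-sides z∈X z'∈Y)
      ... | π , first≡ , last≡ , len≡ = odd⇒¬even 2 ∣-refl
              (subst Even len≡ (consistent z z' z∈Z z'∈Z (≢-sides z∈X z'∈Y) π (inj₁ (first≡ , last≡))))
    ...   | no none with largest nested (λ v → ¬? (E? z v)) (q₀ , q₀∈Y , ¬zq₀)
    ...     | q , (q∈Y , ¬zq) , max =
      pair-case (λ u → (u ≟ z) ⊎-dec ((u ≟ p) ⊎-dec (u ≟ q))) z∈X q∈Y (inj₁ refl) (inj₂ (inj₂ refl))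
        T-inner (Y-inner nb∈Y)
        [ (λ e → disjoint z∈X (subst (_∈ Y) e nb∈Y)) , [ (λ e → disjoint p∈X (subst (_∈ Y) e nb∈Y)) ,
          (λ e → ¬zq (subst (E G z) e z-nb)) ]′ ]′
              Z-inner bis both
      where
      nb : V G
      nb = proj₁ (smooth-X z∈X)
      nb∈Y : nb ∈ Y
      nb∈Y = proj₁ (proj₂ (smooth-X z∈X))
      z-nb : E G z nb
      z-nb = proj₂ (proj₂ (smooth-X z∈X))
      p : V G
      p = proj₁ (smooth-Y q∈Y)
      p∈X : p ∈ X
      p∈X = proj₁ (proj₂ (smooth-Y q∈Y))
      pq : E G p q
      pq = E-sym (proj₂ (proj₂ (smooth-Y q∈Y)))
      T-inner : ∀ {u} → u ≡ z ⊎ u ≡ p ⊎ u ≡ q → ¬ Outer u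
      T-inner (inj₁ refl) = X-inner z∈X
      T-inner (inj₂ (inj₁ refl)) = X-inner p∈X
      T-inner (inj₂ (inj₂ refl)) = Y-inner q∈Y
      Z-inner : ∀ u → u ∈ Z → ¬ Outer u → u ≡ z ⊎ u ≡ p ⊎ u ≡ q
      Z-inner u u∈Z ¬o with position u
      ... | out o = ⊥-elim (¬o o)
      ... | inX a = inj₁ (decidable-stable (u ≟ z) (λ ne → Z-stable u z u∈Z z∈Z (X-clique u z a z∈X ne)))
      ... | inY a = ⊥-elim (none (u , a , u∈Z))
      bis : Bisimplicial′ z q
      bis p' q' p'∈X q'∈Y ¬p'q ¬zq' e = ¬p'q (max q' (q'∈Y , ¬zq') p' p'∈X e)
      -- The vertex `p` is kept so that the edge p q must be met; since `p` is adjacent to `z`, only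
      -- `q` can meet it.
      both : ∀ S → Induced.StrongWithin G _ S → Z ⊆ S → z ∈ S × q ∈ S
      both S sw Z⊆S
        with Restriction.edge-met (λ u → (u ≟ z) ⊎-dec ((u ≟ p) ⊎-dec (u ≟ q))) z∈X q∈Y (inj₁ refl) (inj₂ (inj₂ refl)) T-inner
             sw p∈X q∈Y (inj₂ (inj₁ refl)) (inj₂ (inj₂ refl)) pq
             (λ { w (inj₁ refl) _ _ _ e → ¬zq e ; w (inj₂ (inj₁ refl)) ne _ _ _ → ne refl
                ; w (inj₂ (inj₂ refl)) _ ne _ _ → ne refl })
      ... | inj₂ q∈S = Z⊆S z∈Z , q∈S
      ... | inj₁ p∈S = ⊥-elim (proj₁ (proj₂ sw) z p (Z⊆S z∈Z) p∈S (X-clique z p z∈X p∈X (λ { refl → ¬zq pq })))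

  flip-nested : ∀ {X Y} (pair : SmoothPair G X Y) → Nested pair → Nested (flip-pair pair)
  flip-nested pair nested u u' v v' a b c d e e' with nested v v' u u' c d a b (E-sym e) (E-sym e')
  ... | inj₁ h = inj₂ (E-sym h)
  ... | inj₂ h = inj₁ (E-sym h)

  square? : ∀ X Y → Dec (∃[ p₁ ] ∃[ p₂ ] ∃[ q₁ ] ∃[ q₂ ] Square G X Y p₁ p₂ q₁ q₂)
  square? X Y = any? λ p₁ → any? λ p₂ → any? λ q₁ → any? λ q₂ → map′
    (λ { (a , b , c , d , e , f , g , h) → record
         { p₁∈X = a ; p₂∈X = b ; q₁∈Y = c ; q₂∈Y = d ; e₁ = e ; e₂ = f ; n₁ = g ; n₂ = h } })
    (λ s → let open Square s in p₁∈X , p₂∈X , q₁∈Y , q₂∈Y , e₁ , e₂ , n₁ , n₂)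
    ((p₁ ∈? X) ×-dec (p₂ ∈? X) ×-dec (q₁ ∈? Y) ×-dec (q₂ ∈? Y)
      ×-dec E? p₁ q₁ ×-dec E? p₂ q₂ ×-dec ¬? (E? p₁ q₂) ×-dec ¬? (E? p₂ q₁))

  squareless⇒nested : ∀ {X Y} (pair : SmoothPair G X Y) →
    ¬ (∃[ p₁ ] ∃[ p₂ ] ∃[ q₁ ] ∃[ q₂ ] Square G X Y p₁ p₂ q₁ q₂) → Nested pair
  squareless⇒nested pair none u u' v v' a b c d e e' with E? u v' | E? u' v
  ... | yes h | _ = inj₁ h
  ... | no _ | yes h = inj₂ h
  ... | no h | no h' = ⊥-elim (none (u , u' , v , v' , record
        { p₁∈X = a ; p₂∈X = b ; q₁∈Y = c ; q₂∈Y = d ; e₁ = e ; e₂ = e' ; n₁ = h ; n₂ = h' }))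

  -- With a square, no member of `Z` is in X ∪ Y. Without one, the neighbourhoods are nested; if `Z`
  -- avoids the pair, the largest ones on both sides give the two vertices to keep.
  gadget : ∀ {X Y} → SmoothPair G X Y → ∃ (_∈ X) → ¬ ¬ (Trivial G X Y ⊎ IsSquare G X Y)
  gadget {X} {Y} pair (x₀ , x₀∈X) ¬concl with square? X Y
  ... | yes (_ , _ , _ , _ , sq) = square-exact pair sq
    (λ z z∈Z → square⇒Z∩X=∅ pair sq z z∈Z , square⇒Z∩X=∅ (flip-pair pair) (flip-square sq) z z∈Z) (λ s → ¬concl (inj₂ s))
  ... | no none = cases (any? (λ z → (z ∈? Z) ×-dec (z ∈? X))) (any? (λ z → (z ∈? Z) ×-dec (z ∈? Y)))
    where
    nested : Nested pair
    nested = squareless⇒nested pair none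
    cases : Dec (∃[ z ] (z ∈ Z × z ∈ X)) → Dec (∃[ z ] (z ∈ Z × z ∈ Y)) → ⊥
    cases (yes (z , z∈Z , z∈X)) _ = Z-in-X pair nested z z∈Z z∈X (λ t → ¬concl (inj₁ t))
    cases (no _) (yes (z , z∈Z , z∈Y)) =
      Z-in-X (flip-pair pair) (flip-nested pair nested) z z∈Z z∈Y (λ t → ¬concl (inj₁ (swap t)))
    cases (no noX) (no noY) with SmoothPair.smooth-X pair x₀∈X
    ... | nb₀ , nb₀∈Y , _
      with largest-full pair nested (nb₀ , nb₀∈Y)
         | largest-full (flip-pair pair) (flip-nested pair nested) (x₀ , x₀∈X)
    ...   | q , q∈Y , full-q | p , p∈X , full-p =
      full⇒trivial pair p∈X q∈Y (λ v v∈Y → E-sym (full-p v v∈Y)) full-q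
        (λ z z∈Z ¬o → ⊥-elim (¬o ((λ m → noX (z , z∈Z , m)) , λ m → noY (z , z∈Z , m)))) (λ t → ¬concl (inj₁ t))

  FalseTwins : V G → V G → Set
  FalseTwins u v = u ≢ v × ¬ E G u v × (∀ w → (E G u w → E G v w) × (E G v w → E G u w))

  private
    -- A strong set of the graph without `v` is extended by `v` exactly when it contains `u`; a
    -- clique through `v` is met because `u` could take the place of `v`.
    delete-twin : ∀ {u v} → FalseTwins u v → (v ∈ Z → u ∈ Z) → ⊥
    delete-twin {u} {v} (u≢v , ¬uv , twins) Z-closed = Induced.strong-within G W suspect
        (λ m → ∈-subsetOf⁻ other? m refl)
        λ { (S , sw , Z∩W⊆S) → extend S sw Z∩W⊆S }
      where
      other? : Decidable (λ w → w ≢ v)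
      other? w = ¬? (w ≟ v)
      W : Subset (size G)
      W = subsetOf other?
      W⁺ : ∀ {w} → w ≢ v → w ∈ W
      W⁺ = ∈-subsetOf⁺ other?
      extend : ∀ S → Induced.StrongWithin G W S → (∀ {z} → z ∈ Z → z ∈ W → z ∈ S) → ⊥
      extend S (S⊆W , S-stable , meets) Z∩W⊆S = none-strong S' (stable , meets') Z⊆S'
        where
        S'? : Decidable (λ w → w ∈ S ⊎ (w ≡ v × u ∈ S))
        S'? w = (w ∈? S) ⊎-dec ((w ≟ v) ×-dec (u ∈? S))
        S' : Subset (size G)
        S' = subsetOf S'?
        S'⁺ : ∀ {w} → w ∈ S ⊎ (w ≡ v × u ∈ S) → w ∈ S'
        S'⁺ = ∈-subsetOf⁺ S'?
        stable : Stable G S'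
        stable a b a∈ b∈ e with ∈-subsetOf⁻ S'? a∈ | ∈-subsetOf⁻ S'? b∈
        ... | inj₁ p | inj₁ q = S-stable a b p q e
        ... | inj₁ p | inj₂ (refl , u∈S) = S-stable u a u∈S p (proj₂ (twins a) (E-sym e))
        ... | inj₂ (refl , u∈S) | inj₁ q = S-stable u b u∈S q (proj₂ (twins b) e)
        ... | inj₂ (refl , _) | inj₂ (refl , _) = E-irrefl e
        Z⊆S' : Z ⊆ S'
        Z⊆S' {z} z∈Z with z ≟ v
        ... | no ne = S'⁺ (inj₁ (Z∩W⊆S z∈Z (W⁺ ne)))
        ... | yes refl = S'⁺ (inj₂ (refl , Z∩W⊆S (Z-closed z∈Z) (W⁺ u≢v)))
        meets' : ∀ K → MaximalClique G K → ∃[ k ] (k ∈ K × k ∈ S')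
        meets' K mc@(cl , ne , _) with v ∈? K
        ... | no v∉K with meets K ((λ m → W⁺ (λ { refl → v∉K m })) , cl , ne , λ w _ h → maximal-absorbs mc h)
        ...   | k , k∈K , k∈S = k , k∈K , S'⁺ (inj₁ k∈S)
        meets' K mc@(cl , _ , _) | yes v∈K with meets K' (K'⊆W , cl' , (u , K'⁺ (inj₂ refl)) , max)
          where
          K'? : Decidable (λ w → (w ∈ K × w ≢ v) ⊎ w ≡ u)
          K'? w = ((w ∈? K) ×-dec ¬? (w ≟ v)) ⊎-dec (w ≟ u)
          K' : Subset (size G)
          K' = subsetOf K'?
          K'⁺ : ∀ {w} → (w ∈ K × w ≢ v) ⊎ w ≡ u → w ∈ K'
          K'⁺ = ∈-subsetOf⁺ K'?
          K'⊆W : K' ⊆ W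
          K'⊆W m with ∈-subsetOf⁻ K'? m
          ... | inj₁ (_ , ne) = W⁺ ne
          ... | inj₂ refl = W⁺ u≢v
          u-adj : ∀ {w} → w ∈ K → w ≢ v → E G u w
          u-adj {w} w∈K ne = proj₂ (twins w) (cl v w v∈K w∈K (λ e → ne (sym e)))
          cl' : Clique G K'
          cl' a b a∈ b∈ ne with ∈-subsetOf⁻ K'? a∈ | ∈-subsetOf⁻ K'? b∈
          ... | inj₁ (p , _) | inj₁ (q , _) = cl a b p q ne
          ... | inj₁ (p , a≢v) | inj₂ refl = E-sym (u-adj p a≢v)
          ... | inj₂ refl | inj₁ (q , b≢v) = u-adj q b≢v
          ... | inj₂ refl | inj₂ refl = ⊥-elim (ne refl)
          max : ∀ w → w ∈ W → (∀ k → k ∈ K' → k ≢ w → E G k w) → w ∈ K'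
          max w w∈W h with w ≟ u
          ... | yes e = K'⁺ (inj₂ e)
          ... | no w≢u = K'⁺ (inj₁ (maximal-absorbs mc go , ∈-subsetOf⁻ other? w∈W))
            where
            go : ∀ k → k ∈ K → k ≢ w → E G k w
            go k k∈K ne with k ≟ v
            ... | yes refl = proj₁ (twins w) (h u (K'⁺ (inj₂ refl)) (λ e → w≢u (sym e)))
            ... | no k≢v = h k (K'⁺ (inj₁ (k∈K , k≢v))) ne
        ...   | k , k∈K' , k∈S with ∈-subsetOf⁻ (λ w → ((w ∈? K) ×-dec ¬? (w ≟ v)) ⊎-dec (w ≟ u)) k∈K'
        ...     | inj₁ (k∈K , _) = k , k∈K , S'⁺ (inj₁ k∈S)
        ...     | inj₂ refl = v , v∈K , S'⁺ (inj₂ (refl , k∈S))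

  -- The twin to delete is chosen so that the remaining one is in `Z` whenever either of them is.
  no-false-twins : ∀ {u v} → ¬ FalseTwins u v
  no-false-twins {u} {v} ft@(u≢v , ¬uv , twins) with u ∈? Z
  ... | yes u∈Z = delete-twin ft (λ _ → u∈Z)
  ... | no u∉Z = delete-twin ((λ e → u≢v (sym e)) , (λ e → ¬uv (E-sym e)) , (λ w → swap (twins w))) (λ u∈Z → ⊥-elim (u∉Z u∈Z))

-- Labelling an augmentation

module BipartiteEnds (B : BipMultigraph) where

  lend rend : Fin (nE B) → Fin (nV B)
  lend e with side B (src B e)
  ... | true  = src B e
  ... | false = tgt B e
  rend e with side B (src B e)
  ... | true  = tgt B e
  ... | false = src B e

  EndsMeet : Fin (nE B) → Fin (nE B) → Set
  EndsMeet e f = src B e ≡ src B f ⊎ src B e ≡ tgt B f ⊎ tgt B e ≡ src B f ⊎ tgt B e ≡ tgt B f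

  other-side : ∀ e → side B (src B e) ≡ true → side B (tgt B e) ≡ false
  other-side e p with side B (tgt B e) in r
  ... | true = ⊥-elim (bipartite B e (trans p (sym r)))
  ... | false = refl

  lineAdj⇒ : ∀ {e f} → LineAdj B e f → e ≢ f × (lend e ≡ lend f ⊎ rend e ≡ rend f)
  lineAdj⇒ {e} {f} (ne , s) = ne , shared s
    where
    shared : EndsMeet e f → lend e ≡ lend f ⊎ rend e ≡ rend f
    shared s with side B (src B e) in p | side B (src B f) in q
    shared (inj₁ h) | true | true = inj₁ h
    shared (inj₁ h) | false | false = inj₂ h
    shared (inj₁ h) | true | false = case trans (sym p) (trans (cong (side B) h) q) of λ ()
    shared (inj₁ h) | false | true = case trans (sym p) (trans (cong (side B) h) q) of λ ()
    shared (inj₂ (inj₁ h)) | true | true = ⊥-elim (bipartite B f (trans q (trans (sym p) (cong (side B) h))))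
    shared (inj₂ (inj₁ h)) | true | false = inj₁ h
    shared (inj₂ (inj₁ h)) | false | true = inj₂ h
    shared (inj₂ (inj₁ h)) | false | false = ⊥-elim (bipartite B f (trans q (trans (sym p) (cong (side B) h))))
    shared (inj₂ (inj₂ (inj₁ h))) | true | true = ⊥-elim (bipartite B e (trans p (trans (sym q) (cong (side B) (sym h)))))
    shared (inj₂ (inj₂ (inj₁ h))) | true | false = inj₂ h
    shared (inj₂ (inj₂ (inj₁ h))) | false | true = inj₁ h
    shared (inj₂ (inj₂ (inj₁ h))) | false | false = ⊥-elim (bipartite B e (trans p (trans (sym q) (cong (side B) (sym h)))))
    shared (inj₂ (inj₂ (inj₂ h))) | true | true = inj₂ h
    shared (inj₂ (inj₂ (inj₂ h))) | false | false = inj₁ h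
    shared (inj₂ (inj₂ (inj₂ h))) | true | false =
      ⊥-elim (bipartite B f (trans q (trans (sym (other-side e p)) (cong (side B) h))))
    shared (inj₂ (inj₂ (inj₂ h))) | false | true =
      ⊥-elim (bipartite B e (trans p (trans (sym (other-side f q)) (cong (side B) (sym h)))))

  ⇒lineAdj : ∀ {e f} → e ≢ f → lend e ≡ lend f ⊎ rend e ≡ rend f → LineAdj B e f
  ⇒lineAdj {e} {f} ne s = ne , shared s
    where
    shared : lend e ≡ lend f ⊎ rend e ≡ rend f → EndsMeet e f
    shared s with side B (src B e) | side B (src B f)
    shared (inj₁ h) | true | true = inj₁ h
    shared (inj₁ h) | true | false = inj₂ (inj₁ h)
    shared (inj₁ h) | false | true = inj₂ (inj₂ (inj₁ h))
    shared (inj₁ h) | false | false = inj₂ (inj₂ (inj₂ h))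
    shared (inj₂ h) | true | true = inj₂ (inj₂ (inj₂ h))
    shared (inj₂ h) | true | false = inj₂ (inj₂ (inj₁ h))
    shared (inj₂ h) | false | true = inj₂ (inj₁ h)
    shared (inj₂ h) | false | false = inj₁ h

module Augmented {G : Graph} {Z : Subset (size G)} (suspect : Suspect G Z)
  (B : BipMultigraph) (A : SmoothAug B) (iso : Isomorphic G (AugV B A) (AugAdj B A)) where
  open BipartiteEnds B
  open Graphs G
  open SuspectPair suspect

  private
    f : V G → AugV B A
    f = proj₁ iso

    g : AugV B A → V G
    g = proj₁ (proj₂ iso)

    gf : ∀ v → g (f v) ≡ v
    gf = proj₁ (proj₂ (proj₂ iso))

    fg : ∀ w → f (g w) ≡ w
    fg = proj₁ (proj₂ (proj₂ (proj₂ iso)))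

    E⇔ : ∀ u v → (E G u v → AugAdj B A (f u) (f v)) × (AugAdj B A (f u) (f v) → E G u v)
    E⇔ = proj₂ (proj₂ (proj₂ (proj₂ iso)))

    f-inj : ∀ {u v} → f u ≡ f v → u ≡ v
    f-inj {u} {v} e = trans (sym (gf u)) (trans (cong g e) (gf v))

    O : V G → Fin (nE B)
    O v = origin B A (f v)

  Part : Fin (h A) → Set
  Part i = Fin (a A i) ⊎ Fin (b A i)

  within⇒ : ∀ i (s t : Part i) → AugAdj B A (inj₂ (i , s)) (inj₂ (i , t)) → CobipAdj (a A i) (b A i) (cross A i) s t
  within⇒ i s t e with i ≟ i
  ... | yes refl = e
  ... | no ne = ⊥-elim (ne refl)

  ⇒within : ∀ i (s t : Part i) → CobipAdj (a A i) (b A i) (cross A i) s t → AugAdj B A (inj₂ (i , s)) (inj₂ (i , t))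
  ⇒within i s t e with i ≟ i
  ... | yes refl = e
  ... | no ne = ⊥-elim (ne refl)

  -- Two vertices with no common (Xᵢ , Yᵢ); only for these is adjacency that of their origins in the
  -- line graph.
  Separate : AugV B A → AugV B A → Set
  Separate w w' = ∀ i s t → w ≡ inj₂ (i , s) → w' ≢ inj₂ (i , t)

  across⇒ : ∀ {w w'} → Separate w w' → AugAdj B A w w' → LineAdj B (origin B A w) (origin B A w')
  across⇒ {inj₁ _} {w'} sep e = e
  across⇒ {inj₂ _} {inj₁ _} sep e = e
  across⇒ {inj₂ (i , s)} {inj₂ (j , t)} sep e with i ≟ j
  ... | yes refl = ⊥-elim (sep i s t refl refl)
  ... | no _ = e

  ⇒across : ∀ {w w'} → Separate w w' → LineAdj B (origin B A w) (origin B A w') → AugAdj B A w w'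
  ⇒across {inj₁ _} {w'} sep e = e
  ⇒across {inj₂ _} {inj₁ _} sep e = e
  ⇒across {inj₂ (i , s)} {inj₂ (j , t)} sep e with i ≟ j
  ... | yes refl = ⊥-elim (sep i s t refl refl)
  ... | no _ = e

  inX? : ∀ i → Decidable (λ v → ∃[ p ] f v ≡ inj₂ (i , inj₁ p))
  inX? i v with f v
  ... | inj₁ _ = no λ ()
  ... | inj₂ (j , inj₂ _) = no λ ()
  ... | inj₂ (j , inj₁ p) with j ≟ i
  ...   | yes refl = yes (p , refl)
  ...   | no ne = no λ { (_ , refl) → ne refl }

  inY? : ∀ i → Decidable (λ v → ∃[ q ] f v ≡ inj₂ (i , inj₂ q))
  inY? i v with f v
  ... | inj₁ _ = no λ ()
  ... | inj₂ (j , inj₁ _) = no λ ()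
  ... | inj₂ (j , inj₂ q) with j ≟ i
  ...   | yes refl = yes (q , refl)
  ...   | no ne = no λ { (_ , refl) → ne refl }

  X Y : Fin (h A) → Subset (size G)
  X i = subsetOf (inX? i)
  Y i = subsetOf (inY? i)

  X⁻ : ∀ {i v} → v ∈ X i → ∃[ p ] f v ≡ inj₂ (i , inj₁ p)
  X⁻ {i} = ∈-subsetOf⁻ (inX? i)

  Y⁻ : ∀ {i v} → v ∈ Y i → ∃[ q ] f v ≡ inj₂ (i , inj₂ q)
  Y⁻ {i} = ∈-subsetOf⁻ (inY? i)

  X⁺ : ∀ {i v p} → f v ≡ inj₂ (i , inj₁ p) → v ∈ X i
  X⁺ {i} e = ∈-subsetOf⁺ (inX? i) (_ , e)

  Y⁺ : ∀ {i v q} → f v ≡ inj₂ (i , inj₂ q) → v ∈ Y i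
  Y⁺ {i} e = ∈-subsetOf⁺ (inY? i) (_ , e)

  E-within : ∀ {i u v s t} → f u ≡ inj₂ (i , s) → f v ≡ inj₂ (i , t) →
    (E G u v → CobipAdj (a A i) (b A i) (cross A i) s t) × (CobipAdj (a A i) (b A i) (cross A i) s t → E G u v)
  E-within {i} {u} {v} {s} {t} p q with E⇔ u v
  ... | to , from rewrite p | q = (λ e → within⇒ i s t (to e)) , λ c → from (⇒within i s t c)

  E-across : ∀ {u v} → Separate (f u) (f v) → (E G u v → LineAdj B (O u) (O v)) × (LineAdj B (O u) (O v) → E G u v)
  E-across {u} {v} sep = (λ e → across⇒ sep (proj₁ (E⇔ u v) e)) , λ e → proj₂ (E⇔ u v) (⇒across sep e)

  pair : ∀ i → SmoothPair G (X i) (Y i)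
  pair i = record
    { X-clique = X-clique ; Y-clique = Y-clique ; disjoint = disjoint ; smooth-X = smooth-X ; smooth-Y = smooth-Y
    ; homog-X = homog-X ; homog-Y = homog-Y ; apart = apart }
    where
    X-clique : Clique G (X i)
    X-clique u v u∈ v∈ ne with X⁻ u∈ | X⁻ v∈
    ... | p , e | q , e' = proj₂ (E-within e e') λ { refl → ne (f-inj (trans e (sym e'))) }
    Y-clique : Clique G (Y i)
    Y-clique u v u∈ v∈ ne with Y⁻ u∈ | Y⁻ v∈
    ... | p , e | q , e' = proj₂ (E-within e e') λ { refl → ne (f-inj (trans e (sym e'))) }
    disjoint : ∀ {v} → v ∈ X i → v ∉ Y i
    disjoint v∈X v∈Y with X⁻ v∈X | Y⁻ v∈Y
    ... | _ , e | _ , e' = case trans (sym e) e' of λ ()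
    smooth-X : ∀ {u} → u ∈ X i → ∃[ v ] (v ∈ Y i × E G u v)
    smooth-X u∈ with X⁻ u∈
    ... | p , e with smoothX A i p
    ...   | q , c = g (inj₂ (i , inj₂ q)) , Y⁺ (fg _) , proj₂ (E-within e (fg _)) c
    smooth-Y : ∀ {v} → v ∈ Y i → ∃[ u ] (u ∈ X i × E G v u)
    smooth-Y v∈ with Y⁻ v∈
    ... | q , e with smoothY A i q
    ...   | p , c = g (inj₂ (i , inj₁ p)) , X⁺ (fg _) , proj₂ (E-within e (fg _)) c
    separate : ∀ {w s} → w ∉ X i × w ∉ Y i → Separate (f w) (inj₂ (i , s))
    separate (w∉X , _) j (inj₁ p) t e refl = w∉X (X⁺ e)
    separate (_ , w∉Y) j (inj₂ q) t e refl = w∉Y (Y⁺ e)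
    to : ∀ {w v s} → w ∉ X i × w ∉ Y i → f v ≡ inj₂ (i , s) → E G w v → LineAdj B (O w) (origin B A (inj₂ (i , s)))
    to {w} {v} o e ee = subst (λ z → LineAdj B (O w) (origin B A z)) e
      (proj₁ (E-across {w} {v} (subst (Separate (f w)) (sym e) (separate o))) ee)
    from : ∀ {w v s} → w ∉ X i × w ∉ Y i → f v ≡ inj₂ (i , s) → LineAdj B (O w) (origin B A (inj₂ (i , s))) → E G w v
    from {w} {v} o e ee = proj₂ (E-across {w} {v} (subst (Separate (f w)) (sym e) (separate o)))
      (subst (λ z → LineAdj B (O w) (origin B A z)) (sym e) ee)
    homog-X : ∀ {w u u'} → w ∉ X i × w ∉ Y i → u ∈ X i → u' ∈ X i → E G w u → E G w u'
    homog-X o u∈ u'∈ e with X⁻ u∈ | X⁻ u'∈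
    ... | _ , c | _ , c' = from o c' (to o c e)
    homog-Y : ∀ {w u u'} → w ∉ X i × w ∉ Y i → u ∈ Y i → u' ∈ Y i → E G w u → E G w u'
    homog-Y o u∈ u'∈ e with Y⁻ u∈ | Y⁻ u'∈
    ... | _ , c | _ , c' = from o c' (to o c e)
    apart : ∀ {w u v} → w ∉ X i × w ∉ Y i → u ∈ X i → v ∈ Y i → E G w u → ¬ E G w v
    apart o u∈ v∈ e e' with X⁻ u∈ | Y⁻ v∈
    ... | _ , c | _ , c' = flat A i _ (to o c e , to o c' e')

  X-nonempty : ∀ i → ∃ (_∈ X i)
  X-nonempty i with proj₁ (conn A i)
  ... | inj₁ p = g (inj₂ (i , inj₁ p)) , X⁺ (fg _)
  ... | inj₂ q with smoothY A i q
  ...   | p , _ = g (inj₂ (i , inj₁ p)) , X⁺ (fg _)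

  -- The Boolean names the copy of the middle vertex of the flat edge that a vertex uses; across the
  -- pair, adjacency means using the same copy.
  Copies : (i : Fin (h A)) → (V G → Bool) → Set
  Copies i copy = ∀ u v → u ∈ X i → v ∈ Y i → (E G u v → copy u ≡ copy v) × (copy u ≡ copy v → E G u v)

  -- A square is the line graph of the two paths obtained by doubling the middle vertex of the flat edge.
  copies : ∀ i → Trivial G (X i) (Y i) ⊎ IsSquare G (X i) (Y i) → ∃ (Copies i)
  -- One copy suffices: the only cross pair is an edge by smoothness.
  copies i (inj₁ (_ , only)) = (λ _ → false) , λ u v u∈ v∈ → (λ _ → refl) , λ _ →
    let (v' , v'∈ , e) = SmoothPair.smooth-X (pair i) u∈ in subst (E G u) (only v' v v'∈ v∈) e
  copies i (inj₂ (p₁ , p₂ , q₁ , q₂ , sq , onlyX , onlyY)) = copy , spec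
    where
    open Square sq
    open SmoothPair (pair i) using (disjoint)
    second? : Decidable (λ v → v ≡ p₂ ⊎ v ≡ q₂)
    second? v = (v ≟ p₂) ⊎-dec (v ≟ q₂)
    copy : V G → Bool
    copy v = does (second? v)
    copy-p₁ : copy p₁ ≡ false
    copy-p₁ with p₁ ≟ p₂ | p₁ ≟ q₂
    ... | yes refl | _ = ⊥-elim (n₂ e₁)
    ... | no _ | yes refl = ⊥-elim (disjoint p₁∈X q₂∈Y)
    ... | no _ | no _ = refl
    copy-q₁ : copy q₁ ≡ false
    copy-q₁ with q₁ ≟ p₂ | q₁ ≟ q₂
    ... | yes refl | _ = ⊥-elim (disjoint p₂∈X q₁∈Y)
    ... | no _ | yes refl = ⊥-elim (n₁ e₁)
    ... | no _ | no _ = refl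
    copy-p₂ : copy p₂ ≡ true
    copy-p₂ with p₂ ≟ p₂
    ... | yes _ = refl
    ... | no ne = ⊥-elim (ne refl)
    copy-q₂ : copy q₂ ≡ true
    copy-q₂ with q₂ ≟ p₂ | q₂ ≟ q₂
    ... | yes _ | _ = refl
    ... | no _ | yes _ = refl
    ... | no _ | no ne = ⊥-elim (ne refl)
    spec : Copies i copy
    spec u v u∈ v∈ with onlyX u u∈ | onlyY v v∈
    ... | inj₁ refl | inj₁ refl = (λ _ → trans copy-p₁ (sym copy-q₁)) , λ _ → e₁
    ... | inj₂ refl | inj₂ refl = (λ _ → trans copy-p₂ (sym copy-q₂)) , λ _ → e₂
    ... | inj₁ refl | inj₂ refl = (λ e → ⊥-elim (n₁ e)) , λ c → case trans (sym copy-p₁) (trans c copy-q₂) of λ ()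
    ... | inj₂ refl | inj₁ refl = (λ e → ⊥-elim (n₂ e)) , λ c → case trans (sym copy-p₂) (trans c copy-q₁) of λ ()

  module Labels (copy : Fin (h A) → V G → Bool) (copy-spec : ∀ i → Copies i (copy i)) where

    bit : Bool → ℕ
    bit true  = 1
    bit false = 0

    bit-injective : ∀ {c d} → bit c ≡ bit d → c ≡ d
    bit-injective {true}  {true}  _ = refl
    bit-injective {false} {false} _ = refl

    -- The tags separate the two copies of the middle vertex, and the two outer ends of the flat edge
    -- when these coincide (that is, when xᵢ and yᵢ are parallel).
    tagL tagR : AugV B A → V G → ℕ
    tagL (inj₁ _) v = 0
    tagL (inj₂ (i , s)) v with lend (x A i) ≟ lend (y A i)
    ... | yes _ = bit (copy i v)
    ... | no _ = 0
    tagR (inj₁ _) v = 0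
    tagR (inj₂ (i , s)) v with lend (x A i) ≟ lend (y A i)
    ... | no _ = bit (copy i v)
    tagR (inj₂ (i , inj₁ p)) v | yes _ = 0
    tagR (inj₂ (i , inj₂ q)) v | yes _ with rend (x A i) ≟ rend (y A i)
    ... | yes _ = 1
    ... | no _ = 0

    L R : V G → Fin (nV B) × ℕ
    L v = lend (O v) , tagL (f v) v
    R v = rend (O v) , tagR (f v) v

    private
      Foreign : Fin (h A) → Fin (nE B) → Set
      Foreign i e = e ≢ x A i × e ≢ y A i

      not-both : ∀ i e → Foreign i e → lend e ≡ lend (x A i) ⊎ rend e ≡ rend (x A i) →
        ¬ (lend e ≡ lend (y A i) ⊎ rend e ≡ rend (y A i))
      not-both i e (ne , ne') p q = flat A i e (⇒lineAdj ne p , ⇒lineAdj ne' q)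

      -- A left tag can be nonzero only if xᵢ and yᵢ share their left end, and a foreign edge at
      -- that end would form a triangle with the flat edge.
      tagL-foreign : ∀ i s v e → Foreign i e → lend e ≡ lend (origin B A (inj₂ (i , s))) → tagL (inj₂ (i , s)) v ≡ 0
      tagL-foreign i s v e fo q with lend (x A i) ≟ lend (y A i)
      ... | no _ = refl
      tagL-foreign i (inj₁ _) v e fo q | yes m = ⊥-elim (not-both i e fo (inj₁ q) (inj₁ (trans q m)))
      tagL-foreign i (inj₂ _) v e fo q | yes m = ⊥-elim (not-both i e fo (inj₁ (trans q (sym m))) (inj₁ q))

      share : ∀ i → lend (x A i) ≡ lend (y A i) ⊎ rend (x A i) ≡ rend (y A i)
      share i = proj₂ (lineAdj⇒ (edge A i))

      tagR-foreign : ∀ i s v e → Foreign i e → rend e ≡ rend (origin B A (inj₂ (i , s))) → tagR (inj₂ (i , s)) v ≡ 0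
      tagR-foreign i s v e fo q with lend (x A i) ≟ lend (y A i) | share i
      ... | no ¬m | inj₁ m = ⊥-elim (¬m m)
      tagR-foreign i (inj₁ _) v e fo q | no _ | inj₂ m = ⊥-elim (not-both i e fo (inj₂ q) (inj₂ (trans q m)))
      tagR-foreign i (inj₂ _) v e fo q | no _ | inj₂ m = ⊥-elim (not-both i e fo (inj₂ (trans q (sym m))) (inj₂ q))
      tagR-foreign i (inj₁ _) v e fo q | yes _ | _ = refl
      tagR-foreign i (inj₂ _) v e fo q | yes _ | _ with rend (x A i) ≟ rend (y A i)
      ... | yes m = ⊥-elim (not-both i e fo (inj₂ (trans q (sym m))) (inj₂ q))
      ... | no _ = refl

      foreign-origin : ∀ i w → (∀ s → w ≢ inj₂ (i , s)) → Foreign i (origin B A w)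
      foreign-origin i (inj₁ (z , pf)) _ = pf i
      foreign-origin i (inj₂ (j , s)) ne with i ≟ j
      ... | yes refl = ⊥-elim (ne s refl)
      foreign-origin i (inj₂ (j , inj₁ _)) ne | no i≢j with disj A i j i≢j
      ... | p , _ , q , _ = (λ e → p (sym e)) , λ e → q (sym e)
      foreign-origin i (inj₂ (j , inj₂ _)) ne | no i≢j with disj A i j i≢j
      ... | _ , p , _ , q = (λ e → p (sym e)) , λ e → q (sym e)

      origins-differ : ∀ {u v} → u ≢ v → Separate (f u) (f v) → O u ≢ O v
      origins-differ {u} {v} u≢v sep = go (f u) (f v) refl refl
        where
        go : ∀ w w' → f u ≡ w → f v ≡ w' → origin B A w ≢ origin B A w'
        go (inj₂ (i , inj₁ s)) w' p p' q = proj₁ (foreign-origin i w' (λ t e → sep i (inj₁ s) t p (trans p' e))) (sym q)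
        go (inj₂ (i , inj₂ s)) w' p p' q = proj₂ (foreign-origin i w' (λ t e → sep i (inj₂ s) t p (trans p' e))) (sym q)
        go (inj₁ z) (inj₂ (i , inj₁ s)) p p' q = proj₁ (foreign-origin i (inj₁ z) (λ _ ())) q
        go (inj₁ z) (inj₂ (i , inj₂ s)) p p' q = proj₂ (foreign-origin i (inj₁ z) (λ _ ())) q
        -- Without function extensionality pf and pf' may differ; u and v would then be false twins.
        go (inj₁ (z , pf)) (inj₁ (z' , pf')) p p' refl = no-false-twins (u≢v , ¬uv , twins)
          where
          Ou : O u ≡ z
          Ou = cong (origin B A) p
          Ov : O v ≡ z
          Ov = cong (origin B A) p'
          ¬uv : ¬ E G u v
          ¬uv e = proj₁ (proj₁ (E-across {u} {v} sep) e) (trans Ou (sym Ov))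
          untouched : ∀ {t pf''} → f t ≡ inj₁ (z , pf'') → ∀ w → Separate (f t) (f w)
          untouched ft w i s s' e _ = case trans (sym ft) e of λ ()
          twins : ∀ w → (E G u w → E G v w) × (E G v w → E G u w)
          twins w =
              (λ e → proj₂ (E-across {v} {w} (untouched p' w))
                (subst (λ o → LineAdj B o (O w)) (trans Ou (sym Ov)) (proj₁ (E-across {u} {w} (untouched p w)) e)))
            , (λ e → proj₂ (E-across {u} {w} (untouched p w))
                (subst (λ o → LineAdj B o (O w)) (trans Ov (sym Ou)) (proj₁ (E-across {v} {w} (untouched p' w)) e)))

      sep-tagL : ∀ {u v} → Separate (f u) (f v) → lend (O u) ≡ lend (O v) → tagL (f u) u ≡ 0
      sep-tagL {u} {v} sep q = go (f u) refl
        where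
        go : ∀ w → f u ≡ w → tagL w u ≡ 0
        go (inj₁ _) _ = refl
        go (inj₂ (i , s)) p = tagL-foreign i s u (O v) (foreign-origin i (f v) (λ t e → sep i s t p e))
                                (trans (sym q) (cong (lend ∘ origin B A) p))

      sep-tagR : ∀ {u v} → Separate (f u) (f v) → rend (O u) ≡ rend (O v) → tagR (f u) u ≡ 0
      sep-tagR {u} {v} sep q = go (f u) refl
        where
        go : ∀ w → f u ≡ w → tagR w u ≡ 0
        go (inj₁ _) _ = refl
        go (inj₂ (i , s)) p = tagR-foreign i s u (O v) (foreign-origin i (f v) (λ t e → sep i s t p e))
                                (trans (sym q) (cong (rend ∘ origin B A) p))

      sep-sym : ∀ {w w'} → Separate w w' → Separate w' w
      sep-sym sep i s t p q = sep i t s q p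

      separate-case : ∀ u v → Separate (f u) (f v) →
        (E G u v → u ≢ v × (L u ≡ L v ⊎ R u ≡ R v)) × (u ≢ v × (L u ≡ L v ⊎ R u ≡ R v) → E G u v)
      separate-case u v sep = to , from
        where
        to : E G u v → u ≢ v × (L u ≡ L v ⊎ R u ≡ R v)
        to e = E⇒≢ e , (case proj₂ (lineAdj⇒ (proj₁ (E-across {u} {v} sep) e)) of λ
          { (inj₁ q) → inj₁ (cong₂ _,_ q (trans (sep-tagL {u} {v} sep q) (sym (sep-tagL {v} {u} (sep-sym sep) (sym q)))))
          ; (inj₂ q) → inj₂ (cong₂ _,_ q (trans (sep-tagR {u} {v} sep q) (sym (sep-tagR {v} {u} (sep-sym sep) (sym q))))) })
        from : u ≢ v × (L u ≡ L v ⊎ R u ≡ R v) → E G u v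
        from (ne , s) = proj₂ (E-across {u} {v} sep) (⇒lineAdj (origins-differ {u} {v} ne sep)
          ([ (λ q → inj₁ (cong proj₁ q)) , (λ q → inj₂ (cong proj₁ q)) ]′ s))

      labels : AugV B A → V G → (Fin (nV B) × ℕ) × (Fin (nV B) × ℕ)
      labels w v = (lend (origin B A w) , tagL w v) , (rend (origin B A w) , tagR w v)

      Shares : (p q : (Fin (nV B) × ℕ) × (Fin (nV B) × ℕ)) → Set
      Shares p q = proj₁ p ≡ proj₁ q ⊎ proj₂ p ≡ proj₂ q

      outer-X : ∀ i p p' u v → Shares (labels (inj₂ (i , inj₁ p)) u) (labels (inj₂ (i , inj₁ p')) v)
      outer-X i p p' u v with lend (x A i) ≟ lend (y A i)
      ... | yes _ = inj₂ refl
      ... | no _ = inj₁ refl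

      outer-Y : ∀ i q q' u v → Shares (labels (inj₂ (i , inj₂ q)) u) (labels (inj₂ (i , inj₂ q')) v)
      outer-Y i q q' u v with lend (x A i) ≟ lend (y A i)
      ... | no _ = inj₁ refl
      ... | yes _ with rend (x A i) ≟ rend (y A i)
      ...   | yes _ = inj₂ refl
      ...   | no _ = inj₂ refl

      middle⇒ : ∀ i p q u v → copy i u ≡ copy i v → Shares (labels (inj₂ (i , inj₁ p)) u) (labels (inj₂ (i , inj₂ q)) v)
      middle⇒ i p q u v c with lend (x A i) ≟ lend (y A i) | share i
      ... | yes m | _ = inj₁ (cong₂ _,_ m (cong bit c))
      ... | no ¬m | inj₁ m = ⊥-elim (¬m m)
      ... | no _ | inj₂ m = inj₂ (cong₂ _,_ m (cong bit c))

      ⇒middle : ∀ i p q u v → Shares (labels (inj₂ (i , inj₁ p)) u) (labels (inj₂ (i , inj₂ q)) v) → copy i u ≡ copy i v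
      ⇒middle i p q u v s with lend (x A i) ≟ lend (y A i)
      ⇒middle i p q u v (inj₁ s) | no ¬m = ⊥-elim (¬m (cong proj₁ s))
      ⇒middle i p q u v (inj₂ s) | no ¬m = bit-injective (cong proj₂ s)
      ⇒middle i p q u v (inj₁ s) | yes _ = bit-injective (cong proj₂ s)
      ⇒middle i p q u v (inj₂ s) | yes _ with rend (x A i) ≟ rend (y A i)
      ... | yes _ = case cong proj₂ s of λ ()
      ... | no ¬m = ⊥-elim (¬m (cong proj₁ s))

      shares-sym : ∀ {p q} → Shares p q → Shares q p
      shares-sym (inj₁ e) = inj₁ (sym e)
      shares-sym (inj₂ e) = inj₂ (sym e)

      same-case : ∀ i s t u v → f u ≡ inj₂ (i , s) → f v ≡ inj₂ (i , t) →
        (E G u v → u ≢ v × Shares (labels (inj₂ (i , s)) u) (labels (inj₂ (i , t)) v)) ×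
        (u ≢ v × Shares (labels (inj₂ (i , s)) u) (labels (inj₂ (i , t)) v) → E G u v)
      same-case i (inj₁ p) (inj₁ p') u v e e' = (λ h → E⇒≢ h , outer-X i p p' u v) ,
        λ { (ne , _) → SmoothPair.X-clique (pair i) u v (X⁺ e) (X⁺ e') ne }
      same-case i (inj₂ q) (inj₂ q') u v e e' = (λ h → E⇒≢ h , outer-Y i q q' u v) ,
        λ { (ne , _) → SmoothPair.Y-clique (pair i) u v (Y⁺ e) (Y⁺ e') ne }
      same-case i (inj₁ p) (inj₂ q) u v e e' = (λ h → E⇒≢ h , middle⇒ i p q u v (proj₁ (copy-spec i u v (X⁺ e) (Y⁺ e')) h)) ,
        λ { (_ , s) → proj₂ (copy-spec i u v (X⁺ e) (Y⁺ e')) (⇒middle i p q u v s) }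
      same-case i (inj₂ q) (inj₁ p) u v e e' =
        (λ h → E⇒≢ h , shares-sym (middle⇒ i p q v u (proj₁ (copy-spec i v u (X⁺ e') (Y⁺ e)) (E-sym h)))) ,
        λ { (_ , s) → E-sym (proj₂ (copy-spec i v u (X⁺ e') (Y⁺ e)) (⇒middle i p q v u (shares-sym s))) }

      same-or-separate : ∀ w w' → (∃[ i ] ∃[ s ] ∃[ t ] (w ≡ inj₂ (i , s) × w' ≡ inj₂ (i , t))) ⊎ Separate w w'
      same-or-separate (inj₁ _) w' = inj₂ λ _ _ _ ()
      same-or-separate (inj₂ _) (inj₁ _) = inj₂ λ _ _ _ _ ()
      same-or-separate (inj₂ (i , s)) (inj₂ (j , t)) with i ≟ j
      ... | yes refl = inj₁ (i , s , t , refl , refl)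
      ... | no ne = inj₂ λ { _ _ _ refl refl → ne refl }

    isLabelling : IsLabelling G L R
    isLabelling u v with same-or-separate (f u) (f v)
    ... | inj₂ sep = separate-case u v sep
    ... | inj₁ (i , s , t , p , q) = subst₂ (λ w w' → (E G u v → u ≢ v × Shares (labels w u) (labels w' v)) ×
            (u ≢ v × Shares (labels w u) (labels w' v) → E G u v)) (sym p) (sym q) (same-case i s t u v p q)

theorem4p9 : (G : Graph) (Z : Subset (size G)) → Suspect G Z →
    ¬ SmoothAugOfLineGraphOfBipartiteMultigraph G
theorem4p9 G Z suspect@((_ , innocent , consistent , all-safe , none) , _) (B , A , iso) =
  ¬¬-∀Fin (λ i → gadget (pair i) (X-nonempty i)) λ shapes →
    let open Labels (λ i → proj₁ (copies i (shapes i))) (λ i → proj₂ (copies i (shapes i)))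
    in StrongMatching.strong-superset G _≟ₗ_ _≟ₗ_ L R isLabelling innocent Z all-safe consistent none
  where
  open SuspectPair suspect
  open Augmented suspect B A iso
  _≟ₗ_ : (p q : Fin (nV B) × ℕ) → Dec (p ≡ q)
  _≟ₗ_ = ×-≡-dec _≟_ ℕₚ._≟_
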